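{- For all $n\geq6$, the second largest eigenvalue of $A_{[2,2,1^{n-4}]}$ is $$\phi^{[n-1,1]}_{[2,2,1^{n-4}]}=\tfrac12n^4-5n^3+\tfrac{33}{2}n^2-20n+6,$$ i.e. $\phi^\lambda_{[2,2,1^{n-4}]}\leq\phi^{[n-1,1]}_{[2,2,1^{n-4}]}$ for all $\lambda\vdash n$, $\lambda\neq[n]$. The spectral gap of the corresponding graph is $\phi^{[n]}_{[2,2,1^{n-4}]}-\phi^{[n-1,1]}_{[2,2,1^{n-4}]}=2n^3-11n^2+17n-6$.
   Context: For $n\geq1$ let $\mathcal{M}_{2n}$ be the set of perfect matchings of $K_{2n}$ on $\{1,\dots,2n\}$. For $P,Q\in\mathcal{M}_{2n}$, $P\cup Q$ is a disjoint union of even cycles (a common edge counts as a $2$-cycle); if their lengths are $2\mu_1\geq\dots\geq 2\mu_k$, $P,Q$ are $\mu$-related, $\mu=[\mu_1,\dots,\mu_k]\vdash n$. $A_\mu$ is the $0/1$ matrix on $\mathcal{M}_{2n}$ with $(P,Q)$-entry $1$ iff $P,Q$ are $\mu$-related. The $A_\mu$ commute; their common eigenspaces are indexed by $\lambda\vdash n$, the $\lambda$-eigenspace being the isotypic component of the permutation representation of $S_{2n}$ on $\mathcal{M}_{2n}$ affording the Specht module $S^{2\lambda}$, $2\lambda=[2\lambda_1,2\lambda_2,\dots]$. $\phi^\lambda_\mu$ is the eigenvalue of $A_\mu$ on the $\lambda$-eigenspace; the largest eigenvalue is the valency $\phi^{[n]}_\mu$. $1^a$ denotes $a$ parts equal to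 $1$. -}

module Defs where

open import Data.Bool using (Bool; true; false; _∧_; _∨_; not; if_then_else_; T)
open import Data.Nat as ℕ using (ℕ; zero; suc; _∸_; _≤_; _<ᵇ_; _≡ᵇ_)
open import Data.Nat.Properties using ()
open import Data.Fin as F using (Fin; toℕ)
open import Data.Fin.Properties using () renaming (_≟_ to _≟ᶠ_)
open import Data.Vec as V using (Vec; []; _∷_; lookup; _[_]≔_)
open import Data.List as L using (List; []; _∷_; map; concatMap; filterᵇ; foldr; allFin; replicate; length)
import Data.List.Relation.Unary.All as All
open import Data.List.Membership.Propositional using (_∈_)
open import Data.Integer using (+_)
open import Data.Rational using (ℚ; 0ℚ; 1ℚ; _+_; _*_; -_; _/_)
open import Data.Unit using (⊤)
open import Data.Nat.ListAction using (sum)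
open import Data.Product using (Σ; _×_; ∃)
open import Relation.Nullary using (¬_; does)
open import Relation.Binary.PropositionalEquality using (_≡_; _≢_)

Decreasing : List ℕ → Set
Decreasing [] = ⊤
Decreasing (x ∷ []) = ⊤
Decreasing (x ∷ y ∷ xs) = (y ≤ x) × Decreasing (y ∷ xs)

_⊢_ : List ℕ → ℕ → Set
λ' ⊢ n = Decreasing λ' × All.All (λ p → 1 ≤ p) λ' × (sum λ' ≡ n)

double : List ℕ → List ℕ
double = map (2 ℕ.*_)

Perm : ℕ → Set
Perm m = Vec (Fin m) m

insertAll : ∀ {A : Set} {k} → A → Vec A k → List (Vec A (suc k))
insertAll x [] = (x ∷ []) ∷ []
insertAll x (y ∷ ys) = (x ∷ y ∷ ys) ∷ map (y ∷_) (insertAll x ys)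

perms : ∀ {A : Set} {k} → Vec A k → List (Vec A k)
perms [] = [] ∷ []
perms (x ∷ xs) = concatMap (insertAll x) (perms xs)

allPerms : ∀ m → List (Perm m)
allPerms m = perms (V.allFin m)

_==ᶠ_ : ∀ {m} → Fin m → Fin m → Bool
i ==ᶠ j = does (i ≟ᶠ j)

allᵇ : ∀ {A : Set} → (A → Bool) → List A → Bool
allᵇ p = foldr (λ x b → p x ∧ b) true

countᵇ : ∀ {A : Set} → (A → Bool) → List A → ℕ
countᵇ p xs = length (filterᵇ p xs)

inversions : ∀ {m} → Perm m → ℕ
inversions {m} σ =
  sum (map (λ i → countᵇ (λ j → (toℕ i <ᵇ toℕ j) ∧ (toℕ (lookup σ j) <ᵇ toℕ (lookup σ i))) (allFin m)) (allFin m))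

sgn : ∀ {m} → Perm m → ℚ
sgn σ = if (inversions σ ℕ.% 2) ≡ᵇ 0 then 1ℚ else - 1ℚ

_∘ₚ_ : ∀ {m} → Perm m → Perm m → Perm m
σ ∘ₚ τ = V.map (lookup σ) τ

-- Perfect matchings of K_{2n} on {0,…,2n-1}, represented as fixed-point-free
-- involutions P (the edges are {i , P i}).

isMatching : ∀ {m} → Perm m → Bool
isMatching {m} P = allᵇ (λ i → (lookup P (lookup P i) ==ᶠ i) ∧ not (lookup P i ==ᶠ i)) (allFin m)

matchings : ∀ m → List (Perm m)
matchings m = filterᵇ isMatching (allPerms m)

-- action of S_m on matchings: g · P = g P g⁻¹, i.e. edge {i , P i} ↦ {g i , g (P i)}
act : ∀ {m} → Perm m → Perm m → Perm m
act {m} g P = foldr (λ i v → v [ lookup g i ]≔ lookup g (lookup P i)) P (allFin m)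

-- μ-relatedness.
-- For matchings P, Q the permutation P ∘ Q maps each cycle of P ∪ Q of length
-- 2k to itself, acting on its 2k vertices with orbits of size k.  So the
-- cycle type of P ∪ Q is [2μ₁,…,2μ_k] iff for every k the number of vertices i
-- whose (P ∘ Q)-orbit has size k equals 2k · #{j : μ_j = k}.

orbitLen : ∀ {m} → Perm m → Fin m → ℕ
orbitLen {m} σ i = go m 1 (lookup σ i)
  where
    go : ℕ → ℕ → Fin m → ℕ
    go zero k x = k
    go (suc f) k x = if x ==ᶠ i then k else go f (suc k) (lookup σ x)

related : ∀ {m} → List ℕ → Perm m → Perm m → Bool
related {m} μ P Q =
  allᵇ (λ k → countᵇ (λ i → orbitLen (P ∘ₚ Q) i ≡ᵇ k) (allFin m)
              ≡ᵇ (2 ℕ.* k ℕ.* countᵇ (_≡ᵇ k) μ))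
       (L.upTo (suc m))

-- The permutation module ℚ[𝓜_m]: functions on matchings (we take functions on
-- all of Perm m and only ever evaluate/compare them at matchings).

Fun : ℕ → Set
Fun m = Perm m → ℚ

Σℚ : ∀ {A : Set} → List A → (A → ℚ) → ℚ
Σℚ xs f = foldr (λ x r → f x + r) 0ℚ xs

Amul : ∀ {m} → List ℕ → Fun m → Fun m
Amul {m} μ w P = Σℚ (matchings m) (λ Q → if related μ P Q then w Q else 0ℚ)

-- Young symmetrizer of the standard row-reading tableau T₀ of shape ν
-- (entries 0,…,m-1 filled row by row), and the ν-isotypic component.

rowOf : List ℕ → ℕ → ℕ
rowOf [] k = 0
rowOf (r ∷ rs) k = if k <ᵇ r then 0 else suc (rowOf rs (k ∸ r))

colOf : List ℕ → ℕ → ℕ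
colOf [] k = k
colOf (r ∷ rs) k = if k <ᵇ r then k else colOf rs (k ∸ r)

rowGroup : ∀ m → List ℕ → List (Perm m)
rowGroup m ν = filterᵇ (λ σ → allᵇ (λ k → rowOf ν (toℕ (lookup σ k)) ≡ᵇ rowOf ν (toℕ k)) (allFin m)) (allPerms m)

colGroup : ∀ m → List ℕ → List (Perm m)
colGroup m ν = filterᵇ (λ σ → allᵇ (λ k → colOf ν (toℕ (lookup σ k)) ≡ᵇ colOf ν (toℕ k)) (allFin m)) (allPerms m)

-- The S^ν-isotypic component of the permutation module is the image of the
-- two-sided ideal generated by the Young symmetrizer c = (Σ_{q∈C} sgn q · q)(Σ_{p∈R} p),
-- i.e. the span of { g c w : g ∈ S_m , w }.  Writing the left action via
-- (g w)(P) = w(g⁻¹ · P) and reindexing the (inverse-closed) sums, an element of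
-- this span is exactly a function of the form
--   P ↦ Σ_g Σ_{q∈C} Σ_{p∈R} sgn q · u_g (p · (q · (g · P))).
InIsotypic : ∀ m → List ℕ → Fun m → Set
InIsotypic m ν w =
  Σ (Perm m → Fun m) λ u →
    ∀ P → P ∈ matchings m →
      w P ≡ Σℚ (allPerms m) (λ g → Σℚ (colGroup m ν) (λ q → Σℚ (rowGroup m ν) (λ p →
              sgn q * u g (act p (act q (act g P))))))

-- φ is the eigenvalue φ^λ_μ of A_μ on the λ-eigenspace (the S^{2λ}-isotypic
-- component of the permutation representation of S_{2n} on 𝓜_{2n}):
-- there is a nonzero vector of that component which A_μ scales by φ.
IsEigenvalue : (n : ℕ) → (λ' μ : List ℕ) → ℚ → Set
IsEigenvalue n λ' μ φ =
  Σ (Fun (2 ℕ.* n)) λ w →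
    InIsotypic (2 ℕ.* n) (double λ') w
    × ∃ (λ P → P ∈ matchings (2 ℕ.* n) × w P ≢ 0ℚ)
    × (∀ P → P ∈ matchings (2 ℕ.* n) → Amul μ w P ≡ φ * w P)

ℚ[_] : ℕ → ℚ
ℚ[ k ] = + k / 1

-- On the isotypic component of a shape, the sums of w(t_ab P) over all pairs and of w(t_ab t_bc P) over all triples of
-- vertices are multiples of w(P). Indeed in the Young symmetrizer a transposition inside a row is absorbed, one inside a
-- column changes the sign, and a transposition or 3-cycle of cells in different rows and columns kills the term.
-- A switch P ↦ t_ac t_bd P with a, b, c, d on four distinct edges leads to a [2,2,1^(n-4)]-related matching, and each
-- such matching is reached 32 times; Möbius inversion over the partitions of {a, b, c, d} expresses the sum over these
-- switches by the pair and triple sums. Hence the eigenvalue is a polynomial in the numbers of pairs and triples of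
-- cells of λ that lie in one row, lie in one column, or form a hook. Two linear inequalities between these numbers hold
-- triple by triple, and with the range of y = 2 #(row pairs) - #(column pairs), which for λ ≠ [n] is at most
-- 2 (n - 1)², they bound the eigenvalue, except for a gap at n = 6 in which y never lies.

module Submission where

open import Defs
open import Data.Bool using (Bool; true; false; _∧_; _∨_; not; if_then_else_; T)
open import Data.Bool.Properties using (∧-zeroʳ; ∨-comm; not-injective) renaming (_≟_ to _≟ᵇ_)
open import Data.Empty using (⊥; ⊥-elim)
open import Data.Fin as F using (Fin; toℕ)
import Data.Fin.Properties as Fₚ
open import Data.Fin.Properties using () renaming (_≟_ to _≟ᶠ_)
import Data.Integer as ℤ
import Data.Integer.Properties as ℤₚ
open import Data.List as L using (List; []; _∷_; map; concatMap; filterᵇ; allFin; replicate; length; _++_)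
import Data.List.Properties as Lₚ
open import Data.List.Membership.Propositional using (_∈_; _∉_; find; lose)
open import Data.List.Membership.Propositional.Properties using (∈-concatMap⁺; ∈-concatMap⁻; ∈-map⁺; ∈-map⁻; ∈-filter⁺; ∈-filter⁻; ∈-allFin; ∈-upTo⁺; ∈-++⁺ˡ; ∈-++⁺ʳ)
open import Data.List.Membership.Propositional.Properties.WithK using (unique∧set⇒bag)
open import Data.List.Relation.Binary.BagAndSetEquality using (∼bag⇒↭)
open import Data.List.Relation.Binary.Permutation.Propositional using (_↭_; ↭-sym; ↭-trans; ↭-refl; ↭-reflexive; ↭⇒↭ₛ)
import Data.List.Relation.Binary.Permutation.Propositional as Perm↭
open import Data.List.Relation.Binary.Permutation.Propositional.Properties using (∈-resp-↭; drop-∷)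
import Data.List.Relation.Binary.Permutation.Setoid.Properties as PermS
open import Data.List.Relation.Unary.All as All using (All; []; _∷_; all?)
open import Data.List.Relation.Unary.AllPairs using ([]; _∷_)
open import Data.List.Relation.Unary.Any using (here; there)
open import Data.List.Relation.Unary.Unique.Propositional using (Unique)
import Data.List.Relation.Unary.Unique.Propositional.Properties as Uₚ
open import Data.Nat as ℕ using (ℕ; zero; suc; _<ᵇ_; _≡ᵇ_)
import Data.Nat.Coprimality as Coprime
open import Data.Nat.ListAction using (sum)
import Data.Nat.Properties as ℕₚ
open import Data.Product using (Σ; _×_; ∃; _,_; proj₁; proj₂)
open import Data.Rational as ℚ using (ℚ; mkℚ; 0ℚ; 1ℚ; ½; _+_; _*_; -_; _-_) renaming (_≤_ to _≤ℚ_)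
import Data.Rational.Properties as ℚₚ
import Data.Rational.Unnormalised as ℚᵘ
import Data.Rational.Unnormalised.Properties as ℚᵘₚ
open import Data.Sum using (_⊎_; inj₁; inj₂; [_,_]′)
open import Data.Vec as V using (Vec; []; _∷_; lookup; _[_]≔_)
import Data.Vec.Properties as Vₚ
open import Function using (_∘_; id; case_of_)
open import Function.Bundles using (mk⇔)
open import Level using (0ℓ)
open import Relation.Binary using (tri<; tri≈; tri>)
open import Relation.Binary.PropositionalEquality hiding ([_])
open import Relation.Nullary using (¬_; Dec; yes; no; does)
open import Relation.Nullary.Decidable using (dec-true; dec-false; dec⇒maybe; from-yes; map′; T?; _×-dec_; _⊎-dec_; _→-dec_)
open import Tactic.Cong using (cong!)
open import Tactic.RingSolver using (solve-∀)
open import Tactic.RingSolver.Core.AlmostCommutativeRing using (AlmostCommutativeRing; fromCommutativeRing)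
open ≡-Reasoning

-- Finite sums of rationals

-- The condition on four distinct edges refers to P, so the sum over switches is not a class sum of
-- the symmetric group. Sums over all vertices are, hence they are central and act by scalars.
-- Möbius inversion trades the condition for coincidences of edges, and each coincidence collapses
-- because exchanging the two ends of an edge fixes P. What survives is the class sum of
-- transpositions, its square, and the class sum of 3-cycles. With q the statistic of triples, 8 φ =
-- y² - (4 n - 22) y - 2 q - 24 n. A lower bound for q that is linear in y turns this into a convex
-- quadratic in y, so only the ends of the range of y matter. The first bound for q is an equality
-- for shapes with at most two rows, which makes the estimate sharp at [n-1,1], where y = 2 (n -
-- 1)². It is too weak for small y; there the second bound, an equality for a single column, takes
-- over. That the claimed value really occurs needs in addition a nonzero vector of the component of
-- 2 [n-1,1], which is written down explicitly.

ℚ-ring : AlmostCommutativeRing 0ℓ 0ℓ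
ℚ-ring = fromCommutativeRing ℚₚ.+-*-commutativeRing (λ x → dec⇒maybe (0ℚ ℚₚ.≟ x))

-- ℚ[ k ] is normalised through a gcd, which makes it expensive as a coefficient for the ring solver.
⟦_⟧ : ℕ → ℚ
⟦ k ⟧ = mkℚ (ℤ.+ k) 0 (Coprime.sym (Coprime.1-coprimeTo k))

-- Addition in ℚ normalises its result, so the equation becomes visible only among unnormalised
-- fractions.
ℚ[]-+ : ∀ a b → ℚ[ a ℕ.+ b ] ≡ ℚ[ a ] + ℚ[ b ]
ℚ[]-+ a b = ℚₚ.toℚᵘ-injective (ℚᵘₚ.≃-trans (ℚₚ.toℚᵘ-fromℚᵘ (ℚᵘ.mkℚᵘ (ℤ.+ (a ℕ.+ b)) 0))
  (ℚᵘₚ.≃-sym (ℚᵘₚ.≃-trans (ℚₚ.toℚᵘ-homo-+ ℚ[ a ] ℚ[ b ])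
    (ℚᵘₚ.≃-trans (ℚᵘₚ.+-cong (ℚₚ.toℚᵘ-fromℚᵘ (ℚᵘ.mkℚᵘ (ℤ.+ a) 0)) (ℚₚ.toℚᵘ-fromℚᵘ (ℚᵘ.mkℚᵘ (ℤ.+ b) 0)))
      (ℚᵘ.*≡* (cong (ℤ._* ℤ.+ 1) (cong₂ ℤ._+_ (ℤₚ.*-identityʳ (ℤ.+ a)) (ℤₚ.*-identityʳ (ℤ.+ b)))))))))

ℚ[]-suc : ∀ a → ℚ[ suc a ] ≡ 1ℚ + ℚ[ a ]
ℚ[]-suc = ℚ[]-+ 1

ℚ[]-* : ∀ a b → ℚ[ a ℕ.* b ] ≡ ℚ[ a ] * ℚ[ b ]
ℚ[]-* zero b = sym (ℚₚ.*-zeroˡ ℚ[ b ])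
ℚ[]-* (suc a) b = begin
  ℚ[ b ℕ.+ a ℕ.* b ]       ≡⟨ ℚ[]-+ b (a ℕ.* b) ⟩
  ℚ[ b ] + ℚ[ a ℕ.* b ]    ≡⟨ cong (ℚ[ b ] +_) (ℚ[]-* a b) ⟩
  ℚ[ b ] + ℚ[ a ] * ℚ[ b ] ≡⟨ lem ℚ[ a ] ℚ[ b ] ⟩
  (1ℚ + ℚ[ a ]) * ℚ[ b ]   ≡⟨ cong (_* ℚ[ b ]) (sym (ℚ[]-suc a)) ⟩
  ℚ[ suc a ] * ℚ[ b ] ∎
  where
  lem : ∀ x y → y + x * y ≡ (1ℚ + x) * y
  lem = solve-∀ ℚ-ring

0≤ℚ[] : ∀ a → 0ℚ ≤ℚ ℚ[ a ]
0≤ℚ[] zero = ℚₚ.≤-refl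
0≤ℚ[] (suc a) = subst (0ℚ ≤ℚ_) (sym (ℚ[]-suc a)) (ℚₚ.+-mono-≤ {0ℚ} {1ℚ} {0ℚ} (ℚₚ.nonNegative⁻¹ 1ℚ) (0≤ℚ[] a))

𝟙 : Bool → ℚ
𝟙 true = 1ℚ
𝟙 false = 0ℚ

𝟙-∧ : ∀ a b → 𝟙 (a ∧ b) ≡ 𝟙 a * 𝟙 b
𝟙-∧ true b = sym (ℚₚ.*-identityˡ (𝟙 b))
𝟙-∧ false b = sym (ℚₚ.*-zeroˡ (𝟙 b))

0≤𝟙 : ∀ b → 0ℚ ≤ℚ 𝟙 b
0≤𝟙 true = ℚₚ.nonNegative⁻¹ 1ℚ
0≤𝟙 false = ℚₚ.≤-refl

if-𝟙 : ∀ b (x : ℚ) → (if b then x else 0ℚ) ≡ 𝟙 b * x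
if-𝟙 true x = sym (ℚₚ.*-identityˡ x)
if-𝟙 false x = sym (ℚₚ.*-zeroˡ x)

module _ {A : Set} where

  Σ-cong∈ : (xs : List A) {f g : A → ℚ} → (∀ x → x ∈ xs → f x ≡ g x) → Σℚ xs f ≡ Σℚ xs g
  Σ-cong∈ [] h = refl
  Σ-cong∈ (x ∷ xs) h = cong₂ _+_ (h x (here refl)) (Σ-cong∈ xs (λ y y∈ → h y (there y∈)))

  Σ-cong : (xs : List A) {f g : A → ℚ} → (∀ x → f x ≡ g x) → Σℚ xs f ≡ Σℚ xs g
  Σ-cong xs h = Σ-cong∈ xs (λ x _ → h x)

  Σ-0 : (xs : List A) → Σℚ xs (λ _ → 0ℚ) ≡ 0ℚ
  Σ-0 [] = refl
  Σ-0 (x ∷ xs) = trans (ℚₚ.+-identityˡ _) (Σ-0 xs)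

  Σ-+ : (xs : List A) (f g : A → ℚ) → Σℚ xs (λ x → f x + g x) ≡ Σℚ xs f + Σℚ xs g
  Σ-+ [] f g = refl
  Σ-+ (x ∷ xs) f g = trans (cong (f x + g x +_) (Σ-+ xs f g)) (lem (f x) (g x) (Σℚ xs f) (Σℚ xs g))
    where
    lem : ∀ a b c d → (a + b) + (c + d) ≡ (a + c) + (b + d)
    lem = solve-∀ ℚ-ring

  Σ-*ˡ : (xs : List A) (c : ℚ) (f : A → ℚ) → Σℚ xs (λ x → c * f x) ≡ c * Σℚ xs f
  Σ-*ˡ [] c f = sym (ℚₚ.*-zeroʳ c)
  Σ-*ˡ (x ∷ xs) c f = trans (cong (c * f x +_) (Σ-*ˡ xs c f)) (sym (ℚₚ.*-distribˡ-+ c (f x) (Σℚ xs f)))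

  Σ-*ʳ : (xs : List A) (c : ℚ) (f : A → ℚ) → Σℚ xs (λ x → f x * c) ≡ Σℚ xs f * c
  Σ-*ʳ xs c f = trans (Σ-cong xs (λ x → ℚₚ.*-comm (f x) c)) (trans (Σ-*ˡ xs c f) (ℚₚ.*-comm c _))

  Σ-neg : (xs : List A) (f : A → ℚ) → Σℚ xs (λ x → - f x) ≡ - Σℚ xs f
  Σ-neg xs f = begin
    Σℚ xs (λ x → - f x)       ≡⟨ Σ-cong xs (λ x → lem (f x)) ⟩
    Σℚ xs (λ x → - 1ℚ * f x)  ≡⟨ Σ-*ˡ xs (- 1ℚ) f ⟩
    - 1ℚ * Σℚ xs f            ≡⟨ sym (lem (Σℚ xs f)) ⟩
    - Σℚ xs f ∎
    where
    lem : ∀ a → - a ≡ - 1ℚ * a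
    lem = solve-∀ ℚ-ring

  Σ-- : (xs : List A) (f g : A → ℚ) → Σℚ xs (λ x → f x - g x) ≡ Σℚ xs f - Σℚ xs g
  Σ-- xs f g = trans (Σ-+ xs f (λ x → - g x)) (cong (Σℚ xs f +_) (Σ-neg xs g))

  Σ-const : (xs : List A) (c : ℚ) → Σℚ xs (λ _ → c) ≡ ℚ[ length xs ] * c
  Σ-const [] c = sym (ℚₚ.*-zeroˡ c)
  Σ-const (x ∷ xs) c = begin
    c + Σℚ xs (λ _ → c)     ≡⟨ cong (c +_) (Σ-const xs c) ⟩
    c + ℚ[ length xs ] * c  ≡⟨ lem ℚ[ length xs ] c ⟩
    (1ℚ + ℚ[ length xs ]) * c ≡⟨ cong (_* c) (sym (ℚ[]-suc (length xs))) ⟩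
    ℚ[ suc (length xs) ] * c ∎
    where
    lem : ∀ x y → y + x * y ≡ (1ℚ + x) * y
    lem = solve-∀ ℚ-ring

  Σ-≥0∈ : (xs : List A) (f : A → ℚ) → (∀ x → x ∈ xs → 0ℚ ≤ℚ f x) → 0ℚ ≤ℚ Σℚ xs f
  Σ-≥0∈ [] f h = ℚₚ.≤-refl
  Σ-≥0∈ (x ∷ xs) f h = ℚₚ.+-mono-≤ {0ℚ} {f x} {0ℚ} (h x (here refl)) (Σ-≥0∈ xs f (λ y y∈ → h y (there y∈)))

  Σ-≥term∈ : (xs : List A) (f : A → ℚ) → (∀ x → x ∈ xs → 0ℚ ≤ℚ f x) → ∀ {x} → x ∈ xs → f x ≤ℚ Σℚ xs f
  Σ-≥term∈ (x ∷ xs) f h (here refl) =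
    subst (_≤ℚ f x + Σℚ xs f) (ℚₚ.+-identityʳ (f x)) (ℚₚ.+-monoʳ-≤ (f x) (Σ-≥0∈ xs f (λ y y∈ → h y (there y∈))))
  Σ-≥term∈ (x ∷ xs) f h {y} (there y∈) =
    subst (_≤ℚ f x + Σℚ xs f) (ℚₚ.+-identityˡ (f y)) (ℚₚ.+-mono-≤ (h x (here refl)) (Σ-≥term∈ xs f (λ z z∈ → h z (there z∈)) y∈))

  Σ-↭ : {xs ys : List A} (f : A → ℚ) → xs ↭ ys → Σℚ xs f ≡ Σℚ ys f
  Σ-↭ f Perm↭.refl = refl
  Σ-↭ f (Perm↭.prep x p) = cong (f x +_) (Σ-↭ f p)
  Σ-↭ f (Perm↭.swap x y p) = trans (cong (λ z → f x + (f y + z)) (Σ-↭ f p)) (lem (f x) (f y) _)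
    where
    lem : ∀ a b c → a + (b + c) ≡ b + (a + c)
    lem = solve-∀ ℚ-ring
  Σ-↭ f (Perm↭.trans p q) = trans (Σ-↭ f p) (Σ-↭ f q)

  Σ-filter : (p : A → Bool) (xs : List A) (f : A → ℚ) → Σℚ (filterᵇ p xs) f ≡ Σℚ xs (λ x → 𝟙 (p x) * f x)
  Σ-filter p [] f = refl
  Σ-filter p (x ∷ xs) f with p x
  ... | true = cong₂ _+_ (sym (ℚₚ.*-identityˡ (f x))) (Σ-filter p xs f)
  ... | false = trans (Σ-filter p xs f)
                  (trans (sym (ℚₚ.+-identityˡ _)) (cong (_+ _) (sym (ℚₚ.*-zeroˡ (f x)))))

  Σ-countᵇ : (p : A → Bool) (xs : List A) → Σℚ xs (λ x → 𝟙 (p x)) ≡ ℚ[ countᵇ p xs ]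
  Σ-countᵇ p xs = begin
    Σℚ xs (λ x → 𝟙 (p x))       ≡⟨ Σ-cong xs (λ x → sym (ℚₚ.*-identityʳ (𝟙 (p x)))) ⟩
    Σℚ xs (λ x → 𝟙 (p x) * 1ℚ)  ≡⟨ sym (Σ-filter p xs (λ _ → 1ℚ)) ⟩
    Σℚ (filterᵇ p xs) (λ _ → 1ℚ) ≡⟨ Σ-const (filterᵇ p xs) 1ℚ ⟩
    ℚ[ countᵇ p xs ] * 1ℚ       ≡⟨ ℚₚ.*-identityʳ _ ⟩
    ℚ[ countᵇ p xs ] ∎

  Σ-δ : (d : A → Bool) {xs : List A} {x : A} → Unique xs → x ∈ xs → d x ≡ true →
        (∀ y → y ∈ xs → y ≢ x → d y ≡ false) → (f : A → ℚ) → Σℚ xs (λ y → 𝟙 (d y) * f y) ≡ f x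
  Σ-δ d {x ∷ xs} (x∉ ∷ u) (here refl) dx dy f = begin
    𝟙 (d x) * f x + Σℚ xs (λ y → 𝟙 (d y) * f y)
      ≡⟨ cong₂ _+_ (trans (cong (λ b → 𝟙 b * f x) dx) (ℚₚ.*-identityˡ (f x)))
          (trans (Σ-cong∈ xs (λ y y∈ → trans (cong (λ b → 𝟙 b * f y) (dy y (there y∈) (λ y≡x → All.lookup x∉ y∈ (sym y≡x)))) (ℚₚ.*-zeroˡ (f y)))) (Σ-0 xs)) ⟩
    f x + 0ℚ ≡⟨ ℚₚ.+-identityʳ (f x) ⟩
    f x ∎
  Σ-δ d {z ∷ xs} {x} (z∉ ∷ u) (there x∈) dx dy f = begin
    𝟙 (d z) * f z + Σℚ xs (λ y → 𝟙 (d y) * f y)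
      ≡⟨ cong₂ _+_ (trans (cong (λ b → 𝟙 b * f z) (dy z (here refl) (All.lookup z∉ x∈))) (ℚₚ.*-zeroˡ (f z)))
          (Σ-δ d u x∈ dx (λ y y∈ → dy y (there y∈)) f) ⟩
    0ℚ + f x ≡⟨ ℚₚ.+-identityˡ (f x) ⟩
    f x ∎

Σ-map : {A B : Set} (h : A → B) (xs : List A) (f : B → ℚ) → Σℚ (map h xs) f ≡ Σℚ xs (f ∘ h)
Σ-map h [] f = refl
Σ-map h (x ∷ xs) f = cong (f (h x) +_) (Σ-map h xs f)

Σ-swap : {A B : Set} (xs : List A) (ys : List B) (f : A → B → ℚ) →
         Σℚ xs (λ x → Σℚ ys (f x)) ≡ Σℚ ys (λ y → Σℚ xs (λ x → f x y))
Σ-swap [] ys f = sym (Σ-0 ys)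
Σ-swap (x ∷ xs) ys f = trans (cong (Σℚ ys (f x) +_) (Σ-swap xs ys f)) (sym (Σ-+ ys (f x) (λ y → Σℚ xs (λ x → f x y))))

-- Enumeration of permutations

concatMap-unique : {A B : Set} (f : A → List B) (zs : List A) → (∀ z → z ∈ zs → Unique (f z)) →
  (∀ {z z' y} → z ∈ zs → z' ∈ zs → y ∈ f z → y ∈ f z' → z ≡ z') → Unique zs → Unique (concatMap f zs)
concatMap-unique f [] hu hd [] = []
concatMap-unique f (z ∷ zs) hu hd (z∉ ∷ u) =
  Uₚ.++⁺ (hu z (here refl))
    (concatMap-unique f zs (λ x x∈ → hu x (there x∈)) (λ x∈ y∈ → hd (there x∈) (there y∈)) u)
    λ { (y∈ , y∈') → case find (∈-concatMap⁻ f y∈') of λ { (x , x∈ , y∈fx) →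
        All.lookup z∉ x∈ (hd (here refl) (there x∈) y∈ y∈fx) } }

module _ {A : Set} where

  ∈insertAll⇒↭ : ∀ {k} {x : A} (zs : Vec A k) {ys} → ys ∈ insertAll x zs → V.toList ys ↭ x ∷ V.toList zs
  ∈insertAll⇒↭ [] (here refl) = ↭-refl
  ∈insertAll⇒↭ (z ∷ zs) (here refl) = ↭-refl
  ∈insertAll⇒↭ {x = x} (z ∷ zs) (there ys∈) with ∈-map⁻ (z ∷_) ys∈
  ... | ys' , ys'∈ , refl = ↭-trans (Perm↭.prep z (∈insertAll⇒↭ zs ys'∈)) (Perm↭.swap z x ↭-refl)

  ∈perms⇒↭ : ∀ {k} (xs : Vec A k) {ys} → ys ∈ perms xs → V.toList ys ↭ V.toList xs
  ∈perms⇒↭ [] (here refl) = ↭-refl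
  ∈perms⇒↭ (x ∷ xs) ys∈ with find (∈-concatMap⁻ (insertAll x) ys∈)
  ... | zs , zs∈ , ys∈i = ↭-trans (∈insertAll⇒↭ zs ys∈i) (Perm↭.prep x (∈perms⇒↭ xs zs∈))

  ∈⇒∈insertAll : ∀ {k} {x : A} (ys : Vec A (suc k)) → x ∈ V.toList ys → ∃ λ zs → ys ∈ insertAll x zs
  ∈⇒∈insertAll (y ∷ []) (here refl) = [] , here refl
  ∈⇒∈insertAll (y ∷ z ∷ ys) (here refl) = z ∷ ys , here refl
  ∈⇒∈insertAll (y ∷ z ∷ ys) (there x∈) with ∈⇒∈insertAll (z ∷ ys) x∈
  ... | zs , h = y ∷ zs , there (∈-map⁺ (y ∷_) h)

  -- By induction: x occurs somewhere in `ys`, and deleting it there leaves a rearrangement of `xs`.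
  ↭⇒∈perms : ∀ {k} (xs : Vec A k) {ys} → V.toList ys ↭ V.toList xs → ys ∈ perms xs
  ↭⇒∈perms [] {[]} p = here refl
  ↭⇒∈perms (x ∷ xs) {ys} p with ∈⇒∈insertAll ys (∈-resp-↭ (↭-sym p) (here refl))
  ... | zs , h = ∈-concatMap⁺ (insertAll x) (lose (↭⇒∈perms xs (drop-∷ (↭-trans (↭-sym (∈insertAll⇒↭ zs h)) p))) h)

  insertAll-unique : ∀ {k} {x : A} (zs : Vec A k) → x ∉ V.toList zs → Unique (insertAll x zs)
  insertAll-unique [] x∉ = [] ∷ []
  insertAll-unique (z ∷ zs) x∉ =
    All.tabulate (λ ys∈ e → case ∈-map⁻ (z ∷_) ys∈ of λ { (_ , _ , refl) → x∉ (here (Vₚ.∷-injectiveˡ e)) })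
    ∷ Uₚ.map⁺ Vₚ.∷-injectiveʳ (insertAll-unique zs (x∉ ∘ there))

  -- As x occurs in neither `zs` nor `zs'`, its position in `ys` is unique, and deleting it recovers
  -- both.
  insertAll-injective : ∀ {k} {x : A} (zs zs' : Vec A k) {ys} → x ∉ V.toList zs → x ∉ V.toList zs' →
    ys ∈ insertAll x zs → ys ∈ insertAll x zs' → zs ≡ zs'
  insertAll-injective [] [] _ _ _ _ = refl
  insertAll-injective (z ∷ zs) (z' ∷ zs') x∉ x∉' (here refl) (here refl) = refl
  insertAll-injective (z ∷ zs) (z' ∷ zs') x∉ x∉' (here refl) (there h) with ∈-map⁻ (z' ∷_) h
  ... | _ , _ , refl = ⊥-elim (x∉' (here refl))
  insertAll-injective (z ∷ zs) (z' ∷ zs') x∉ x∉' (there h) (here refl) with ∈-map⁻ (z ∷_) h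
  ... | _ , _ , refl = ⊥-elim (x∉ (here refl))
  insertAll-injective (z ∷ zs) (z' ∷ zs') x∉ x∉' (there h) (there h') with ∈-map⁻ (z ∷_) h | ∈-map⁻ (z' ∷_) h'
  ... | _ , i , refl | _ , i' , refl = cong (z ∷_) (insertAll-injective zs zs' (x∉ ∘ there) (x∉' ∘ there) i i')

  perms-unique : ∀ {k} (xs : Vec A k) → Unique (V.toList xs) → Unique (perms xs)
  perms-unique [] u = [] ∷ []
  perms-unique (x ∷ xs) (x∉ ∷ u) =
    concatMap-unique (insertAll x) (perms xs) (λ zs zs∈ → insertAll-unique zs (avoid zs∈))
      (λ {z} {z'} z∈ z'∈ → insertAll-injective z z' (avoid z∈) (avoid z'∈)) (perms-unique xs u)
    where
    avoid : ∀ {zs} → zs ∈ perms xs → x ∉ V.toList zs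
    avoid zs∈ x∈ = All.lookup x∉ (∈-resp-↭ (∈perms⇒↭ xs zs∈) x∈) refl

  toList-tabulate : ∀ {k} (f : Fin k → A) → V.toList (V.tabulate f) ≡ L.tabulate f
  toList-tabulate {zero} f = refl
  toList-tabulate {suc k} f = cong (f F.zero ∷_) (toList-tabulate (f ∘ F.suc))

  lookup∈toList : ∀ {k} (xs : Vec A k) i → lookup xs i ∈ V.toList xs
  lookup∈toList (x ∷ xs) F.zero = here refl
  lookup∈toList (x ∷ xs) (F.suc i) = there (lookup∈toList xs i)

  ∈toList⇒lookup : ∀ {k} (xs : Vec A k) {x} → x ∈ V.toList xs → ∃ λ i → lookup xs i ≡ x
  ∈toList⇒lookup (x ∷ xs) (here refl) = F.zero , refl
  ∈toList⇒lookup (x ∷ xs) (there x∈) with ∈toList⇒lookup xs x∈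
  ... | i , e = F.suc i , e

  unique⇒injective : ∀ {k} (xs : Vec A k) → Unique (V.toList xs) → ∀ {i j} → lookup xs i ≡ lookup xs j → i ≡ j
  unique⇒injective (x ∷ xs) (x∉ ∷ u) {F.zero} {F.zero} e = refl
  unique⇒injective (x ∷ xs) (x∉ ∷ u) {F.zero} {F.suc j} e = ⊥-elim (All.lookup x∉ (lookup∈toList xs j) e)
  unique⇒injective (x ∷ xs) (x∉ ∷ u) {F.suc i} {F.zero} e = ⊥-elim (All.lookup x∉ (lookup∈toList xs i) (sym e))
  unique⇒injective (x ∷ xs) (x∉ ∷ u) {F.suc i} {F.suc j} e = cong F.suc (unique⇒injective xs u e)

  injective⇒unique : ∀ {k} (xs : Vec A k) → (∀ {i j} → lookup xs i ≡ lookup xs j → i ≡ j) → Unique (V.toList xs)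
  injective⇒unique [] h = []
  injective⇒unique (x ∷ xs) h =
    All.tabulate (λ y∈ e → case ∈toList⇒lookup xs y∈ of λ { (i , e') → case h {F.zero} {F.suc i} (trans e (sym e')) of λ () })
    ∷ injective⇒unique xs (λ e → Fsuc-inj (h e))
    where
    Fsuc-inj : ∀ {k} {i j : Fin k} → F.suc i ≡ F.suc j → i ≡ j
    Fsuc-inj refl = refl

  unique∧set⇒↭ : {xs ys : List A} → Unique xs → Unique ys → (∀ {z} → z ∈ xs → z ∈ ys) → (∀ {z} → z ∈ ys → z ∈ xs) → xs ↭ ys
  unique∧set⇒↭ u v f g = ∼bag⇒↭ (unique∧set⇒bag u v (mk⇔ f g))

  Unique-resp-↭ : {xs ys : List A} → xs ↭ ys → Unique xs → Unique ys
  Unique-resp-↭ p = PermS.Unique-resp-↭ (setoid A) (↭⇒↭ₛ p)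

  -- An involution preserving a duplicate-free list only rearranges it. The row and column groups
  -- are reindexed in this way by multiplication with one of their transpositions.
  Σ-involution : (xs : List A) (f : A → A) → Unique xs → (∀ {x} → x ∈ xs → f x ∈ xs) → (∀ {x} → f (f x) ≡ x) →
    (g : A → ℚ) → Σℚ xs (g ∘ f) ≡ Σℚ xs g
  Σ-involution xs f u c i g = trans (sym (Σ-map f xs g)) (Σ-↭ g
    (unique∧set⇒↭ (Uₚ.map⁺ (λ {x} {y} e → trans (sym i) (trans (cong f e) i)) u) u
      (λ z∈ → case ∈-map⁻ f z∈ of λ { (x , x∈ , refl) → c x∈ })
      (λ {z} z∈ → subst (_∈ map f xs) i (∈-map⁺ f (c z∈)))))

toList-allFin : ∀ m → V.toList (V.allFin m) ≡ allFin m
toList-allFin m = toList-tabulate id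

-- Surjectivity would follow from finiteness; it is kept as data because `act g P` is known only at
-- vertices of the form g i, so preimages are needed throughout.
record IsPerm {m} (σ : Perm m) : Set where
  field
    inj : ∀ {i j} → lookup σ i ≡ lookup σ j → i ≡ j
    surj : ∀ i → ∃ λ j → lookup σ j ≡ i
open IsPerm public

∈allPerms⇒↭ : ∀ {m} {σ : Perm m} → σ ∈ allPerms m → V.toList σ ↭ allFin m
∈allPerms⇒↭ {m} σ∈ = ↭-trans (∈perms⇒↭ (V.allFin m) σ∈) (↭-reflexive (toList-allFin m))

isPerm : ∀ {m} {σ : Perm m} → σ ∈ allPerms m → IsPerm σ
isPerm {m} {σ} σ∈ = record
  { inj = unique⇒injective σ (Unique-resp-↭ (↭-sym (∈allPerms⇒↭ σ∈)) (Uₚ.allFin⁺ m))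
  ; surj = λ i → ∈toList⇒lookup σ (∈-resp-↭ (↭-sym (∈allPerms⇒↭ σ∈)) (∈-allFin i)) }

IsPerm⇒↭ : ∀ {m} {σ : Perm m} → IsPerm σ → V.toList σ ↭ allFin m
IsPerm⇒↭ {m} {σ} p = unique∧set⇒↭ (injective⇒unique σ (inj p)) (Uₚ.allFin⁺ m) (λ {z} _ → ∈-allFin z)
  (λ {z} _ → case surj p z of λ { (j , refl) → lookup∈toList σ j })

∈allPerms : ∀ {m} {σ : Perm m} → IsPerm σ → σ ∈ allPerms m
∈allPerms {m} p = ↭⇒∈perms (V.allFin m) (↭-trans (IsPerm⇒↭ p) (↭-reflexive (sym (toList-allFin m))))

allPerms-unique : ∀ m → Unique (allPerms m)
allPerms-unique m = perms-unique (V.allFin m) (subst Unique (sym (toList-allFin m)) (Uₚ.allFin⁺ m))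

filterᵇ-unique : {A : Set} (p : A → Bool) {xs : List A} → Unique xs → Unique (filterᵇ p xs)
filterᵇ-unique p = Uₚ.filter⁺ (T? ∘ p)

T⇒≡ : ∀ {b} → T b → b ≡ true
T⇒≡ {true} _ = refl

≡⇒T : ∀ {b} → b ≡ true → T b
≡⇒T refl = _

∈-filterᵇ⁺ : {A : Set} (p : A → Bool) {xs : List A} {x : A} → x ∈ xs → p x ≡ true → x ∈ filterᵇ p xs
∈-filterᵇ⁺ p x∈ e = ∈-filter⁺ (T? ∘ p) x∈ (≡⇒T e)

∈-filterᵇ⁻ : {A : Set} (p : A → Bool) {xs : List A} {x : A} → x ∈ filterᵇ p xs → x ∈ xs × p x ≡ true
∈-filterᵇ⁻ p {xs} x∈ with ∈-filter⁻ (T? ∘ p) {xs = xs} x∈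
... | h , t = h , T⇒≡ t

allᵇ⁺ : {A : Set} (p : A → Bool) (xs : List A) → (∀ x → x ∈ xs → p x ≡ true) → allᵇ p xs ≡ true
allᵇ⁺ p [] h = refl
allᵇ⁺ p (x ∷ xs) h = cong₂ _∧_ (h x (here refl)) (allᵇ⁺ p xs (λ y y∈ → h y (there y∈)))

∧-true : ∀ {a b} → (a ∧ b) ≡ true → a ≡ true × b ≡ true
∧-true {true} {true} _ = refl , refl

allᵇ⁻ : {A : Set} (p : A → Bool) (xs : List A) → allᵇ p xs ≡ true → ∀ {x} → x ∈ xs → p x ≡ true
allᵇ⁻ p (x ∷ xs) h (here refl) = proj₁ (∧-true h)
allᵇ⁻ p (x ∷ xs) h (there y∈) = allᵇ⁻ p xs (proj₂ (∧-true {p x} h)) y∈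

==ᶠ-refl : ∀ {m} (i : Fin m) → (i ==ᶠ i) ≡ true
==ᶠ-refl i = dec-true (i ≟ᶠ i) refl

==ᶠ-≢ : ∀ {m} {i j : Fin m} → i ≢ j → (i ==ᶠ j) ≡ false
==ᶠ-≢ {i = i} {j} = dec-false (i ≟ᶠ j)

==ᶠ⇒≡ : ∀ {m} {i j : Fin m} → (i ==ᶠ j) ≡ true → i ≡ j
==ᶠ⇒≡ {i = i} {j} e with i ≟ᶠ j
... | yes p = p

Vec-ext : ∀ {A : Set} {k} {xs ys : Vec A k} → (∀ i → lookup xs i ≡ lookup ys i) → xs ≡ ys
Vec-ext {xs = xs} {ys} h = begin
  xs                       ≡⟨ sym (Vₚ.tabulate∘lookup xs) ⟩
  V.tabulate (lookup xs)   ≡⟨ Vₚ.tabulate-cong h ⟩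
  V.tabulate (lookup ys)   ≡⟨ Vₚ.tabulate∘lookup ys ⟩
  ys ∎

map-lookup-allFin : ∀ {A : Set} {k} (xs : Vec A k) → map (lookup xs) (allFin k) ≡ V.toList xs
map-lookup-allFin {k = k} xs = begin
  map (lookup xs) (allFin k)               ≡⟨ cong (map (lookup xs)) (sym (toList-allFin k)) ⟩
  map (lookup xs) (V.toList (V.allFin k))  ≡⟨ sym (Vₚ.toList-map (lookup xs) (V.allFin k)) ⟩
  V.toList (V.map (lookup xs) (V.allFin k)) ≡⟨ cong V.toList (Vₚ.map-lookup-allFin xs) ⟩
  V.toList xs ∎

Σ-reindex : ∀ {m} {σ : Perm m} → IsPerm σ → (f : Fin m → ℚ) → Σℚ (allFin m) (f ∘ lookup σ) ≡ Σℚ (allFin m) f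
Σ-reindex {m} {σ} p f = trans (sym (Σ-map (lookup σ) (allFin m) f))
  (Σ-↭ f (↭-trans (↭-reflexive (map-lookup-allFin σ)) (IsPerm⇒↭ p)))

-- Transpositions, the action on matchings and the sign

abstract
  -- Kept abstract so that only its three defining equations, and no nested conditionals, enter
  -- later goals.
  sw : ∀ {m} → Fin m → Fin m → Fin m → Fin m
  sw a b x = if x ==ᶠ a then b else if x ==ᶠ b then a else x

  sw-l : ∀ {m} (a b : Fin m) → sw a b a ≡ b
  sw-l a b rewrite ==ᶠ-refl a = refl

  sw-r : ∀ {m} (a b : Fin m) → sw a b b ≡ a
  sw-r a b with b ≟ᶠ a
  ... | yes refl = refl
  ... | no _ rewrite ==ᶠ-refl b = refl

  sw-o : ∀ {m} {a b x : Fin m} → x ≢ a → x ≢ b → sw a b x ≡ x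
  sw-o p q rewrite ==ᶠ-≢ p | ==ᶠ-≢ q = refl

module _ {m : ℕ} where

  data SwView (a b x : Fin m) : Set where
    isL : x ≡ a → SwView a b x
    isR : x ≡ b → SwView a b x
    isO : x ≢ a → x ≢ b → SwView a b x

  swView : (a b x : Fin m) → SwView a b x
  swView a b x with x ≟ᶠ a | x ≟ᶠ b
  ... | yes p | _ = isL p
  ... | no _ | yes q = isR q
  ... | no p | no q = isO p q

  sw-invol : (a b x : Fin m) → sw a b (sw a b x) ≡ x
  sw-invol a b x with swView a b x
  ... | isL refl = trans (cong (sw a b) (sw-l a b)) (sw-r a b)
  ... | isR refl = trans (cong (sw a b) (sw-r a b)) (sw-l a b)
  ... | isO p q = trans (cong (sw a b) (sw-o p q)) (sw-o p q)

  sw-comm : (a b x : Fin m) → sw a b x ≡ sw b a x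
  sw-comm a b x with swView a b x
  ... | isL refl = trans (sw-l a b) (sym (sw-r b a))
  ... | isR refl = trans (sw-r a b) (sym (sw-l b a))
  ... | isO p q = trans (sw-o p q) (sym (sw-o q p))

  sw-id : (a x : Fin m) → sw a a x ≡ x
  sw-id a x with swView a a x
  ... | isL refl = sw-l a a
  ... | isR refl = sw-l a a
  ... | isO p q = sw-o p q

  -- Conjugating a transposition relabels its two points. All rules for moving one transposition
  -- past another come from this.
  sw-nat : (f : Fin m → Fin m) → (∀ {i j} → f i ≡ f j → i ≡ j) → (a b x : Fin m) → f (sw a b x) ≡ sw (f a) (f b) (f x)
  sw-nat f i a b x with swView a b x
  ... | isL refl = trans (cong f (sw-l a b)) (sym (sw-l (f a) (f b)))
  ... | isR refl = trans (cong f (sw-r a b)) (sym (sw-r (f a) (f b)))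
  ... | isO p q = trans (cong f (sw-o p q)) (sym (sw-o (p ∘ i) (q ∘ i)))

  sw-inj : (a b : Fin m) {i j : Fin m} → sw a b i ≡ sw a b j → i ≡ j
  sw-inj a b {i} {j} e = trans (sym (sw-invol a b i)) (trans (cong (sw a b) e) (sw-invol a b j))

  tr : Fin m → Fin m → Perm m
  tr a b = V.tabulate (sw a b)

  lookup-tr : (a b x : Fin m) → lookup (tr a b) x ≡ sw a b x
  lookup-tr a b x = Vₚ.lookup∘tabulate (sw a b) x

  tr-isPerm : (a b : Fin m) → IsPerm (tr a b)
  tr-isPerm a b = record
    { inj = λ {i} {j} e → sw-inj a b (trans (sym (lookup-tr a b i)) (trans e (lookup-tr a b j)))
    ; surj = λ i → sw a b i , trans (lookup-tr a b (sw a b i)) (sw-invol a b i) }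

  lookup-∘ : (σ τ : Perm m) (i : Fin m) → lookup (σ ∘ₚ τ) i ≡ lookup σ (lookup τ i)
  lookup-∘ σ τ i = Vₚ.lookup-map i (lookup σ) τ

  lookup-tr∘ : (a b : Fin m) (σ : Perm m) (i : Fin m) → lookup (tr a b ∘ₚ σ) i ≡ sw a b (lookup σ i)
  lookup-tr∘ a b σ i = trans (lookup-∘ (tr a b) σ i) (lookup-tr a b _)

  ∘-isPerm : {σ τ : Perm m} → IsPerm σ → IsPerm τ → IsPerm (σ ∘ₚ τ)
  ∘-isPerm {σ} {τ} p q = record
    { inj = λ {i} {j} e → inj q (inj p (trans (sym (lookup-∘ σ τ i)) (trans e (lookup-∘ σ τ j))))
    ; surj = λ i → let j , ej = surj p i ; k , ek = surj q j in
        k , trans (lookup-∘ σ τ k) (trans (cong (lookup σ) ek) ej) }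

  -- The fold inside `act`, with its list of vertices left free for induction.
  actOn : Perm m → Perm m → List (Fin m) → Perm m
  actOn g P = L.foldr (λ i v → v [ lookup g i ]≔ lookup g (lookup P i)) P

  actOn-lookup : {g : Perm m} → IsPerm g → (P : Perm m) (xs : List (Fin m)) {i : Fin m} → i ∈ xs →
    lookup (actOn g P xs) (lookup g i) ≡ lookup g (lookup P i)
  actOn-lookup {g} p P (x ∷ xs) {i} i∈ with i ≟ᶠ x
  ... | yes refl = Vₚ.lookup∘update (lookup g i) (actOn g P xs) _
  actOn-lookup {g} p P (x ∷ xs) (here refl) | no i≢x = ⊥-elim (i≢x refl)
  actOn-lookup {g} p P (x ∷ xs) (there i∈) | no i≢x =
    trans (Vₚ.lookup∘update′ (i≢x ∘ inj p) (actOn g P xs) _) (actOn-lookup p P xs i∈)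

  act-lookup : {g : Perm m} → IsPerm g → (P : Perm m) (i : Fin m) → lookup (act g P) (lookup g i) ≡ lookup g (lookup P i)
  act-lookup p P i = actOn-lookup p P (allFin m) (∈-allFin i)

  -- Every vertex is of the form g i, so equivariance determines all values of the image.
  act-unique : {g : Perm m} → IsPerm g → {P Q : Perm m} → (∀ i → lookup Q (lookup g i) ≡ lookup g (lookup P i)) → act g P ≡ Q
  act-unique {g} p {P} {Q} h = Vec-ext λ i → let j , e = surj p i in
    subst (λ i → lookup (act g P) i ≡ lookup Q i) e (trans (act-lookup p P j) (sym (h j)))

  act-∘ : {σ τ : Perm m} → IsPerm σ → IsPerm τ → (P : Perm m) → act (σ ∘ₚ τ) P ≡ act σ (act τ P)
  act-∘ {σ} {τ} p q P = act-unique (∘-isPerm p q) λ i → begin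
    lookup (act σ (act τ P)) (lookup (σ ∘ₚ τ) i) ≡⟨ cong (lookup (act σ (act τ P))) (lookup-∘ σ τ i) ⟩
    lookup (act σ (act τ P)) (lookup σ (lookup τ i)) ≡⟨ act-lookup p (act τ P) (lookup τ i) ⟩
    lookup σ (lookup (act τ P) (lookup τ i)) ≡⟨ cong (lookup σ) (act-lookup q P i) ⟩
    lookup σ (lookup τ (lookup P i)) ≡⟨ sym (lookup-∘ σ τ (lookup P i)) ⟩
    lookup (σ ∘ₚ τ) (lookup P i) ∎

  infixr 9 _↔_·_
  _↔_·_ : Fin m → Fin m → Perm m → Perm m
  a ↔ b · P = act (tr a b) P

  lookup-↔ : (a b : Fin m) (P : Perm m) (x : Fin m) → lookup (a ↔ b · P) x ≡ sw a b (lookup P (sw a b x))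
  lookup-↔ a b P x = begin
    lookup (a ↔ b · P) x
      ≡⟨ cong (lookup (a ↔ b · P)) (sym (trans (lookup-tr a b _) (sw-invol a b x))) ⟩
    lookup (a ↔ b · P) (lookup (tr a b) (sw a b x))
      ≡⟨ act-lookup (tr-isPerm a b) P (sw a b x) ⟩
    lookup (tr a b) (lookup P (sw a b x))
      ≡⟨ lookup-tr a b _ ⟩
    sw a b (lookup P (sw a b x)) ∎

  ↔-invol : (a b : Fin m) (P : Perm m) → a ↔ b · a ↔ b · P ≡ P
  ↔-invol a b P = Vec-ext λ x → begin
    lookup (a ↔ b · a ↔ b · P) x            ≡⟨ lookup-↔ a b (a ↔ b · P) x ⟩
    sw a b (lookup (a ↔ b · P) (sw a b x))  ≡⟨ cong (sw a b) (lookup-↔ a b P (sw a b x)) ⟩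
    sw a b (sw a b (lookup P (sw a b (sw a b x)))) ≡⟨ sw-invol a b _ ⟩
    lookup P (sw a b (sw a b x))            ≡⟨ cong (lookup P) (sw-invol a b x) ⟩
    lookup P x ∎

  ↔-comm : (a b : Fin m) (P : Perm m) → a ↔ b · P ≡ b ↔ a · P
  ↔-comm a b P = cong (λ t → act t P) (Vₚ.tabulate-cong (sw-comm a b))

  ↔-id : (a : Fin m) (P : Perm m) → a ↔ a · P ≡ P
  ↔-id a P = Vec-ext λ x → trans (lookup-↔ a a P x) (trans (sw-id a _) (cong (lookup P) (sw-id a x)))

  tr-conj : {g : Perm m} → IsPerm g → (a b : Fin m) → g ∘ₚ tr a b ≡ tr (lookup g a) (lookup g b) ∘ₚ g
  tr-conj {g} p a b = Vec-ext λ i → begin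
    lookup (g ∘ₚ tr a b) i            ≡⟨ lookup-∘ g (tr a b) i ⟩
    lookup g (lookup (tr a b) i)      ≡⟨ cong (lookup g) (lookup-tr a b i) ⟩
    lookup g (sw a b i)               ≡⟨ sw-nat (lookup g) (inj p) a b i ⟩
    sw (lookup g a) (lookup g b) (lookup g i) ≡⟨ sym (lookup-tr∘ _ _ g i) ⟩
    lookup (tr (lookup g a) (lookup g b) ∘ₚ g) i ∎

  act-↔ : {g : Perm m} → IsPerm g → (a b : Fin m) (P : Perm m) → act g (a ↔ b · P) ≡ lookup g a ↔ lookup g b · act g P
  act-↔ {g} p a b P = begin
    act g (a ↔ b · P)    ≡⟨ sym (act-∘ p (tr-isPerm a b) P) ⟩
    act (g ∘ₚ tr a b) P  ≡⟨ cong (λ t → act t P) (tr-conj p a b) ⟩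
    act (tr (lookup g a) (lookup g b) ∘ₚ g) P ≡⟨ act-∘ (tr-isPerm _ _) p P ⟩
    lookup g a ↔ lookup g b · act g P ∎

  ↔-conj : (a b c d : Fin m) (P : Perm m) → a ↔ b · c ↔ d · P ≡ sw a b c ↔ sw a b d · a ↔ b · P
  ↔-conj a b c d P = trans (act-↔ (tr-isPerm a b) c d P)
    (cong₂ (λ x y → x ↔ y · a ↔ b · P) (lookup-tr a b c) (lookup-tr a b d))

-- Perfect matchings as fixed-point-free involutions

record IsMatching {m} (P : Perm m) : Set where
  field
    inv : ∀ i → lookup P (lookup P i) ≡ i
    fpf : ∀ i → lookup P i ≢ i
open IsMatching public

module _ {m : ℕ} where

  matching-isPerm : {P : Perm m} → IsMatching P → IsPerm P
  matching-isPerm {P} M = record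
    { inj = λ {i} {j} e → trans (sym (inv M i)) (trans (cong (lookup P) e) (inv M j))
    ; surj = λ i → lookup P i , inv M i }

  ∈matchings : {P : Perm m} → IsMatching P → P ∈ matchings m
  ∈matchings {P} M = ∈-filterᵇ⁺ isMatching (∈allPerms (matching-isPerm M))
    (allᵇ⁺ _ (allFin m) (λ i _ → cong₂ _∧_ (trans (cong (_==ᶠ i) (inv M i)) (==ᶠ-refl i)) (cong not (==ᶠ-≢ (fpf M i)))))

  ∈matchings⇒ : {P : Perm m} → P ∈ matchings m → IsMatching P
  ∈matchings⇒ {P} P∈ = record
    { inv = λ i → ==ᶠ⇒≡ (proj₁ (∧-true (h i)))
    ; fpf = λ i e → case trans (sym (proj₂ (∧-true {lookup P (lookup P i) ==ᶠ i} (h i)))) (cong not (trans (cong (_==ᶠ i) e) (==ᶠ-refl i))) of λ () }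
    where
    h = λ i → allᵇ⁻ (λ i → (lookup P (lookup P i) ==ᶠ i) ∧ not (lookup P i ==ᶠ i)) (allFin m)
          (proj₂ (∈-filterᵇ⁻ isMatching {allPerms m} P∈)) (∈-allFin i)

  matchings-unique : Unique (matchings m)
  matchings-unique = filterᵇ-unique isMatching (allPerms-unique m)

  act-matching : {g : Perm m} → IsPerm g → {P : Perm m} → IsMatching P → IsMatching (act g P)
  act-matching {g} p {P} M = record
    { inv = λ i → let j , e = surj p i in subst (λ i → lookup (act g P) (lookup (act g P) i) ≡ i) e
        (trans (cong (lookup (act g P)) (act-lookup p P j))
          (trans (act-lookup p P (lookup P j)) (cong (lookup g) (inv M j))))
    ; fpf = λ i h → let j , e = surj p i in
        fpf M j (inj p (trans (sym (act-lookup p P j)) (subst (λ i → lookup (act g P) i ≡ i) (sym e) h))) }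

  ↔-matching : (a b : Fin m) {P : Perm m} → IsMatching P → IsMatching (a ↔ b · P)
  ↔-matching a b = act-matching (tr-isPerm a b)

-- A transposition changes the sign

ℚ[]-injective : ∀ {a b} → ℚ[ a ] ≡ ℚ[ b ] → a ≡ b
ℚ[]-injective {a} {b} e with ℚₚ./-injective-≃ (ℚᵘ.mkℚᵘ (ℤ.+ a) 0) (ℚᵘ.mkℚᵘ (ℤ.+ b) 0) e
... | ℚᵘ.*≡* h = ℤₚ.+-injective (trans (sym (ℤₚ.*-identityʳ (ℤ.+ a))) (trans h (ℤₚ.*-identityʳ (ℤ.+ b))))

ℚ[]-sum : {A : Set} (f : A → ℕ) (xs : List A) → ℚ[ sum (map f xs) ] ≡ Σℚ xs (λ x → ℚ[ f x ])
ℚ[]-sum f [] = refl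
ℚ[]-sum f (x ∷ xs) = trans (ℚ[]-+ (f x) _) (cong (ℚ[ f x ] +_) (ℚ[]-sum f xs))

module _ {m : ℕ} where

  inv-pair : Perm m → Fin m → Fin m → Bool
  inv-pair σ i j = (toℕ i <ᵇ toℕ j) ∧ (toℕ (lookup σ j) <ᵇ toℕ (lookup σ i))

  -- The count is moved to ℚ so that the lemmas on finite sums apply; `ℚ[]-injective` brings the
  -- result back.
  ℚ-inversions : (σ : Perm m) → ℚ[ inversions σ ] ≡ Σℚ (allFin m) (λ i → Σℚ (allFin m) (λ j → 𝟙 (inv-pair σ i j)))
  ℚ-inversions σ = trans (ℚ[]-sum _ (allFin m)) (Σ-cong (allFin m) (λ i → sym (Σ-countᵇ (inv-pair σ i) (allFin m))))

<ᵇ-irrefl : ∀ n → (n <ᵇ n) ≡ false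
<ᵇ-irrefl zero = refl
<ᵇ-irrefl (suc n) = <ᵇ-irrefl n

n<ᵇsuc : ∀ n → (n <ᵇ suc n) ≡ true
n<ᵇsuc zero = refl
n<ᵇsuc (suc n) = n<ᵇsuc n

suc<ᵇn : ∀ n → (suc n <ᵇ n) ≡ false
suc<ᵇn zero = refl
suc<ᵇn (suc n) = suc<ᵇn n

<ᵇ-sucʳ : ∀ n a → n ≢ a → (n <ᵇ suc a) ≡ (n <ᵇ a)
<ᵇ-sucʳ zero zero h = ⊥-elim (h refl)
<ᵇ-sucʳ zero (suc a) h = refl
<ᵇ-sucʳ (suc n) zero h = refl
<ᵇ-sucʳ (suc n) (suc a) h = <ᵇ-sucʳ n a (h ∘ cong suc)

<ᵇ-sucˡ : ∀ a n → n ≢ suc a → (suc a <ᵇ n) ≡ (a <ᵇ n)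
<ᵇ-sucˡ a zero h = refl
<ᵇ-sucˡ zero (suc zero) h = ⊥-elim (h refl)
<ᵇ-sucˡ zero (suc (suc n)) h = refl
<ᵇ-sucˡ (suc a) (suc n) h = <ᵇ-sucˡ a n (h ∘ cong suc)

<ᵇ-total : ∀ a b → a ≢ b → ((a <ᵇ b) ≡ true × (b <ᵇ a) ≡ false) ⊎ ((a <ᵇ b) ≡ false × (b <ᵇ a) ≡ true)
<ᵇ-total zero zero h = ⊥-elim (h refl)
<ᵇ-total zero (suc b) h = inj₁ (refl , refl)
<ᵇ-total (suc a) zero h = inj₂ (refl , refl)
<ᵇ-total (suc a) (suc b) h = <ᵇ-total a b (h ∘ cong suc)

even : ℕ → Bool
even n = (n ℕ.% 2) ≡ᵇ 0

even-suc : ∀ n → even (suc n) ≡ not (even n)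
even-suc zero = refl
even-suc (suc zero) = refl
even-suc (suc (suc n)) = even-suc n

evenSign : Bool → ℚ
evenSign b = if b then 1ℚ else - 1ℚ

evenSign-not : ∀ b → evenSign (not b) ≡ - evenSign b
evenSign-not true = refl
evenSign-not false = refl

-- No value lies strictly between the consecutive a and b, so exchanging them keeps the order of
-- every pair of values other than {a, b}.
adjacent-order : ∀ {m} {a b : Fin m} → toℕ b ≡ suc (toℕ a) → ∀ x y → ¬ (x ≡ a × y ≡ b) → ¬ (x ≡ b × y ≡ a) →
  (toℕ (sw a b y) <ᵇ toℕ (sw a b x)) ≡ (toℕ y <ᵇ toℕ x)
adjacent-order {a = a} {b} e x y h h' with swView a b x | swView a b y
... | isL refl | isL refl rewrite sw-l a b = trans (<ᵇ-irrefl (toℕ b)) (sym (<ᵇ-irrefl (toℕ a)))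
... | isL refl | isR refl = ⊥-elim (h (refl , refl))
... | isL refl | isO p q rewrite sw-l a b | sw-o p q | e = <ᵇ-sucʳ (toℕ y) (toℕ a) (p ∘ Fₚ.toℕ-injective)
... | isR refl | isL refl = ⊥-elim (h' (refl , refl))
... | isR refl | isR refl rewrite sw-r a b = trans (<ᵇ-irrefl (toℕ a)) (sym (<ᵇ-irrefl (toℕ b)))
... | isR refl | isO p q rewrite sw-r a b | sw-o p q | e = sym (<ᵇ-sucʳ (toℕ y) (toℕ a) (p ∘ Fₚ.toℕ-injective))
... | isO p q | isL refl rewrite sw-l a b | sw-o p q | e = <ᵇ-sucˡ (toℕ a) (toℕ x) (λ h → q (Fₚ.toℕ-injective (trans h (sym e))))
... | isO p q | isR refl rewrite sw-r a b | sw-o p q | e = sym (<ᵇ-sucˡ (toℕ a) (toℕ x) (λ h → q (Fₚ.toℕ-injective (trans h (sym e)))))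
... | isO p q | isO p' q' rewrite sw-o p q | sw-o p' q' = refl

-- Only the pair of positions holding the two adjacent values changes its status.
module _ {m : ℕ} {σ : Perm m} (s : IsPerm σ) {a b : Fin m} (e : toℕ b ≡ suc (toℕ a)) where

  private
    i₀ = proj₁ (surj s a)
    j₀ = proj₁ (surj s b)
    σi₀ : lookup σ i₀ ≡ a
    σi₀ = proj₂ (surj s a)
    σj₀ : lookup σ j₀ ≡ b
    σj₀ = proj₂ (surj s b)
    σ' = tr a b ∘ₚ σ

    a≢b : a ≢ b
    a≢b h = ℕₚ.1+n≢n (trans (sym e) (cong toℕ (sym h)))

    i₀≢j₀ : i₀ ≢ j₀
    i₀≢j₀ h = a≢b (trans (sym σi₀) (trans (cong (lookup σ) h) σj₀))

    -- A correction supported on the single entry (k, l), and only when k precedes l.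
    at : Fin m → Fin m → Fin m → Fin m → ℚ
    at k l i j = 𝟙 (i ==ᶠ k) * (𝟙 (j ==ᶠ l) * 𝟙 (toℕ k <ᵇ toℕ l))

    Σat : ∀ k l → Σℚ (allFin m) (λ i → Σℚ (allFin m) (at k l i)) ≡ 𝟙 (toℕ k <ᵇ toℕ l)
    Σat k l = begin
      Σℚ (allFin m) (λ i → Σℚ (allFin m) (at k l i))
        ≡⟨ Σ-cong (allFin m) (λ i → Σ-*ˡ (allFin m) (𝟙 (i ==ᶠ k)) _) ⟩
      Σℚ (allFin m) (λ i → 𝟙 (i ==ᶠ k) * Σℚ (allFin m) (λ j → 𝟙 (j ==ᶠ l) * 𝟙 (toℕ k <ᵇ toℕ l)))
        ≡⟨ Σ-δ (_==ᶠ k) (Uₚ.allFin⁺ m) (∈-allFin k) (==ᶠ-refl k) (λ y _ → ==ᶠ-≢) _ ⟩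
      Σℚ (allFin m) (λ j → 𝟙 (j ==ᶠ l) * 𝟙 (toℕ k <ᵇ toℕ l))
        ≡⟨ Σ-δ (_==ᶠ l) (Uₚ.allFin⁺ m) (∈-allFin l) (==ᶠ-refl l) (λ y _ → ==ᶠ-≢) _ ⟩
      𝟙 (toℕ k <ᵇ toℕ l) ∎

    at-hit : ∀ k l → at k l k l ≡ 𝟙 (toℕ k <ᵇ toℕ l)
    at-hit k l rewrite ==ᶠ-refl k | ==ᶠ-refl l = trans (ℚₚ.*-identityˡ _) (ℚₚ.*-identityˡ _)

    at-miss : ∀ k l i j → ¬ (i ≡ k × j ≡ l) → at k l i j ≡ 0ℚ
    at-miss k l i j h with i ≟ᶠ k | j ≟ᶠ l
    ... | yes p | yes q = ⊥-elim (h (p , q))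
    ... | yes p | no q = trans (ℚₚ.*-identityˡ _) (ℚₚ.*-zeroˡ (𝟙 (toℕ k <ᵇ toℕ l)))
    ... | no p | c = ℚₚ.*-zeroˡ (𝟙 (does c) * 𝟙 (toℕ k <ᵇ toℕ l))

    σ'i₀ : lookup σ' i₀ ≡ b
    σ'i₀ = trans (lookup-tr∘ a b σ i₀) (trans (cong (sw a b) σi₀) (sw-l a b))
    σ'j₀ : lookup σ' j₀ ≡ a
    σ'j₀ = trans (lookup-tr∘ a b σ j₀) (trans (cong (sw a b) σj₀) (sw-r a b))

    a<b : (toℕ a <ᵇ toℕ b) ≡ true
    a<b = trans (cong (toℕ a <ᵇ_) e) (n<ᵇsuc (toℕ a))
    b≮a : (toℕ b <ᵇ toℕ a) ≡ false
    b≮a = trans (cong (_<ᵇ toℕ a) e) (suc<ᵇn (toℕ a))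

    ∧-by : ∀ (c : Bool) {x y x' y' : Fin m} {d} → x ≡ x' → y ≡ y' → (toℕ x' <ᵇ toℕ y') ≡ d →
      𝟙 (c ∧ (toℕ x <ᵇ toℕ y)) ≡ 𝟙 c * 𝟙 d
    ∧-by c refl refl refl = 𝟙-∧ c _

    -- If `i₀` precedes `j₀`, the pair (i₀, j₀) becomes an inversion; otherwise (j₀, i₀) ceases to
    -- be one. One correction on each side treats both orders at once.
    pointwise : ∀ i j → 𝟙 (inv-pair σ' i j) + at j₀ i₀ i j ≡ 𝟙 (inv-pair σ i j) + at i₀ j₀ i j
    pointwise i j with Fₚ._≟_ i i₀ ×-dec Fₚ._≟_ j j₀
    ... | yes (refl , refl) = begin
      𝟙 (inv-pair σ' i₀ j₀) + at j₀ i₀ i₀ j₀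
        ≡⟨ cong₂ _+_ (trans (∧-by (toℕ i₀ <ᵇ toℕ j₀) σ'j₀ σ'i₀ a<b) (ℚₚ.*-identityʳ (𝟙 (toℕ i₀ <ᵇ toℕ j₀)))) (at-miss j₀ i₀ i₀ j₀ (i₀≢j₀ ∘ proj₁)) ⟩
      𝟙 (toℕ i₀ <ᵇ toℕ j₀) + 0ℚ
        ≡⟨ ℚₚ.+-comm (𝟙 (toℕ i₀ <ᵇ toℕ j₀)) 0ℚ ⟩
      0ℚ + 𝟙 (toℕ i₀ <ᵇ toℕ j₀)
        ≡⟨ sym (cong₂ _+_ (trans (∧-by (toℕ i₀ <ᵇ toℕ j₀) σj₀ σi₀ b≮a) (ℚₚ.*-zeroʳ (𝟙 (toℕ i₀ <ᵇ toℕ j₀)))) (at-hit i₀ j₀)) ⟩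
      𝟙 (inv-pair σ i₀ j₀) + at i₀ j₀ i₀ j₀ ∎
    ... | no h with Fₚ._≟_ i j₀ ×-dec Fₚ._≟_ j i₀
    ... | yes (refl , refl) = begin
      𝟙 (inv-pair σ' j₀ i₀) + at j₀ i₀ j₀ i₀
        ≡⟨ cong₂ _+_ (trans (∧-by (toℕ j₀ <ᵇ toℕ i₀) σ'i₀ σ'j₀ b≮a) (ℚₚ.*-zeroʳ (𝟙 (toℕ j₀ <ᵇ toℕ i₀)))) (at-hit j₀ i₀) ⟩
      0ℚ + 𝟙 (toℕ j₀ <ᵇ toℕ i₀)
        ≡⟨ ℚₚ.+-comm 0ℚ (𝟙 (toℕ j₀ <ᵇ toℕ i₀)) ⟩
      𝟙 (toℕ j₀ <ᵇ toℕ i₀) + 0ℚ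
        ≡⟨ sym (cong₂ _+_ (trans (∧-by (toℕ j₀ <ᵇ toℕ i₀) σi₀ σj₀ a<b) (ℚₚ.*-identityʳ (𝟙 (toℕ j₀ <ᵇ toℕ i₀)))) (at-miss i₀ j₀ j₀ i₀ (i₀≢j₀ ∘ sym ∘ proj₁))) ⟩
      𝟙 (inv-pair σ j₀ i₀) + at i₀ j₀ j₀ i₀ ∎
    ... | no h' = cong₂ _+_
      (cong (λ d → 𝟙 ((toℕ i <ᵇ toℕ j) ∧ d))
        (trans (cong₂ (λ x y → toℕ x <ᵇ toℕ y) (lookup-tr∘ a b σ j) (lookup-tr∘ a b σ i))
          (adjacent-order e (lookup σ i) (lookup σ j)
            (λ { (p , q) → h (inj s (trans p (sym σi₀)) , inj s (trans q (sym σj₀))) })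
            (λ { (p , q) → h' (inj s (trans p (sym σj₀)) , inj s (trans q (sym σi₀))) }))))
      (trans (at-miss j₀ i₀ i j h') (sym (at-miss i₀ j₀ i j h)))

    double-Σ : ∀ (f g : Fin m → Fin m → ℚ) → Σℚ (allFin m) (λ i → Σℚ (allFin m) (λ j → f i j + g i j)) ≡
      Σℚ (allFin m) (λ i → Σℚ (allFin m) (f i)) + Σℚ (allFin m) (λ i → Σℚ (allFin m) (g i))
    double-Σ f g = trans (Σ-cong (allFin m) (λ i → Σ-+ (allFin m) (f i) (g i))) (Σ-+ (allFin m) (λ i → Σℚ (allFin m) (f i)) (λ i → Σℚ (allFin m) (g i)))

    balance : ℚ[ inversions σ' ] + 𝟙 (toℕ j₀ <ᵇ toℕ i₀) ≡ ℚ[ inversions σ ] + 𝟙 (toℕ i₀ <ᵇ toℕ j₀)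
    balance = begin
      ℚ[ inversions σ' ] + 𝟙 (toℕ j₀ <ᵇ toℕ i₀)
        ≡⟨ cong₂ _+_ (ℚ-inversions σ') (sym (Σat j₀ i₀)) ⟩
      _ ≡⟨ sym (double-Σ (λ i j → 𝟙 (inv-pair σ' i j)) (at j₀ i₀)) ⟩
      _ ≡⟨ Σ-cong (allFin m) (λ i → Σ-cong (allFin m) (λ j → pointwise i j)) ⟩
      _ ≡⟨ double-Σ (λ i j → 𝟙 (inv-pair σ i j)) (at i₀ j₀) ⟩
      _ ≡⟨ sym (cong₂ _+_ (ℚ-inversions σ) (sym (Σat i₀ j₀))) ⟩
      ℚ[ inversions σ ] + 𝟙 (toℕ i₀ <ᵇ toℕ j₀) ∎

    by-parity : ∀ x y → x ≡ suc y → evenSign (even x) ≡ - evenSign (even y)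
    by-parity x y refl = trans (cong evenSign (even-suc y)) (evenSign-not (even y))

  sgn-adjacent : sgn (tr a b ∘ₚ σ) ≡ - sgn σ
  sgn-adjacent with <ᵇ-total (toℕ i₀) (toℕ j₀) (i₀≢j₀ ∘ Fₚ.toℕ-injective)
  ... | inj₁ (p , q) = by-parity (inversions σ') (inversions σ) (ℚ[]-injective (begin
      ℚ[ inversions σ' ]           ≡⟨ sym (ℚₚ.+-identityʳ _) ⟩
      ℚ[ inversions σ' ] + 0ℚ      ≡⟨ cong (λ b → ℚ[ inversions σ' ] + 𝟙 b) (sym q) ⟩
      _                            ≡⟨ balance ⟩
      _                            ≡⟨ cong (λ b → ℚ[ inversions σ ] + 𝟙 b) p ⟩
      ℚ[ inversions σ ] + 1ℚ       ≡⟨ ℚₚ.+-comm ℚ[ inversions σ ] 1ℚ ⟩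
      1ℚ + ℚ[ inversions σ ]       ≡⟨ sym (ℚ[]-suc (inversions σ)) ⟩
      ℚ[ suc (inversions σ) ] ∎))
  ... | inj₂ (p , q) = trans (sym (neg-neg (sgn σ'))) (cong -_ (sym (by-parity (inversions σ) (inversions σ') (ℚ[]-injective (begin
      ℚ[ inversions σ ]            ≡⟨ sym (ℚₚ.+-identityʳ _) ⟩
      ℚ[ inversions σ ] + 0ℚ       ≡⟨ cong (λ b → ℚ[ inversions σ ] + 𝟙 b) (sym p) ⟩
      _                            ≡⟨ sym balance ⟩
      _                            ≡⟨ cong (λ b → ℚ[ inversions σ' ] + 𝟙 b) q ⟩
      ℚ[ inversions σ' ] + 1ℚ      ≡⟨ ℚₚ.+-comm ℚ[ inversions σ' ] 1ℚ ⟩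
      1ℚ + ℚ[ inversions σ' ]      ≡⟨ sym (ℚ[]-suc (inversions σ')) ⟩
      ℚ[ suc (inversions σ') ] ∎)))))
    where
    neg-neg : ∀ x → - (- x) ≡ x
    neg-neg = solve-∀ ℚ-ring

module _ {m : ℕ} where

  tr-comm : (a b : Fin m) → tr a b ≡ tr b a
  tr-comm a b = Vₚ.tabulate-cong (sw-comm a b)

  tr-split : {a b c : Fin m} → a ≢ b → a ≢ c → (σ : Perm m) → tr a b ∘ₚ σ ≡ tr c b ∘ₚ (tr a c ∘ₚ (tr c b ∘ₚ σ))
  tr-split {a} {b} {c} a≢b a≢c σ = Vec-ext λ i → sym (begin
    lookup (tr c b ∘ₚ (tr a c ∘ₚ (tr c b ∘ₚ σ))) i ≡⟨ lookup-tr∘ c b (tr a c ∘ₚ (tr c b ∘ₚ σ)) i ⟩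
    sw c b (lookup (tr a c ∘ₚ (tr c b ∘ₚ σ)) i)    ≡⟨ cong (sw c b) (lookup-tr∘ a c (tr c b ∘ₚ σ) i) ⟩
    sw c b (sw a c (lookup (tr c b ∘ₚ σ) i))       ≡⟨ cong (sw c b ∘ sw a c) (lookup-tr∘ c b σ i) ⟩
    sw c b (sw a c (sw c b (lookup σ i)))          ≡⟨ sw-nat (sw c b) (sw-inj c b) a c _ ⟩
    sw (sw c b a) (sw c b c) (sw c b (sw c b (lookup σ i)))
      ≡⟨ cong₂ (λ x y → sw x y (sw c b (sw c b (lookup σ i)))) (sw-o a≢c a≢b) (sw-l c b) ⟩
    sw a b (sw c b (sw c b (lookup σ i)))          ≡⟨ cong (sw a b) (sw-invol c b _) ⟩
    sw a b (lookup σ i)                            ≡⟨ sym (lookup-tr∘ a b σ i) ⟩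
    lookup (tr a b ∘ₚ σ) i ∎)

  -- Induction on the distance: with c the predecessor of b, (a b) = (c b)(a c)(c b), two adjacent
  -- factors and one of smaller distance, hence three changes of sign.
  sgn-ascending : ∀ d {σ : Perm m} → IsPerm σ → {a b : Fin m} → toℕ b ≡ suc (d ℕ.+ toℕ a) → sgn (tr a b ∘ₚ σ) ≡ - sgn σ
  sgn-ascending zero s e = sgn-adjacent s e
  sgn-ascending (suc d) {σ} s {a} {b} e = begin
    sgn (tr a b ∘ₚ σ)                             ≡⟨ cong sgn (tr-split a≢b a≢c σ) ⟩
    sgn (tr c b ∘ₚ (tr a c ∘ₚ (tr c b ∘ₚ σ)))     ≡⟨ sgn-adjacent (∘-isPerm (tr-isPerm a c) (∘-isPerm (tr-isPerm c b) s)) c<b ⟩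
    - sgn (tr a c ∘ₚ (tr c b ∘ₚ σ))               ≡⟨ cong -_ (sgn-ascending d (∘-isPerm (tr-isPerm c b) s) c≡) ⟩
    - (- sgn (tr c b ∘ₚ σ))                       ≡⟨ cong (-_ ∘ -_) (sgn-adjacent s c<b) ⟩
    - (- (- sgn σ))                               ≡⟨ neg³ (sgn σ) ⟩
    - sgn σ ∎
    where
    neg³ : ∀ x → - (- (- x)) ≡ - x
    neg³ = solve-∀ ℚ-ring
    c<m : suc (d ℕ.+ toℕ a) ℕ.< m
    c<m = ℕₚ.<-trans (ℕₚ.≤-reflexive (sym e)) (Fₚ.toℕ<n b)
    c : Fin m
    c = F.fromℕ< c<m
    c≡ : toℕ c ≡ suc (d ℕ.+ toℕ a)
    c≡ = Fₚ.toℕ-fromℕ< c<m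
    c<b : toℕ b ≡ suc (toℕ c)
    c<b = trans e (cong suc (sym c≡))
    a≢b : a ≢ b
    a≢b refl = ℕₚ.m≢1+n+m (toℕ a) e
    a≢c : a ≢ c
    a≢c a≡c = ℕₚ.m≢1+n+m (toℕ a) (trans (cong toℕ a≡c) c≡)

  sgn-tr : {σ : Perm m} → IsPerm σ → {a b : Fin m} → a ≢ b → sgn (tr a b ∘ₚ σ) ≡ - sgn σ
  sgn-tr {σ} s {a} {b} a≢b with ℕₚ.<-cmp (toℕ a) (toℕ b)
  ... | tri< lt _ _ = sgn-ascending (toℕ b ℕ.∸ suc (toℕ a)) s
          (sym (trans (sym (ℕₚ.+-suc _ (toℕ a))) (ℕₚ.m∸n+n≡m lt)))
  ... | tri≈ _ eq _ = ⊥-elim (a≢b (Fₚ.toℕ-injective eq))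
  ... | tri> _ _ gt = trans (cong (λ t → sgn (t ∘ₚ σ)) (tr-comm a b)) (sgn-ascending (toℕ a ℕ.∸ suc (toℕ b)) s
          (sym (trans (sym (ℕₚ.+-suc _ (toℕ b))) (ℕₚ.m∸n+n≡m gt))))

-- Sums over vertices

abstract
  -- Opaque, so that nested sums are compared by their summands and never unfolded into folds over
  -- lists.
  ∑ : ∀ {m} → (Fin m → ℚ) → ℚ
  ∑ {m} f = Σℚ (allFin m) f

  ∑-def : ∀ {m} (f : Fin m → ℚ) → ∑ f ≡ Σℚ (allFin m) f
  ∑-def f = refl

  ∑-cong : ∀ {m} {f g : Fin m → ℚ} → (∀ i → f i ≡ g i) → ∑ f ≡ ∑ g
  ∑-cong {m} = Σ-cong (allFin m)

  ∑-+ : ∀ {m} (f g : Fin m → ℚ) → ∑ (λ i → f i + g i) ≡ ∑ f + ∑ g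
  ∑-+ {m} = Σ-+ (allFin m)

  ∑-- : ∀ {m} (f g : Fin m → ℚ) → ∑ (λ i → f i - g i) ≡ ∑ f - ∑ g
  ∑-- {m} = Σ-- (allFin m)

  ∑-*ˡ : ∀ {m} (c : ℚ) (f : Fin m → ℚ) → ∑ (λ i → c * f i) ≡ c * ∑ f
  ∑-*ˡ {m} = Σ-*ˡ (allFin m)

  ∑-*ʳ : ∀ {m} (c : ℚ) (f : Fin m → ℚ) → ∑ (λ i → f i * c) ≡ ∑ f * c
  ∑-*ʳ {m} = Σ-*ʳ (allFin m)

  ∑-const : ∀ {m} (c : ℚ) → ∑ {m} (λ _ → c) ≡ ℚ[ m ] * c
  ∑-const {m} c = trans (Σ-const (allFin m) c) (cong (λ k → ℚ[ k ] * c) (length-allFin m))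
    where
    length-allFin : ∀ m → length (allFin m) ≡ m
    length-allFin m = Lₚ.length-tabulate id

  ∑-Σ : ∀ {m} {A : Set} (xs : List A) (f : Fin m → A → ℚ) → ∑ (λ i → Σℚ xs (f i)) ≡ Σℚ xs (λ x → ∑ (λ i → f i x))
  ∑-Σ {m} = Σ-swap (allFin m)

  ∑-swap : ∀ {m n} (f : Fin m → Fin n → ℚ) → ∑ (λ i → ∑ (f i)) ≡ ∑ (λ j → ∑ (λ i → f i j))
  ∑-swap {m} {n} = Σ-swap (allFin m) (allFin n)

  ∑-≥0 : ∀ {m} (f : Fin m → ℚ) → (∀ i → 0ℚ ≤ℚ f i) → 0ℚ ≤ℚ ∑ f
  ∑-≥0 {m} f h = Σ-≥0∈ (allFin m) f (λ i _ → h i)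

  ∑-δ : ∀ {m} (x : Fin m) (f : Fin m → ℚ) → ∑ (λ y → 𝟙 (y ==ᶠ x) * f y) ≡ f x
  ∑-δ {m} x f = Σ-δ (_==ᶠ x) (Uₚ.allFin⁺ m) (∈-allFin x) (==ᶠ-refl x) (λ y _ → ==ᶠ-≢) f

  ∑-reindex : ∀ {m} {σ : Perm m} → IsPerm σ → (f : Fin m → ℚ) → ∑ (λ i → f (lookup σ i)) ≡ ∑ f
  ∑-reindex = Σ-reindex

  ∑-countᵇ : ∀ {m} (p : Fin m → Bool) → ∑ (λ i → 𝟙 (p i)) ≡ ℚ[ countᵇ p (allFin m) ]
  ∑-countᵇ {m} p = Σ-countᵇ p (allFin m)

module _ {m : ℕ} where

  ∑∑-+ : (f g : Fin m → Fin m → ℚ) → ∑ (λ a → ∑ (λ b → f a b + g a b)) ≡ ∑ (λ a → ∑ (f a)) + ∑ (λ a → ∑ (g a))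
  ∑∑-+ f g = trans (∑-cong (λ a → ∑-+ (f a) (g a))) (∑-+ (λ a → ∑ (f a)) (λ a → ∑ (g a)))

  ∑∑-- : (f g : Fin m → Fin m → ℚ) → ∑ (λ a → ∑ (λ b → f a b - g a b)) ≡ ∑ (λ a → ∑ (f a)) - ∑ (λ a → ∑ (g a))
  ∑∑-- f g = trans (∑-cong (λ a → ∑-- (f a) (g a))) (∑-- (λ a → ∑ (f a)) (λ a → ∑ (g a)))

  ∑∑-*ˡ : (k : ℚ) (f : Fin m → Fin m → ℚ) → ∑ (λ a → ∑ (λ c → k * f a c)) ≡ k * ∑ (λ a → ∑ (f a))
  ∑∑-*ˡ k f = trans (∑-cong (λ a → ∑-*ˡ k (f a))) (∑-*ˡ k (λ a → ∑ (f a)))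

  ∑∑-Σ : {A : Set} (xs : List A) (f : A → Fin m → Fin m → ℚ) →
    ∑ (λ a → ∑ (λ b → Σℚ xs (λ x → f x a b))) ≡ Σℚ xs (λ x → ∑ (λ a → ∑ (f x a)))
  ∑∑-Σ xs f = trans (∑-cong (λ a → ∑-Σ xs (λ b x → f x a b))) (∑-Σ xs (λ a x → ∑ (f x a)))

  ∑∑-reindex : {σ : Perm m} → IsPerm σ → (f : Fin m → Fin m → ℚ) →
    ∑ (λ a → ∑ (λ b → f (lookup σ a) (lookup σ b))) ≡ ∑ (λ a → ∑ (f a))
  ∑∑-reindex {σ} s f = trans (∑-cong (λ a → ∑-reindex s (f (lookup σ a)))) (∑-reindex s (λ a → ∑ (f a)))

  ∑³ : (Fin m → Fin m → Fin m → ℚ) → ℚ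
  ∑³ f = ∑ λ a → ∑ λ b → ∑ λ c → f a b c

  ∑³-cong : {f g : Fin m → Fin m → Fin m → ℚ} → (∀ a b c → f a b c ≡ g a b c) → ∑³ f ≡ ∑³ g
  ∑³-cong h = ∑-cong λ a → ∑-cong λ b → ∑-cong λ c → h a b c

  ∑³-+ : (f g : Fin m → Fin m → Fin m → ℚ) → ∑³ (λ a b c → f a b c + g a b c) ≡ ∑³ f + ∑³ g
  ∑³-+ f g = trans (∑-cong (λ a → ∑∑-+ (f a) (g a))) (∑-+ (λ a → ∑ (λ b → ∑ (f a b))) (λ a → ∑ (λ b → ∑ (g a b))))

  ∑³-- : (f g : Fin m → Fin m → Fin m → ℚ) → ∑³ (λ a b c → f a b c - g a b c) ≡ ∑³ f - ∑³ g
  ∑³-- f g = trans (∑-cong (λ a → ∑∑-- (f a) (g a))) (∑-- (λ a → ∑ (λ b → ∑ (f a b))) (λ a → ∑ (λ b → ∑ (g a b))))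

  ∑³-*ˡ : (k : ℚ) (f : Fin m → Fin m → Fin m → ℚ) → ∑³ (λ a b c → k * f a b c) ≡ k * ∑³ f
  ∑³-*ˡ k f = trans (∑-cong (λ a → ∑∑-*ˡ k (f a))) (∑-*ˡ k (λ a → ∑ (λ b → ∑ (f a b))))

  ∑³-Σ : {A : Set} (xs : List A) (f : A → Fin m → Fin m → Fin m → ℚ) →
    ∑³ (λ a b c → Σℚ xs (λ x → f x a b c)) ≡ Σℚ xs (λ x → ∑³ (f x))
  ∑³-Σ xs f = trans (∑-cong (λ a → ∑∑-Σ xs (λ x b c → f x a b c))) (∑-Σ xs (λ a x → ∑ (λ b → ∑ (f x a b))))

  ∑³-reindex : {σ : Perm m} → IsPerm σ → (f : Fin m → Fin m → Fin m → ℚ) →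
    ∑³ (λ a b c → f (lookup σ a) (lookup σ b) (lookup σ c)) ≡ ∑³ f
  ∑³-reindex {σ} s f = trans (∑-cong (λ a → ∑∑-reindex s (f (lookup σ a)))) (∑-reindex s (λ a → ∑ (λ b → ∑ (f a b))))

  ∑³-rotate : (f : Fin m → Fin m → Fin m → ℚ) → ∑³ (λ a b c → f b c a) ≡ ∑³ f
  ∑³-rotate f = trans (∑-swap (λ a b → ∑ (λ c → f b c a))) (∑-cong (λ b → ∑-swap (λ a c → f b c a)))

  ∑³-reverse : (f : Fin m → Fin m → Fin m → ℚ) → ∑³ (λ a b c → f c b a) ≡ ∑³ f
  ∑³-reverse f = trans (∑-cong (λ a → ∑-swap (λ b c → f c b a))) (∑³-rotate f)

self-neg⇒0 : ∀ x → - x ≡ x → x ≡ 0ℚ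
self-neg⇒0 x h = trans (lem x) (trans (cong (λ y → ½ * (x + y)) (sym h)) (lem' x))
  where
  lem : ∀ x → x ≡ ½ * (x + x)
  lem = solve-∀ ℚ-ring
  lem' : ∀ x → ½ * (x - x) ≡ 0ℚ
  lem' = solve-∀ ℚ-ring

-- Absorption of transpositions and 3-cycles by the Young symmetrizer

module Shape (m : ℕ) (ν : List ℕ) where

  row col : Fin m → ℕ
  row i = rowOf ν (toℕ i)
  col i = colOf ν (toℕ i)

  -- `corner` is where weakly decreasing row lengths enter: an upper row reaches every column that a
  -- lower row occupies.
  record IsDiagram : Set where
    field
      corner : ∀ a b → row a ℕ.< row b → ∃ λ c → row c ≡ row a × col c ≡ col b
      cell-inj : ∀ {a b} → row a ≡ row b → col a ≡ col b → a ≡ b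
  open IsDiagram public

  R C : List (Perm m)
  R = rowGroup m ν
  C = colGroup m ν

  stabilizes : (Fin m → ℕ) → Perm m → Bool
  stabilizes f σ = allᵇ (λ k → f (lookup σ k) ≡ᵇ f k) (allFin m)

  ∈stabilizer⁻ : (f : Fin m → ℕ) {σ : Perm m} → σ ∈ filterᵇ (stabilizes f) (allPerms m) →
    IsPerm σ × (∀ k → f (lookup σ k) ≡ f k)
  ∈stabilizer⁻ f {σ} σ∈ with ∈-filterᵇ⁻ (stabilizes f) {allPerms m} σ∈
  ... | h , t = isPerm h , λ k → ℕₚ.≡ᵇ⇒≡ _ _ (≡⇒T (allᵇ⁻ (λ k → f (lookup σ k) ≡ᵇ f k) (allFin m) t (∈-allFin k)))

  ∈stabilizer⁺ : (f : Fin m → ℕ) {σ : Perm m} → IsPerm σ → (∀ k → f (lookup σ k) ≡ f k) →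
    σ ∈ filterᵇ (stabilizes f) (allPerms m)
  ∈stabilizer⁺ f p h = ∈-filterᵇ⁺ (stabilizes f) (∈allPerms p)
    (allᵇ⁺ _ (allFin m) (λ k _ → T⇒≡ (ℕₚ.≡⇒≡ᵇ _ _ (h k))))

  sw-stabilizes : (f : Fin m → ℕ) {a b : Fin m} → f a ≡ f b → ∀ k → f (sw a b k) ≡ f k
  sw-stabilizes f {a} {b} e k with swView a b k
  ... | isL refl = trans (cong f (sw-l a b)) (sym e)
  ... | isR refl = trans (cong f (sw-r a b)) e
  ... | isO p q = cong f (sw-o p q)

  R-∘tr : ∀ {a b} → row a ≡ row b → ∀ {p} → p ∈ R → p ∘ₚ tr a b ∈ R
  R-∘tr {a} {b} e {p} p∈ with ∈stabilizer⁻ row p∈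
  ... | ip , h = ∈stabilizer⁺ row (∘-isPerm ip (tr-isPerm a b)) λ k →
    trans (cong row (trans (lookup-∘ p (tr a b) k) (cong (lookup p) (lookup-tr a b k))))
      (trans (h (sw a b k)) (sw-stabilizes row e k))

  C-tr∘ : ∀ {a b} → col a ≡ col b → ∀ {q} → q ∈ C → tr a b ∘ₚ q ∈ C
  C-tr∘ {a} {b} e {q} q∈ with ∈stabilizer⁻ col q∈
  ... | iq , h = ∈stabilizer⁺ col (∘-isPerm (tr-isPerm a b) iq) λ k →
    trans (cong col (lookup-tr∘ a b q k)) (trans (sw-stabilizes col e (lookup q k)) (h k))

  R-unique : Unique R
  R-unique = filterᵇ-unique (stabilizes row) (allPerms-unique m)

  C-unique : Unique C
  C-unique = filterᵇ-unique (stabilizes col) (allPerms-unique m)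

  ∘tr-invol : (a b : Fin m) (p : Perm m) → (p ∘ₚ tr a b) ∘ₚ tr a b ≡ p
  ∘tr-invol a b p = Vec-ext λ i → begin
    lookup ((p ∘ₚ tr a b) ∘ₚ tr a b) i  ≡⟨ lookup-∘ (p ∘ₚ tr a b) (tr a b) i ⟩
    lookup (p ∘ₚ tr a b) (lookup (tr a b) i) ≡⟨ lookup-∘ p (tr a b) (lookup (tr a b) i) ⟩
    lookup p (lookup (tr a b) (lookup (tr a b) i))
      ≡⟨ cong (lookup p) (trans (lookup-tr a b _) (trans (cong (sw a b) (lookup-tr a b i)) (sw-invol a b i))) ⟩
    lookup p i ∎

  tr∘-invol : (a b : Fin m) (q : Perm m) → tr a b ∘ₚ (tr a b ∘ₚ q) ≡ q
  tr∘-invol a b q = Vec-ext λ i → trans (lookup-tr∘ a b (tr a b ∘ₚ q) i)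
    (trans (cong (sw a b) (lookup-tr∘ a b q i)) (sw-invol a b _))

  -- r and k are the indicators of "same row" and of "same column but different cell".
  abstract
    r k : Fin m → Fin m → ℚ
    r a b = 𝟙 (row a ≡ᵇ row b)
    k a b = 𝟙 (col a ≡ᵇ col b) * 𝟙 (not (a ==ᶠ b))

    r-def : ∀ a b → r a b ≡ 𝟙 (row a ≡ᵇ row b)
    r-def a b = refl

    k-def : ∀ a b → k a b ≡ 𝟙 (col a ≡ᵇ col b) * 𝟙 (not (a ==ᶠ b))
    k-def a b = refl

    r-yes : ∀ {a b} → row a ≡ row b → r a b ≡ 1ℚ
    r-yes {a} {b} e = cong 𝟙 (T⇒≡ (ℕₚ.≡⇒≡ᵇ (row a) (row b) e))

    r-no : ∀ {a b} → row a ≢ row b → r a b ≡ 0ℚ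
    r-no {a} {b} h with row a ≡ᵇ row b in e
    ... | true = ⊥-elim (h (ℕₚ.≡ᵇ⇒≡ _ _ (≡⇒T e)))
    ... | false = refl

    k-yes : ∀ {a b} → col a ≡ col b → a ≢ b → k a b ≡ 1ℚ
    k-yes {a} {b} e h rewrite T⇒≡ (ℕₚ.≡⇒≡ᵇ (col a) (col b) e) | ==ᶠ-≢ h = refl

    k-no : ∀ {a b} → col a ≢ col b → k a b ≡ 0ℚ
    k-no {a} {b} h with col a ≡ᵇ col b in e
    ... | true = ⊥-elim (h (ℕₚ.≡ᵇ⇒≡ _ _ (≡⇒T e)))
    ... | false = ℚₚ.*-zeroˡ (𝟙 (not (a ==ᶠ b)))

    k-refl : ∀ a → k a a ≡ 0ℚ
    k-refl a rewrite ==ᶠ-refl a = ℚₚ.*-zeroʳ (𝟙 (col a ≡ᵇ col a))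

  module Absorb (u : Fun m) (X : Perm m) where

    -- The Young symmetrizer evaluated at X with `f` inserted between the column and the row
    -- permutations; `Y id` is one summand of an isotypic function.
    Y : (Perm m → Perm m) → ℚ
    Y f = Σℚ C (λ q → Σℚ R (λ p → sgn q * u (act p (f (act q X)))))

    Y-cong : {f g : Perm m → Perm m} → (∀ Z → f Z ≡ g Z) → Y f ≡ Y g
    Y-cong h = Σ-cong C λ q → Σ-cong R λ p → cong (λ Z → sgn q * u (act p Z)) (h (act q X))

    -- Right multiplication by (a b) permutes R and merges the transposition into p.
    row-absorb : (f : Perm m → Perm m) {a b : Fin m} → row a ≡ row b → Y (λ Z → a ↔ b · f Z) ≡ Y f
    row-absorb f {a} {b} e = Σ-cong C λ q → trans
      (Σ-cong∈ R λ p p∈ → cong (λ Z → sgn q * u Z) (sym (act-∘ (proj₁ (∈stabilizer⁻ row p∈)) (tr-isPerm a b) (f (act q X)))))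
      (Σ-involution R (_∘ₚ tr a b) R-unique (R-∘tr e) (λ {p} → ∘tr-invol a b p) (λ p → sgn q * u (act p (f (act q X)))))

    -- Left multiplication by (a b) permutes C and merges the transposition into q, at the price of
    -- one sign.
    col-absorb : (f : Perm m → Perm m) {a b : Fin m} → col a ≡ col b → a ≢ b → Y (λ Z → f (a ↔ b · Z)) ≡ - Y f
    col-absorb f {a} {b} e a≢b = begin
      Y (λ Z → f (a ↔ b · Z)) ≡⟨ Σ-cong∈ C step ⟩
      Σℚ C (λ q → - G (tr a b ∘ₚ q)) ≡⟨ Σ-neg C (λ q → G (tr a b ∘ₚ q)) ⟩
      - Σℚ C (λ q → G (tr a b ∘ₚ q)) ≡⟨ cong -_ (Σ-involution C (tr a b ∘ₚ_) C-unique (C-tr∘ e) (λ {q} → tr∘-invol a b q) G) ⟩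
      - Y f ∎
      where
      G : Perm m → ℚ
      G q = Σℚ R (λ p → sgn q * u (act p (f (act q X))))
      neg² : ∀ s x → s * x ≡ - (- s * x)
      neg² = solve-∀ ℚ-ring
      step : ∀ q → q ∈ C → Σℚ R (λ p → sgn q * u (act p (f (a ↔ b · act q X)))) ≡ - G (tr a b ∘ₚ q)
      step q q∈ with ∈stabilizer⁻ col q∈
      ... | iq , _ = begin
        Σℚ R (λ p → sgn q * u (act p (f (a ↔ b · act q X))))
          ≡⟨ Σ-cong R (λ p → trans (neg² (sgn q) _) (cong₂ (λ s Z → - (s * u (act p (f Z)))) (sym (sgn-tr iq a≢b)) (sym (act-∘ (tr-isPerm a b) iq X)))) ⟩
        Σℚ R (λ p → - (sgn (tr a b ∘ₚ q) * u (act p (f (act (tr a b ∘ₚ q) X)))))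
          ≡⟨ Σ-neg R (λ p → sgn (tr a b ∘ₚ q) * u (act p (f (act (tr a b ∘ₚ q) X)))) ⟩
        - G (tr a b ∘ₚ q) ∎

    -- A column transposition to the right of f that equals a row transposition to its left makes Y f its own negative.
    absorb-zero : (f : Perm m → Perm m) {x y x' y' : Fin m} → col x ≡ col y → x ≢ y → row x' ≡ row y' →
      (∀ Z → f (x ↔ y · Z) ≡ x' ↔ y' · f Z) → Y f ≡ 0ℚ
    absorb-zero f {x} {y} {x'} {y'} ec n er h = self-neg⇒0 (Y f)
      (trans (sym (col-absorb f ec n)) (trans (Y-cong h) (row-absorb f er)))

-- Scalars of transpositions and 3-cycles on a shape

module Diagram (m : ℕ) (ν : List ℕ) (D : Shape.IsDiagram m ν) where

  open Shape m ν

  k-row : ∀ {a b} → row a ≡ row b → k a b ≡ 0ℚ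
  k-row {a} {b} e with col a ℕ.≟ col b
  ... | no n = k-no n
  ... | yes e' = trans (cong (k a) (sym (cell-inj D e e'))) (k-refl a)

  -- At a = b this is 1, as the trivial transposition demands; hence `r` holds on the diagonal and
  -- `k` does not.
  swap-scalar : Fin m → Fin m → ℚ
  swap-scalar a b = r a b - k a b

  -- A 3-cycle inside a row acts by 1, inside a column also by 1, being even; on a hook it is a row
  -- times a column transposition and acts by -1. For distinct cells at most one of the five terms
  -- is nonzero.
  cycle-scalar : Fin m → Fin m → Fin m → ℚ
  cycle-scalar a b c = r a b * r b c + k a b * k b c * k c a - r a b * k b c - r b c * k c a - r c a * k a b

  -- For c = a the cycle degenerates to the identity, whose scalar is 1.
  cycle-correction : Fin m → Fin m → Fin m → ℚ
  cycle-correction a b c = 𝟙 (c ==ᶠ a) * (1ℚ - swap-scalar a b)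

  module Scalars (u : Fun m) (X : Perm m) where

    open Absorb u X

    Y₁ : ℚ
    Y₁ = Y id

    -- In the last case let row a lie above row b, and let c be the cell in the row of a and the
    -- column of b. Then (a b)(b c) = (a c)(a b) with (b c) a column and (a c) a row transposition.
    Y-swap : ∀ a b → Y (a ↔ b ·_) ≡ swap-scalar a b * Y₁
    Y-swap a b with row a ℕ.≟ row b
    ... | yes e rewrite r-yes e | k-row e = trans (row-absorb id e) (lem Y₁)
      where
      lem : ∀ y → y ≡ (1ℚ - 0ℚ) * y
      lem = solve-∀ ℚ-ring
    ... | no n with col a ℕ.≟ col b
    ... | yes e rewrite r-no n | k-yes e (n ∘ cong row) = trans (col-absorb id e (n ∘ cong row)) (lem Y₁)
      where
      lem : ∀ y → - y ≡ (0ℚ - 1ℚ) * y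
      lem = solve-∀ ℚ-ring
    ... | no n' rewrite r-no n | k-no n' = trans (zero-case (ℕₚ.<-cmp (row a) (row b))) (lem Y₁)
      where
      lem : ∀ y → 0ℚ ≡ (0ℚ - 0ℚ) * y
      lem = solve-∀ ℚ-ring
      zero-below : ∀ a b → row a ℕ.< row b → col a ≢ col b → Y (a ↔ b ·_) ≡ 0ℚ
      zero-below a b lt n' with corner D a b lt
      ... | c , er , ec = absorb-zero (a ↔ b ·_) {b} {c} {a} {c} (sym ec) (λ b≡c → ℕₚ.<⇒≢ lt (trans (sym er) (cong row (sym b≡c)))) (sym er)
        λ Z → trans (↔-conj a b b c Z) (cong₂ (λ x y → x ↔ y · a ↔ b · Z) (sw-r a b)
          (sw-o (λ c≡a → n' (trans (cong col (sym c≡a)) ec)) (λ c≡b → ℕₚ.<⇒≢ lt (trans (sym er) (cong row c≡b)))))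
      zero-case : _ → Y (a ↔ b ·_) ≡ 0ℚ
      zero-case (tri< lt _ _) = zero-below a b lt n'
      zero-case (tri≈ _ e _) = ⊥-elim (n e)
      zero-case (tri> _ _ gt) = trans (Y-cong (↔-comm a b)) (zero-below b a gt (n' ∘ sym))

    cycle : Fin m → Fin m → Fin m → Perm m → Perm m
    cycle a b c Z = a ↔ b · b ↔ c · Z

    cycle-rotate : ∀ {a b c} → a ≢ b → a ≢ c → ∀ Z → cycle a b c Z ≡ cycle b c a Z
    cycle-rotate {a} {b} {c} p q Z = sym (trans (↔-conj b c c a Z)
      (trans (cong₂ (λ x y → x ↔ y · b ↔ c · Z) (sw-r b c) (sw-o p q)) (↔-comm b a _)))

    -- For d in the row of b and the column of a, (a d) is a column and (b d) a row transposition.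
    -- The 3-cycle sends a to b and fixes d, so it conjugates the first into the second.
    Y-cycle-generic : ∀ {a b c} → a ≢ b → b ≢ c → c ≢ a → row b ℕ.< row a → row b ≢ row c →
      col a ≢ col b → col a ≢ col c → Y (cycle a b c) ≡ 0ℚ
    Y-cycle-generic {a} {b} {c} ab bc ca lt rbc cab cac with corner D b a lt
    ... | d , er , ec = absorb-zero (cycle a b c) {a} {d} {b} {d} (sym ec) a≢d (sym er)
      λ Z → trans (cong (a ↔ b ·_) (↔-conj b c a d Z)) (trans (↔-conj a b _ _ _)
        (cong₂ (λ x y → x ↔ y · cycle a b c Z)
          (trans (cong (sw a b) (sw-o ab (ca ∘ sym))) (sw-l a b))
          (trans (cong (sw a b) (sw-o d≢b d≢c)) (sw-o (a≢d ∘ sym) d≢b))))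
      where
      a≢d : a ≢ d
      a≢d e = ℕₚ.<⇒≢ lt (trans (sym er) (cong row (sym e)))
      d≢b : d ≢ b
      d≢b e = cab (trans (sym ec) (cong col e))
      d≢c : d ≢ c
      d≢c e = rbc (trans (sym er) (cong row e))

    -- After a rotation one factor of the 3-cycle is absorbed, on the left if two cells share a row,
    -- on the right if two share a column. The remaining factor is a transposition handled by
    -- `Y-swap`.
    Y-cycle-distinct : ∀ {a b c} → a ≢ b → b ≢ c → c ≢ a → Y (cycle a b c) ≡ cycle-scalar a b c * Y₁
    Y-cycle-distinct {a} {b} {c} ab bc ca
      with row a ℕ.≟ row b | row b ℕ.≟ row c | row c ℕ.≟ row a
    ... | yes e | yes e' | _ rewrite r-yes e | r-yes e' | k-row e | k-row e' | k-row (sym (trans e e')) =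
      trans (row-absorb (b ↔ c ·_) e) (trans (Y-swap b c) (trans (cong (_* Y₁) (cong₂ _-_ (r-yes e') (k-row e'))) (lem Y₁ (r c a))))
      where
      lem : ∀ y x → (1ℚ - 0ℚ) * y ≡ (1ℚ * 1ℚ + 0ℚ * 0ℚ * 0ℚ - 1ℚ * 0ℚ - 1ℚ * 0ℚ - x * 0ℚ) * y
      lem = solve-∀ ℚ-ring
    ... | yes e | no n | _ rewrite r-yes e | r-no n | k-row e =
      trans (row-absorb (b ↔ c ·_) e) (trans (Y-swap b c) (trans (cong (λ x → (x - k b c) * Y₁) (r-no n)) (lem Y₁ (r c a) (k b c) (k c a))))
      where
      lem : ∀ y x v w → (0ℚ - v) * y ≡ (1ℚ * 0ℚ + 0ℚ * v * w - 1ℚ * v - 0ℚ * w - x * 0ℚ) * y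
      lem = solve-∀ ℚ-ring
    ... | no n | yes e | yes e' = ⊥-elim (n (trans (sym e') (sym e)))
    ... | no n | yes e | no n' rewrite r-no n | r-yes e | r-no n' | k-row e =
      trans (Y-cong (cycle-rotate ab (ca ∘ sym))) (trans (row-absorb (c ↔ a ·_) e)
        (trans (Y-swap c a) (trans (cong (λ x → (x - k c a) * Y₁) (r-no n')) (lem Y₁ (k c a) (k a b)))))
      where
      lem : ∀ y v w → (0ℚ - v) * y ≡ (0ℚ * 1ℚ + w * 0ℚ * v - 0ℚ * 0ℚ - 1ℚ * v - 0ℚ * w) * y
      lem = solve-∀ ℚ-ring
    ... | no n | no n' | yes e rewrite r-no n | r-no n' | r-yes e | k-row e =
      trans (Y-cong (λ Z → trans (cycle-rotate ab (ca ∘ sym) Z) (cycle-rotate bc (ab ∘ sym) Z))) (trans (row-absorb (a ↔ b ·_) e)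
        (trans (Y-swap a b) (trans (cong (λ x → (x - k a b) * Y₁) (r-no n)) (lem Y₁ (k a b) (k b c)))))
      where
      lem : ∀ y v w → (0ℚ - v) * y ≡ (0ℚ * 0ℚ + v * w * 0ℚ - 0ℚ * w - 0ℚ * 0ℚ - 1ℚ * v) * y
      lem = solve-∀ ℚ-ring
    ... | no n | no n' | no n'' rewrite r-no n | r-no n' | r-no n'' =
      trans (columns (col a ℕ.≟ col b) (col b ℕ.≟ col c) (col c ℕ.≟ col a)) (lem Y₁ (k a b) (k b c) (k c a))
      where
      lem : ∀ y u v w → u * v * w * y ≡ (0ℚ * 0ℚ + u * v * w - 0ℚ * v - 0ℚ * w - 0ℚ * u) * y
      lem = solve-∀ ℚ-ring
      generic : col a ≢ col b → col b ≢ col c → col c ≢ col a → Y (cycle a b c) ≡ 0ℚ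
      -- Row indices cannot increase at every step around a cycle, so some rotation starts with a
      -- descent.
      generic cab cbc cca with ℕₚ.<-cmp (row a) (row b) | ℕₚ.<-cmp (row b) (row c) | ℕₚ.<-cmp (row c) (row a)
      ... | tri> _ _ gt | _ | _ = Y-cycle-generic ab bc ca gt n' cab (cca ∘ sym)
      ... | tri≈ _ e _ | _ | _ = ⊥-elim (n e)
      ... | _ | tri> _ _ gt | _ = trans (Y-cong (cycle-rotate ab (ca ∘ sym))) (Y-cycle-generic bc ca ab gt n'' cbc (cab ∘ sym))
      ... | _ | tri≈ _ e _ | _ = ⊥-elim (n' e)
      ... | _ | _ | tri> _ _ gt = trans (Y-cong (λ Z → trans (cycle-rotate ab (ca ∘ sym) Z) (cycle-rotate bc (ab ∘ sym) Z)))
                                    (Y-cycle-generic ca ab bc gt n cca (cbc ∘ sym))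
      ... | _ | _ | tri≈ _ e _ = ⊥-elim (n'' e)
      ... | tri< p _ _ | tri< q _ _ | tri< s _ _ = ⊥-elim (ℕₚ.<-irrefl refl (ℕₚ.<-trans p (ℕₚ.<-trans q s)))
      columns : Dec (col a ≡ col b) → Dec (col b ≡ col c) → Dec (col c ≡ col a) → Y (cycle a b c) ≡ k a b * k b c * k c a * Y₁
      columns (yes e) (yes e') _ = trans (col-absorb (a ↔ b ·_) e' bc) (trans (cong -_ (Y-swap a b))
        (trans (cong₂ (λ x y → - ((x - y) * Y₁)) (r-no n) (k-yes e ab))
          (trans (f Y₁) (sym (cong₂ (λ x y → x * y * Y₁) (cong₂ _*_ (k-yes e ab) (k-yes e' bc)) (k-yes (sym (trans e e')) ca))))))
        where
        f : ∀ y → - ((0ℚ - 1ℚ) * y) ≡ 1ℚ * 1ℚ * 1ℚ * y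
        f = solve-∀ ℚ-ring
      columns (no h) (yes e') _ = trans (col-absorb (a ↔ b ·_) e' bc) (trans (cong -_ (Y-swap a b))
        (trans (cong₂ (λ x y → - ((x - y) * Y₁)) (r-no n) (k-no h))
          (trans (f Y₁ (k b c) (k c a)) (sym (cong (λ x → x * k b c * k c a * Y₁) (k-no h))))))
        where
        f : ∀ y v w → - ((0ℚ - 0ℚ) * y) ≡ 0ℚ * v * w * y
        f = solve-∀ ℚ-ring
      columns _ (no h) (yes e') = trans (Y-cong (cycle-rotate ab (ca ∘ sym))) (trans (col-absorb (b ↔ c ·_) e' ca) (trans (cong -_ (Y-swap b c))
        (trans (cong₂ (λ x y → - ((x - y) * Y₁)) (r-no n') (k-no h))
          (trans (f Y₁ (k a b) (k c a)) (sym (cong (λ x → k a b * x * k c a * Y₁) (k-no h)))))))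
        where
        f : ∀ y v w → - ((0ℚ - 0ℚ) * y) ≡ v * 0ℚ * w * y
        f = solve-∀ ℚ-ring
      columns (yes e') (no _) (no h) = trans (Y-cong (λ Z → trans (cycle-rotate ab (ca ∘ sym) Z) (cycle-rotate bc (ab ∘ sym) Z)))
        (trans (col-absorb (c ↔ a ·_) e' ab) (trans (cong -_ (Y-swap c a))
        (trans (cong₂ (λ x y → - ((x - y) * Y₁)) (r-no n'') (k-no h))
          (trans (f Y₁ (k a b) (k b c)) (sym (cong (λ x → k a b * k b c * x * Y₁) (k-no h)))))))
        where
        f : ∀ y v w → - ((0ℚ - 0ℚ) * y) ≡ v * w * 0ℚ * y
        f = solve-∀ ℚ-ring
      columns (no h) (no h') (no h'') = trans (generic h h' h'')
        (trans (f Y₁ (k b c) (k c a)) (sym (cong (λ x → x * k b c * k c a * Y₁) (k-no h))))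
        where
        f : ∀ y v w → 0ℚ ≡ 0ℚ * v * w * y
        f = solve-∀ ℚ-ring

    -- For a = b or b = c the product is a transposition, and `cycle-scalar` already reduces to its
    -- scalar. Only c = a, where the product is the identity, needs the correction.
    Y-cycle : ∀ a b c → Y (cycle a b c) ≡ (cycle-scalar a b c + cycle-correction a b c) * Y₁
    Y-cycle a b c with c ≟ᶠ a
    ... | yes refl = trans (Y-cong (λ Z → trans (cong (a ↔ b ·_) (↔-comm b a Z)) (↔-invol a b Z)))
        (trans (sym (ℚₚ.*-identityˡ Y₁)) (cong (_* Y₁) (sym scalar)))
      where
      scalar : cycle-scalar c b c + 1ℚ * (1ℚ - swap-scalar c b) ≡ 1ℚ
      scalar with row c ℕ.≟ row b
      ... | yes e rewrite r-yes e | r-yes (sym e) | k-row e | k-row (sym e) | k-refl c | r-yes {c} {c} refl = refl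
      ... | no n rewrite r-no n | r-no (n ∘ sym) | k-refl c | r-yes {c} {c} refl = lem (k c b) (k b c)
        where
        lem : ∀ x y → (0ℚ * 0ℚ + x * y * 0ℚ - 0ℚ * y - 0ℚ * 0ℚ - 1ℚ * x) + 1ℚ * (1ℚ - (0ℚ - x)) ≡ 1ℚ
        lem = solve-∀ ℚ-ring
    ... | no ca = trans body (cong (_* Y₁) (lem (cycle-scalar a b c) (1ℚ - swap-scalar a b)))
      where
      lem : ∀ x y → x ≡ x + 0ℚ * y
      lem = solve-∀ ℚ-ring
      body : Y (cycle a b c) ≡ cycle-scalar a b c * Y₁
      body with a ≟ᶠ b | b ≟ᶠ c
      ... | yes refl | _ rewrite r-yes {a} {a} refl | k-refl a =
        trans (row-absorb (a ↔ c ·_) {a} {a} refl) (trans (Y-swap a c) (cong (_* Y₁) (trans (lem' (r a c) (k a c) (k c a) (r c a))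
          (cong (λ x → 1ℚ * r a c + 0ℚ * k a c * k c a - 1ℚ * k a c - x - r c a * 0ℚ) (sym rk)))))
        where
        lem' : ∀ x y z t → x - y ≡ 1ℚ * x + 0ℚ * y * z - 1ℚ * y - 0ℚ - t * 0ℚ
        lem' = solve-∀ ℚ-ring
        rk : r a c * k c a ≡ 0ℚ
        rk with row a ℕ.≟ row c
        ... | yes e rewrite k-row (sym e) = ℚₚ.*-zeroʳ (r a c)
        ... | no n rewrite r-no n = ℚₚ.*-zeroˡ (k c a)
      ... | no _ | yes refl rewrite r-yes {b} {b} refl | k-refl b =
        trans (Y-cong (λ Z → cong (a ↔ b ·_) (↔-id b Z))) (trans (Y-swap a b) (cong (_* Y₁) scalar))
        where
        scalar : r a b - k a b ≡ r a b * 1ℚ + k a b * 0ℚ * k b a - r a b * 0ℚ - 1ℚ * k b a - r b a * k a b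
        scalar with row a ℕ.≟ row b | col a ℕ.≟ col b
        ... | yes e | _ rewrite r-yes e | k-row e | k-row (sym e) = lem' (r b a)
          where
          lem' : ∀ x → 1ℚ - 0ℚ ≡ 1ℚ * 1ℚ + 0ℚ * 0ℚ * 0ℚ - 1ℚ * 0ℚ - 1ℚ * 0ℚ - x * 0ℚ
          lem' = solve-∀ ℚ-ring
        ... | no n | yes e rewrite r-no n | r-no (n ∘ sym) | k-yes e (ca ∘ sym) | k-yes (sym e) ca = refl
        ... | no n | no n' rewrite r-no n | r-no (n ∘ sym) | k-no n' | k-no (n' ∘ sym) = refl
      ... | no ab | no bc = Y-cycle-distinct ab bc ca

  -- Ordered tuples are counted. As `r` holds on the diagonal, `row₂`, `row₃` and `hook` include
  -- tuples with repeated cells.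
  row₂ col₂ row₃ col₃ hook : ℚ
  row₂ = ∑ λ a → ∑ λ b → r a b
  col₂ = ∑ λ a → ∑ λ b → k a b
  row₃ = ∑ λ a → ∑ λ b → ∑ λ c → r a b * r b c
  col₃ = ∑ λ a → ∑ λ b → ∑ λ c → k a b * k b c * k c a
  hook = ∑ λ a → ∑ λ b → ∑ λ c → r a b * k b c

  isotypic-term : (u : Perm m → Fun m) → Perm m → Perm m → ℚ
  isotypic-term u P g = Scalars.Y₁ (u g) (act g P)

  module _ (w : Fun m) (iso : InIsotypic m ν w) where

    private
      u = proj₁ iso
      w≡ = proj₂ iso

      summand : Perm m → (Perm m → Perm m) → Perm m → Perm m → Perm m → ℚ
      summand P f g q p = sgn q * u g (act p (f (act q (act g P))))

      value : ∀ {P} → IsMatching P → w P ≡ Σℚ (allPerms m) (isotypic-term u P)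
      value M = w≡ _ (∈matchings M)

      shift : {g q : Perm m} → IsPerm g → q ∈ C → (a b : Fin m) (Z : Perm m) →
        act q (act g (a ↔ b · Z)) ≡ lookup (q ∘ₚ g) a ↔ lookup (q ∘ₚ g) b · act q (act g Z)
      shift {g} {q} ig q∈ a b Z = trans (cong (act q) (act-↔ ig a b Z))
        (trans (act-↔ (proj₁ (∈stabilizer⁻ col q∈)) _ _ (act g Z))
          (cong₂ (λ x y → x ↔ y · act q (act g Z)) (sym (lookup-∘ q g a)) (sym (lookup-∘ q g b))))

    -- Carrying a transposition past g and q relabels a and b by q g, which leaves the sum over all
    -- pairs unchanged. Inside the symmetrizer each transposition then acts by its own scalar.
    swaps-scalar : ∀ {P} → IsMatching P → ∑ (λ a → ∑ (λ b → w (a ↔ b · P))) ≡ (row₂ - col₂) * w P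
    swaps-scalar {P} M = begin
      ∑ (λ a → ∑ (λ b → w (a ↔ b · P)))
        ≡⟨ ∑-cong (λ a → ∑-cong (λ b → value (↔-matching a b M))) ⟩
      ∑ (λ a → ∑ (λ b → Σℚ (allPerms m) (isotypic-term u (a ↔ b · P))))
        ≡⟨ ∑∑-Σ (allPerms m) (λ g a b → isotypic-term u (a ↔ b · P) g) ⟩
      Σℚ (allPerms m) (λ g → ∑ (λ a → ∑ (λ b → isotypic-term u (a ↔ b · P) g)))
        ≡⟨ Σ-cong∈ (allPerms m) (λ g g∈ → inner g (isPerm g∈)) ⟩
      Σℚ (allPerms m) (λ g → (row₂ - col₂) * isotypic-term u P g)
        ≡⟨ Σ-*ˡ (allPerms m) (row₂ - col₂) (isotypic-term u P) ⟩
      (row₂ - col₂) * Σℚ (allPerms m) (isotypic-term u P)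
        ≡⟨ cong ((row₂ - col₂) *_) (sym (value M)) ⟩
      (row₂ - col₂) * w P ∎
      where
      inner : ∀ g → IsPerm g → ∑ (λ a → ∑ (λ b → isotypic-term u (a ↔ b · P) g)) ≡ (row₂ - col₂) * isotypic-term u P g
      inner g ig = begin
        ∑ (λ a → ∑ (λ b → isotypic-term u (a ↔ b · P) g))
          ≡⟨ ∑∑-Σ C (λ q a b → Σℚ R (summand (a ↔ b · P) id g q)) ⟩
        Σℚ C (λ q → ∑ (λ a → ∑ (λ b → Σℚ R (summand (a ↔ b · P) id g q))))
          ≡⟨ Σ-cong∈ C (λ q q∈ → trans
              (∑-cong (λ a → ∑-cong (λ b → Σ-cong R (λ p → cong (λ Z → sgn q * u g (act p Z)) (shift ig q∈ a b P)))))
              (∑∑-reindex (∘-isPerm (proj₁ (∈stabilizer⁻ col q∈)) ig) (λ a b → Σℚ R (summand P (a ↔ b ·_) g q)))) ⟩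
        Σℚ C (λ q → ∑ (λ a → ∑ (λ b → Σℚ R (summand P (a ↔ b ·_) g q))))
          ≡⟨ sym (∑∑-Σ C (λ q a b → Σℚ R (summand P (a ↔ b ·_) g q))) ⟩
        ∑ (λ a → ∑ (λ b → Absorb.Y (u g) (act g P) (a ↔ b ·_)))
          ≡⟨ ∑-cong (λ a → trans (∑-cong (λ b → Scalars.Y-swap (u g) (act g P) a b)) (∑-*ʳ (isotypic-term u P g) (swap-scalar a))) ⟩
        ∑ (λ a → ∑ (swap-scalar a) * isotypic-term u P g)
          ≡⟨ ∑-*ʳ (isotypic-term u P g) (λ a → ∑ (swap-scalar a)) ⟩
        ∑ (λ a → ∑ (swap-scalar a)) * isotypic-term u P g
          ≡⟨ cong (_* isotypic-term u P g) (trans (∑-cong (λ a → ∑-- (r a) (k a))) (∑-- (λ a → ∑ (r a)) (λ a → ∑ (k a)))) ⟩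
        (row₂ - col₂) * isotypic-term u P g ∎

    -- The bracket is the total of `cycle-correction`: the triples with c = a form m² pairs (a, b).
    cycles-total : ℚ
    cycles-total = row₃ + col₃ - ⟦ 3 ⟧ * hook + (ℚ[ m ] * ℚ[ m ] - (row₂ - col₂))

    private
      total : ∑ (λ a → ∑ (λ b → ∑ (λ c → cycle-scalar a b c + cycle-correction a b c))) ≡ cycles-total
      total = trans (∑³-+ cycle-scalar cycle-correction) (cong₂ _+_ scalars corrections)
        where
        rk kr : Fin m → Fin m → Fin m → ℚ
        rk a b c = r a b * k b c
        kr a b c = r a b * r b c + k a b * k b c * k c a
        lem : ∀ x h → x - h - h - h ≡ x - ⟦ 3 ⟧ * h
        lem = solve-∀ ℚ-ring
        scalars : ∑ (λ a → ∑ (λ b → ∑ (cycle-scalar a b))) ≡ row₃ + col₃ - ⟦ 3 ⟧ * hook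
        scalars = trans (∑³-- (λ a b c → kr a b c - rk a b c - rk b c a) (λ a b c → rk c a b))
          (trans (cong₂ _-_ (trans (∑³-- (λ a b c → kr a b c - rk a b c) (λ a b c → rk b c a))
              (cong₂ _-_ (trans (∑³-- kr rk) (cong (_- hook) (∑³-+ (λ a b c → r a b * r b c) (λ a b c → k a b * k b c * k c a)))) (∑³-rotate rk)))
            (trans (∑³-rotate (λ a b c → rk b c a)) (∑³-rotate rk)))
          (lem (row₃ + col₃) hook))
        corrections : ∑ (λ a → ∑ (λ b → ∑ (cycle-correction a b))) ≡ ℚ[ m ] * ℚ[ m ] - (row₂ - col₂)
        corrections = begin
          ∑ (λ a → ∑ (λ b → ∑ (cycle-correction a b)))
            ≡⟨ ∑-cong (λ a → ∑-cong (λ b → ∑-δ a (λ _ → 1ℚ - swap-scalar a b))) ⟩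
          ∑ (λ a → ∑ (λ b → 1ℚ - swap-scalar a b))
            ≡⟨ trans (∑-cong (λ a → ∑-- (λ _ → 1ℚ) (swap-scalar a))) (∑-- (λ a → ∑ {m} (λ b → 1ℚ)) (λ a → ∑ (swap-scalar a))) ⟩
          ∑ {m} (λ a → ∑ {m} (λ b → 1ℚ)) - ∑ (λ a → ∑ (swap-scalar a))
            ≡⟨ cong₂ _-_ (trans (∑-cong {m} (λ a → trans (∑-const {m} 1ℚ) (ℚₚ.*-identityʳ ℚ[ m ]))) (∑-const {m} ℚ[ m ]))
                 (trans (∑-cong (λ a → ∑-- (r a) (k a))) (∑-- (λ a → ∑ (r a)) (λ a → ∑ (k a)))) ⟩
          ℚ[ m ] * ℚ[ m ] - (row₂ - col₂) ∎

    cycles-scalar : ∀ {P} → IsMatching P → ∑ (λ a → ∑ (λ b → ∑ (λ c → w (a ↔ b · b ↔ c · P)))) ≡ cycles-total * w P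
    cycles-scalar {P} M = begin
      ∑ (λ a → ∑ (λ b → ∑ (λ c → w (a ↔ b · b ↔ c · P))))
        ≡⟨ ∑-cong (λ a → ∑-cong (λ b → ∑-cong (λ c → value (↔-matching a b (↔-matching b c M))))) ⟩
      ∑ (λ a → ∑ (λ b → ∑ (λ c → Σℚ (allPerms m) (isotypic-term u (a ↔ b · b ↔ c · P)))))
        ≡⟨ ∑³-Σ (allPerms m) (λ g a b c → isotypic-term u (a ↔ b · b ↔ c · P) g) ⟩
      Σℚ (allPerms m) (λ g → ∑ (λ a → ∑ (λ b → ∑ (λ c → isotypic-term u (a ↔ b · b ↔ c · P) g))))
        ≡⟨ Σ-cong∈ (allPerms m) (λ g g∈ → inner g (isPerm g∈)) ⟩
      Σℚ (allPerms m) (λ g → cycles-total * isotypic-term u P g)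
        ≡⟨ Σ-*ˡ (allPerms m) cycles-total (isotypic-term u P) ⟩
      cycles-total * Σℚ (allPerms m) (isotypic-term u P)
        ≡⟨ cong (cycles-total *_) (sym (value M)) ⟩
      cycles-total * w P ∎
      where
      inner : ∀ g → IsPerm g → ∑ (λ a → ∑ (λ b → ∑ (λ c → isotypic-term u (a ↔ b · b ↔ c · P) g))) ≡ cycles-total * isotypic-term u P g
      inner g ig = begin
        ∑ (λ a → ∑ (λ b → ∑ (λ c → isotypic-term u (a ↔ b · b ↔ c · P) g)))
          ≡⟨ ∑³-Σ C (λ q a b c → Σℚ R (summand (a ↔ b · b ↔ c · P) id g q)) ⟩
        Σℚ C (λ q → ∑ (λ a → ∑ (λ b → ∑ (λ c → Σℚ R (summand (a ↔ b · b ↔ c · P) id g q)))))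
          ≡⟨ Σ-cong∈ C (λ q q∈ → trans
              (∑-cong (λ a → ∑-cong (λ b → ∑-cong (λ c → Σ-cong R (λ p → cong (λ Z → sgn q * u g (act p Z))
                (trans (shift ig q∈ a b (b ↔ c · P)) (cong (lookup (q ∘ₚ g) a ↔ lookup (q ∘ₚ g) b ·_) (shift ig q∈ b c P))))))))
              (∑³-reindex (∘-isPerm (proj₁ (∈stabilizer⁻ col q∈)) ig) (λ a b c → Σℚ R (summand P (λ Z → a ↔ b · b ↔ c · Z) g q)))) ⟩
        Σℚ C (λ q → ∑ (λ a → ∑ (λ b → ∑ (λ c → Σℚ R (summand P (λ Z → a ↔ b · b ↔ c · Z) g q)))))
          ≡⟨ sym (∑³-Σ C (λ q a b c → Σℚ R (summand P (λ Z → a ↔ b · b ↔ c · Z) g q))) ⟩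
        ∑ (λ a → ∑ (λ b → ∑ (λ c → Absorb.Y (u g) (act g P) (λ Z → a ↔ b · b ↔ c · Z))))
          ≡⟨ ∑-cong (λ a → ∑-cong (λ b → trans (∑-cong (λ c → Scalars.Y-cycle (u g) (act g P) a b c)) (∑-*ʳ y (f a b)))) ⟩
        ∑ (λ a → ∑ (λ b → ∑ (f a b) * y))
          ≡⟨ ∑-cong (λ a → ∑-*ʳ y (λ b → ∑ (f a b))) ⟩
        ∑ (λ a → ∑ (λ b → ∑ (f a b)) * y)
          ≡⟨ ∑-*ʳ y (λ a → ∑ (λ b → ∑ (f a b))) ⟩
        ∑ (λ a → ∑ (λ b → ∑ (f a b))) * y
          ≡⟨ cong (_* y) total ⟩
        cycles-total * y ∎
        where
        y = isotypic-term u P g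
        f : Fin m → Fin m → Fin m → ℚ
        f a b c = cycle-scalar a b c + cycle-correction a b c

∑-involution : ∀ {m} {σ : Fin m → Fin m} → (∀ i → σ (σ i) ≡ i) → (f : Fin m → ℚ) → ∑ (λ i → f (σ i)) ≡ ∑ f
∑-involution {m} {σ} h f = trans (∑-cong (λ i → cong f (sym (Vₚ.lookup∘tabulate σ i)))) (∑-reindex σ-perm f)
  where
  σ-perm : IsPerm (V.tabulate σ)
  σ-perm = record
    { inj = λ {i} {j} e → trans (sym (h i)) (trans (cong σ (trans (sym (Vₚ.lookup∘tabulate σ i)) (trans e (Vₚ.lookup∘tabulate σ j)))) (h j))
    ; surj = λ i → σ i , trans (Vₚ.lookup∘tabulate σ (σ i)) (h i) }

-- Switching edges of a matching

-- Finite identities and inequalities about coincidence patterns are proved by evaluating all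
-- Boolean cases.
∀ᵇ? : {Q : Bool → Set} → (∀ b → Dec (Q b)) → Dec (∀ b → Q b)
∀ᵇ? d = map′ (λ { (t , f) true → t ; (t , f) false → f }) (λ h → h true , h false) (d true ×-dec d false)

transitiveᵇ : Bool → Bool → Bool → Bool
transitiveᵇ xy yz xz = (not (xy ∧ yz) ∨ xz) ∧ (not (xy ∧ xz) ∨ yz) ∧ (not (yz ∧ xz) ∨ xy)

none : Bool → Bool → Bool → Bool → Bool → Bool → Bool
none bd ba bc da dc ac = not bd ∧ not ba ∧ not bc ∧ not da ∧ not dc ∧ not ac

-- Transitivity on the four triangles among b, d, a, c: the six Booleans describe an equivalence
-- relation.
consistent : Bool → Bool → Bool → Bool → Bool → Bool → Bool
consistent bd ba bc da dc ac = transitiveᵇ bd da ba ∧ transitiveᵇ bd dc bc ∧ transitiveᵇ ba ac bc ∧ transitiveᵇ da ac dc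

-- The coefficients are the values μ(0̂, π) of the Möbius function of the lattice of partitions π of {b, d, a, c}.
partition-terms : List (ℚ × (Bool → Bool → Bool → Bool → Bool → Bool → ℚ))
partition-terms =
    (1ℚ     , λ bd ba bc da dc ac → 1ℚ)
  ∷ (- 1ℚ   , λ bd ba bc da dc ac → 𝟙 bd)
  ∷ (- 1ℚ   , λ bd ba bc da dc ac → 𝟙 ac)
  ∷ (- 1ℚ   , λ bd ba bc da dc ac → 𝟙 ba)
  ∷ (- 1ℚ   , λ bd ba bc da dc ac → 𝟙 bc)
  ∷ (- 1ℚ   , λ bd ba bc da dc ac → 𝟙 da)
  ∷ (- 1ℚ   , λ bd ba bc da dc ac → 𝟙 dc)
  ∷ (1ℚ     , λ bd ba bc da dc ac → 𝟙 bd * 𝟙 ac)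
  ∷ (1ℚ     , λ bd ba bc da dc ac → 𝟙 ba * 𝟙 dc)
  ∷ (1ℚ     , λ bd ba bc da dc ac → 𝟙 bc * 𝟙 da)
  ∷ (⟦ 2 ⟧ , λ bd ba bc da dc ac → 𝟙 bd * 𝟙 ba)
  ∷ (⟦ 2 ⟧ , λ bd ba bc da dc ac → 𝟙 bd * 𝟙 bc)
  ∷ (⟦ 2 ⟧ , λ bd ba bc da dc ac → 𝟙 ba * 𝟙 bc)
  ∷ (⟦ 2 ⟧ , λ bd ba bc da dc ac → 𝟙 da * 𝟙 dc)
  ∷ (- ⟦ 6 ⟧ , λ bd ba bc da dc ac → 𝟙 bd * (𝟙 ba * 𝟙 bc))
  ∷ []

-- The values of the Möbius function, summed over all partitions finer than or equal to the actual
-- coincidence partition, give 1 exactly if nothing coincides. Of the 64 patterns the 15 consistent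
-- ones are the set partitions.
möbius : ∀ bd ba bc da dc ac → consistent bd ba bc da dc ac ≡ true →
  𝟙 (none bd ba bc da dc ac) ≡ Σℚ partition-terms (λ t → proj₁ t * proj₂ t bd ba bc da dc ac)
möbius = from-yes (∀ᵇ? λ bd → ∀ᵇ? λ ba → ∀ᵇ? λ bc → ∀ᵇ? λ da → ∀ᵇ? λ dc → ∀ᵇ? λ ac →
  (consistent bd ba bc da dc ac ≟ᵇ true) →-dec
  (𝟙 (none bd ba bc da dc ac) ℚₚ.≟ Σℚ partition-terms (λ t → proj₁ t * proj₂ t bd ba bc da dc ac)))

module Matching {m : ℕ} {P : Perm m} (M : IsMatching P) where

  p : Fin m → Fin m
  p = lookup P

  abstract
    _~_ : Fin m → Fin m → Bool
    x ~ y = (y ==ᶠ x) ∨ (y ==ᶠ p x)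

    ~-apart : ∀ {x y} → y ≢ x → y ≢ p x → (x ~ y) ≡ false
    ~-apart n n' = cong₂ _∨_ (==ᶠ-≢ n) (==ᶠ-≢ n')

    ~-same : ∀ x → (x ~ x) ≡ true
    ~-same x rewrite ==ᶠ-refl x = refl

    ~-mateʳ : ∀ x z → (p x ~ z) ≡ (x ~ z)
    ~-mateʳ x z = trans (cong (λ y → (z ==ᶠ p x) ∨ (z ==ᶠ y)) (inv M x)) (∨-comm (z ==ᶠ p x) (z ==ᶠ x))

    𝟙~ : ∀ x y → 𝟙 (x ~ y) ≡ 𝟙 (y ==ᶠ x) + 𝟙 (y ==ᶠ p x)
    𝟙~ x y with y ≟ᶠ x
    ... | yes refl rewrite ==ᶠ-≢ (fpf M y ∘ sym) = refl
    ... | no n = sym (ℚₚ.+-identityˡ _)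

  data ~View (x y : Fin m) : Set where
    same : y ≡ x → ~View x y
    mate : y ≡ p x → ~View x y
    apart : y ≢ x → y ≢ p x → (x ~ y) ≡ false → ~View x y

  ~view : ∀ x y → ~View x y
  ~view x y with y ≟ᶠ x | y ≟ᶠ p x
  ... | yes e | _ = same e
  ... | no _ | yes e = mate e
  ... | no n | no n' = apart n n' (~-apart n n')

  ~-mate : ∀ x → (x ~ p x) ≡ true
  ~-mate x = trans (sym (~-mateʳ x (p x))) (~-same (p x))

  private
    transitive-refl : ∀ q → transitiveᵇ true q q ≡ true
    transitive-refl true = refl
    transitive-refl false = refl

    transitive-false : ∀ q r → (q ∧ r) ≡ false → transitiveᵇ false q r ≡ true
    transitive-false true true ()
    transitive-false true false _ = refl
    transitive-false false r _ = refl

  ~-transitive : ∀ x y z → transitiveᵇ (x ~ y) (y ~ z) (x ~ z) ≡ true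
  ~-transitive x y z with ~view x y
  ... | same refl rewrite ~-same x = transitive-refl (x ~ z)
  ... | mate refl rewrite ~-mate x | ~-mateʳ x z = transitive-refl (x ~ z)
  ... | apart n n' e rewrite e = transitive-false (y ~ z) (x ~ z) (disjoint (~view y z) (~view x z))
    where
    disjoint : ~View y z → ~View x z → ((y ~ z) ∧ (x ~ z)) ≡ false
    disjoint (apart _ _ e) _ rewrite e = refl
    disjoint _ (apart _ _ e) rewrite e = ∧-zeroʳ (y ~ z)
    disjoint (same refl) (same e) = ⊥-elim (n e)
    disjoint (same refl) (mate e) = ⊥-elim (n' e)
    disjoint (mate refl) (same e) = ⊥-elim (n' (trans (sym (inv M y)) (cong p e)))
    disjoint (mate refl) (mate e) = ⊥-elim (n (trans (sym (inv M y)) (trans (cong p e) (inv M x))))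

  ∑~ : ∀ x (f : Fin m → ℚ) → ∑ (λ y → 𝟙 (x ~ y) * f y) ≡ f x + f (p x)
  ∑~ x f = begin
    ∑ (λ y → 𝟙 (x ~ y) * f y)
      ≡⟨ ∑-cong (λ y → trans (cong (_* f y) (𝟙~ x y)) (ℚₚ.*-distribʳ-+ (f y) (𝟙 (y ==ᶠ x)) _)) ⟩
    ∑ (λ y → 𝟙 (y ==ᶠ x) * f y + 𝟙 (y ==ᶠ p x) * f y)
      ≡⟨ ∑-+ _ _ ⟩
    ∑ (λ y → 𝟙 (y ==ᶠ x) * f y) + ∑ (λ y → 𝟙 (y ==ᶠ p x) * f y)
      ≡⟨ cong₂ _+_ (∑-δ x f) (∑-δ (p x) f) ⟩
    f x + f (p x) ∎

  ∑-mate : (f : Fin m → ℚ) → ∑ (λ x → f (p x)) ≡ ∑ f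
  ∑-mate = ∑-involution (inv M)

  p-inj : ∀ {x y} → p x ≡ p y → x ≡ y
  p-inj = inj (matching-isPerm M)

  -- Exchanging the two ends of an edge maps every edge to itself. All collapses of degenerate
  -- switches rest on this.
  ↔-edge : ∀ a → a ↔ p a · P ≡ P
  ↔-edge a = Vec-ext λ x → trans (lookup-↔ a (p a) P x) (at x)
    where
    at : ∀ x → sw a (p a) (p (sw a (p a) x)) ≡ p x
    at x with swView a (p a) x
    ... | isL refl = trans (cong (sw a (p a) ∘ p) (sw-l a (p a))) (trans (cong (sw a (p a)) (inv M a)) (sw-l a (p a)))
    ... | isR refl = trans (cong (sw a (p a) ∘ p) (sw-r a (p a))) (trans (sw-r a (p a)) (sym (inv M a)))
    ... | isO n n' = trans (cong (sw a (p a) ∘ p) (sw-o n n'))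
        (sw-o (λ e → n' (p-inj (trans e (sym (inv M a))))) (n ∘ p-inj))

  -- The switch replaces the edges {a, p a} and {b, p b} by {a, p b} and {b, p a}.
  module Apart {a b : Fin m} (n : b ≢ a) (n' : b ≢ p a) where

    private
      Q = a ↔ b · P
      via : ∀ {x y z} → sw a b x ≡ y → sw a b (p y) ≡ z → lookup Q x ≡ z
      via {x} e e' = trans (lookup-↔ a b P x) (trans (cong (sw a b ∘ p) e) e')
      pb≢a : p b ≢ a
      pb≢a e = n' (trans (sym (inv M b)) (cong p e))

    at-a : lookup Q a ≡ p b
    at-a = via (sw-l a b) (sw-o pb≢a (fpf M b))
    at-b : lookup Q b ≡ p a
    at-b = via (sw-r a b) (sw-o (fpf M a) (n' ∘ sym))
    at-pa : lookup Q (p a) ≡ b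
    at-pa = via (sw-o (fpf M a) (n' ∘ sym)) (trans (cong (sw a b) (inv M a)) (sw-l a b))
    at-pb : lookup Q (p b) ≡ a
    at-pb = via (sw-o pb≢a (fpf M b)) (trans (cong (sw a b) (inv M b)) (sw-r a b))
    at-else : ∀ {x} → x ≢ a → x ≢ b → x ≢ p a → x ≢ p b → lookup Q x ≡ p x
    at-else {x} xa xb xpa xpb = via (sw-o xa xb) (sw-o (λ e → xpa (trans (sym (inv M x)) (cong p e))) (λ e → xpb (trans (sym (inv M x)) (cong p e))))

  -- Exchanging a with b or their mates with each other produces the same new edges {a, p b} and {b,
  -- p a}.
  ↔-mates : ∀ a b → a ↔ b · P ≡ p a ↔ p b · P
  ↔-mates a b with ~view a b
  ... | same refl = trans (↔-id a P) (sym (↔-id (p a) P))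
  ... | mate refl = trans (↔-comm a (p a) P) (cong (λ x → p a ↔ x · P) (sym (inv M a)))
  ... | apart n n' _ = Vec-ext at
    where
    module A = Apart {a} {b} n n'
    module B = Apart {p a} {p b} (n ∘ p-inj) (n' ∘ p-inj)
    at : ∀ x → lookup (a ↔ b · P) x ≡ lookup (p a ↔ p b · P) x
    at x with x ≟ᶠ a | x ≟ᶠ b | x ≟ᶠ p a | x ≟ᶠ p b
    ... | yes refl | _ | _ | _ = trans A.at-a (sym (subst (λ z → lookup (p a ↔ p b · P) z ≡ p b) (inv M a) B.at-pa))
    ... | _ | yes refl | _ | _ = trans A.at-b (sym (subst (λ z → lookup (p a ↔ p b · P) z ≡ p a) (inv M b) B.at-pb))
    ... | _ | _ | yes refl | _ = trans A.at-pa (sym (trans B.at-a (inv M b)))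
    ... | _ | _ | _ | yes refl = trans A.at-pb (sym (trans B.at-b (inv M a)))
    ... | no x1 | no x2 | no x3 | no x4 = trans (A.at-else x1 x2 x3 x4)
      (sym (B.at-else x3 x4 (λ e → x1 (trans e (inv M a))) (λ e → x2 (trans e (inv M b)))))

  four-edges : Fin m → Fin m → Fin m → Fin m → Bool
  four-edges b d a c = none (b ~ d) (b ~ a) (b ~ c) (d ~ a) (d ~ c) (a ~ c)

-- Sums over quadruples with prescribed coincidences of edges

∑⁴ : ∀ {m} → (Fin m → Fin m → Fin m → Fin m → ℚ) → ℚ
∑⁴ f = ∑ λ b → ∑ λ d → ∑ λ a → ∑ λ c → f b d a c

module _ {m : ℕ} where

  ∑⁴-cong : {f g : Fin m → Fin m → Fin m → Fin m → ℚ} → (∀ b d a c → f b d a c ≡ g b d a c) → ∑⁴ f ≡ ∑⁴ g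
  ∑⁴-cong h = ∑-cong λ b → ∑-cong λ d → ∑-cong λ a → ∑-cong λ c → h b d a c

  ∑⁴-Σ : {A : Set} (xs : List A) (f : A → Fin m → Fin m → Fin m → Fin m → ℚ) →
    ∑⁴ (λ b d a c → Σℚ xs (λ x → f x b d a c)) ≡ Σℚ xs (λ x → ∑⁴ (f x))
  ∑⁴-Σ xs f = trans (∑-cong (λ b → ∑³-Σ xs (λ x d a c → f x b d a c))) (∑-Σ xs (λ b x → ∑³ (f x b)))

  ∑⁴-*ˡ : (k : ℚ) (f : Fin m → Fin m → Fin m → Fin m → ℚ) → ∑⁴ (λ b d a c → k * f b d a c) ≡ k * ∑⁴ f
  ∑⁴-*ˡ k f = trans (∑-cong (λ b → ∑³-*ˡ k (f b))) (∑-*ˡ k (λ b → ∑³ (f b)))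

module SwitchSums {m : ℕ} {P : Perm m} (M : IsMatching P) (w : Fun m) where

  open Matching M

  F : Fin m → Fin m → Fin m → Fin m → ℚ
  F b d a c = w (a ↔ c · b ↔ d · P)

  W S₂ S₃ S₄ : ℚ
  W = w P
  S₂ = ∑ λ a → ∑ λ b → w (a ↔ b · P)
  S₃ = ∑ λ a → ∑ λ b → ∑ λ c → w (a ↔ b · b ↔ c · P)
  S₄ = ∑⁴ F

  private
    μ : ℚ
    μ = ℚ[ m ]

    N : Fin m → ℚ
    N x = ∑ λ c → w (x ↔ c · P)

    -- After the first switch p d is the mate of b, so the second transposition exchanges the ends
    -- of an edge.
    ↔-half : ∀ b d → b ↔ p d · b ↔ d · P ≡ b ↔ d · P
    ↔-half b d with ~view b d
    ... | same refl = trans (cong (b ↔ p b ·_) (↔-id b P)) (trans (↔-edge b) (sym (↔-id b P)))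
    ... | mate refl = trans (cong (λ x → b ↔ x · b ↔ p b · P) (inv M b)) (↔-id b _)
    ... | apart n n' _ = trans (cong (λ x → b ↔ x · b ↔ d · P) (sym (Apart.at-a n n')))
        (Matching.↔-edge (↔-matching b d M) b)

    ↔-half′ : ∀ b d → p b ↔ d · b ↔ d · P ≡ b ↔ d · P
    ↔-half′ b d = begin
      p b ↔ d · b ↔ d · P              ≡⟨ cong (p b ↔ d ·_) (↔-mates b d) ⟩
      p b ↔ d · p b ↔ p d · P          ≡⟨ cong (λ x → p b ↔ x · p b ↔ p d · P) (sym (inv M d)) ⟩
      p b ↔ p (p d) · p b ↔ p d · P    ≡⟨ ↔-half (p b) (p d) ⟩
      p b ↔ p d · P                    ≡⟨ sym (↔-mates b d) ⟩
      b ↔ d · P ∎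

    ↔-edge-conj : ∀ a b d → a ↔ p a · b ↔ d · P ≡ sw a (p a) b ↔ sw a (p a) d · P
    ↔-edge-conj a b d = trans (↔-conj a (p a) b d P) (cong (sw a (p a) b ↔ sw a (p a) d ·_) (↔-edge a))

    F-ac : ∀ b d a c → F b d a c ≡ F b d c a
    F-ac b d a c = cong w (↔-comm a c _)

    F-bd : ∀ b d a c → F b d a c ≡ F d b a c
    F-bd b d a c = cong (λ Z → w (a ↔ c · Z)) (↔-comm b d P)

    swap-ac : (K : Fin m → Fin m → Fin m → Fin m → ℚ) → ∑⁴ (λ b d a c → K b d a c * F b d a c) ≡ ∑⁴ (λ b d a c → K b d c a * F b d a c)
    swap-ac K = ∑-cong λ b → ∑-cong λ d → trans (∑-swap (λ a c → K b d a c * F b d a c))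
      (∑-cong λ c → ∑-cong λ a → cong (K b d a c *_) (F-ac b d a c))

    swap-bd : (K : Fin m → Fin m → Fin m → Fin m → ℚ) → ∑⁴ (λ b d a c → K b d a c * F b d a c) ≡ ∑⁴ (λ b d a c → K d b a c * F b d a c)
    swap-bd K = trans (∑-swap (λ b d → ∑ λ a → ∑ λ c → K b d a c * F b d a c))
      (∑-cong λ d → ∑-cong λ b → ∑-cong λ a → ∑-cong λ c → cong (K b d a c *_) (F-bd b d a c))

    ∑∑~ : (G : Fin m → Fin m → ℚ) → ∑ (λ b → ∑ λ d → 𝟙 (b ~ d) * G b d) ≡ ∑ (λ b → G b b + G b (p b))
    ∑∑~ G = ∑-cong λ b → ∑~ b (G b)

    F-bb : ∀ b a c → F b b a c ≡ w (a ↔ c · P)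
    F-bb b a c = cong (λ Z → w (a ↔ c · Z)) (↔-id b P)

    F-bpb : ∀ b a c → F b (p b) a c ≡ w (a ↔ c · P)
    F-bpb b a c = cong (λ Z → w (a ↔ c · Z)) (↔-edge b)

    constant : ∀ x → ∑ {m} (λ _ → x) ≡ μ * x
    constant = ∑-const

    ∑N : ∑ (λ b → N b + N (p b)) ≡ S₂ + S₂
    ∑N = trans (∑-+ N (λ b → N (p b))) (cong (S₂ +_) (∑-mate N))

    -- For d on the edge of b the inner switch does nothing; each of the 2 m pairs (b, d) leaves one
    -- copy of `S₂`.
    sum-bd : ∑⁴ (λ b d a c → 𝟙 (b ~ d) * F b d a c) ≡ ⟦ 2 ⟧ * (μ * S₂)
    sum-bd = begin
      ∑⁴ (λ b d a c → 𝟙 (b ~ d) * F b d a c)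
        ≡⟨ ∑-cong (λ b → ∑-cong (λ d → ∑∑-*ˡ (𝟙 (b ~ d)) (F b d))) ⟩
      ∑ (λ b → ∑ λ d → 𝟙 (b ~ d) * ∑ (λ a → ∑ (F b d a)))
        ≡⟨ ∑∑~ (λ b d → ∑ λ a → ∑ (F b d a)) ⟩
      ∑ (λ b → ∑ (λ a → ∑ (F b b a)) + ∑ (λ a → ∑ (F b (p b) a)))
        ≡⟨ ∑-cong (λ b → cong₂ _+_ (∑-cong λ a → ∑-cong λ c → F-bb b a c) (∑-cong λ a → ∑-cong λ c → F-bpb b a c)) ⟩
      ∑ {m} (λ b → S₂ + S₂)  ≡⟨ constant (S₂ + S₂) ⟩
      μ * (S₂ + S₂)          ≡⟨ lem μ S₂ ⟩
      ⟦ 2 ⟧ * (μ * S₂) ∎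
      where
      lem : ∀ x y → x * (y + y) ≡ ⟦ 2 ⟧ * (x * y)
      lem = solve-∀ ℚ-ring

    -- For c = a the outer switch disappears. For c = p a the outer transposition fixes P, and
    -- moving it inwards only permutes the pairs (b, d).
    sum-ac : ∑⁴ (λ b d a c → 𝟙 (a ~ c) * F b d a c) ≡ ⟦ 2 ⟧ * (μ * S₂)
    sum-ac = begin
      ∑⁴ (λ b d a c → 𝟙 (a ~ c) * F b d a c)
        ≡⟨ ∑-cong (λ b → ∑-cong (λ d → trans (∑∑~ (F b d)) (∑-+ (λ a → F b d a a) (λ a → F b d a (p a))))) ⟩
      ∑ (λ b → ∑ λ d → ∑ (λ a → F b d a a) + ∑ (λ a → F b d a (p a)))
        ≡⟨ ∑-cong (λ b → ∑-cong (λ d → cong₂ _+_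
             (trans (∑-cong (λ a → cong w (↔-id a _))) (constant (w (b ↔ d · P))))
             (∑-cong (λ a → cong w (↔-edge-conj a b d))))) ⟩
      ∑ (λ b → ∑ λ d → μ * w (b ↔ d · P) + ∑ (λ a → H a b d))
        ≡⟨ trans (∑-cong (λ b → ∑-+ (λ d → μ * w (b ↔ d · P)) (λ d → ∑ (λ a → H a b d)))) (∑-+ (λ b → ∑ λ d → μ * w (b ↔ d · P)) (λ b → ∑ λ d → ∑ λ a → H a b d)) ⟩
      ∑ (λ b → ∑ λ d → μ * w (b ↔ d · P)) + ∑ (λ b → ∑ λ d → ∑ λ a → H a b d)
        ≡⟨ cong₂ _+_ (∑∑-*ˡ μ (λ b d → w (b ↔ d · P)))
             (trans (∑-cong (λ b → ∑-swap (λ d a → H a b d))) (trans (∑-swap (λ b a → ∑ λ d → H a b d)) (trans (∑-cong reindexed) (constant S₂)))) ⟩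
      μ * S₂ + μ * S₂ ≡⟨ lem μ S₂ ⟩
      ⟦ 2 ⟧ * (μ * S₂) ∎
      where
      H : Fin m → Fin m → Fin m → ℚ
      H a b d = w (sw a (p a) b ↔ sw a (p a) d · P)
      reindexed : ∀ a → ∑ (λ b → ∑ λ d → H a b d) ≡ S₂
      reindexed a = trans (∑-cong (λ b → ∑-involution (sw-invol a (p a)) (λ d → w (sw a (p a) b ↔ d · P)))) (∑-involution (sw-invol a (p a)) N)
      lem : ∀ x y → x * y + x * y ≡ ⟦ 2 ⟧ * (x * y)
      lem = solve-∀ ℚ-ring

    -- For a = b this is the triple sum up to renaming. For a = p b, replacing (b d) by the
    -- transposition of the mates and summing over mates gives the same.
    sum-ba : ∑⁴ (λ b d a c → 𝟙 (b ~ a) * F b d a c) ≡ ⟦ 2 ⟧ * S₃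
    sum-ba = begin
      ∑⁴ (λ b d a c → 𝟙 (b ~ a) * F b d a c)
        ≡⟨ ∑-cong (λ b → ∑-cong (λ d → trans (∑-cong (λ a → ∑-*ˡ (𝟙 (b ~ a)) (F b d a))) (∑~ b (λ a → ∑ (F b d a))))) ⟩
      ∑ (λ b → ∑ λ d → ∑ (F b d b) + ∑ (F b d (p b)))
        ≡⟨ trans (∑-cong (λ b → ∑-+ (λ d → ∑ (F b d b)) (λ d → ∑ (F b d (p b))))) (∑-+ (λ b → ∑ λ d → ∑ (F b d b)) (λ b → ∑ λ d → ∑ (F b d (p b)))) ⟩
      U + ∑ (λ b → ∑ λ d → ∑ (F b d (p b)))
        ≡⟨ cong₂ _+_ U≡ (trans mates U≡) ⟩
      S₃ + S₃ ≡⟨ lem S₃ ⟩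
      ⟦ 2 ⟧ * S₃ ∎
      where
      U : ℚ
      U = ∑ λ b → ∑ λ d → ∑ (F b d b)
      U≡ : U ≡ S₃
      U≡ = trans (∑-cong (λ b → trans (∑-swap (F′ b)) (∑-cong (λ c → ∑-cong (λ d → F-ac b d b c)))))
        (∑-swap (λ b c → ∑ λ d → F b d c b))
        where
        F′ : Fin m → Fin m → Fin m → ℚ
        F′ b d c = F b d b c
      mates : ∑ (λ b → ∑ λ d → ∑ (F b d (p b))) ≡ U
      mates = trans (∑-cong (λ b → trans (∑-cong (λ d → ∑-cong (λ c → cong (λ Z → w (p b ↔ c · Z)) (↔-mates b d)))) (∑-mate (λ d → ∑ (F (p b) d (p b))))))
        (∑-mate (λ b → ∑ λ d → ∑ (F b d b)))
      lem : ∀ x → x + x ≡ ⟦ 2 ⟧ * x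
      lem = solve-∀ ℚ-ring

    sum-bc : ∑⁴ (λ b d a c → 𝟙 (b ~ c) * F b d a c) ≡ ⟦ 2 ⟧ * S₃
    sum-bc = trans (swap-ac (λ b d a c → 𝟙 (b ~ c))) sum-ba

    sum-da : ∑⁴ (λ b d a c → 𝟙 (d ~ a) * F b d a c) ≡ ⟦ 2 ⟧ * S₃
    sum-da = trans (swap-bd (λ b d a c → 𝟙 (d ~ a))) sum-ba

    sum-dc : ∑⁴ (λ b d a c → 𝟙 (d ~ c) * F b d a c) ≡ ⟦ 2 ⟧ * S₃
    sum-dc = trans (swap-bd (λ b d a c → 𝟙 (d ~ c))) sum-bc

    sum-bd∧ac : ∑⁴ (λ b d a c → 𝟙 (b ~ d) * 𝟙 (a ~ c) * F b d a c) ≡ ⟦ 4 ⟧ * (μ * (μ * W))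
    sum-bd∧ac = begin
      ∑⁴ (λ b d a c → 𝟙 (b ~ d) * 𝟙 (a ~ c) * F b d a c)
        ≡⟨ ∑-cong (λ b → ∑-cong (λ d → trans (∑-cong (λ a → ∑-cong (λ c → ℚₚ.*-assoc (𝟙 (b ~ d)) (𝟙 (a ~ c)) (F b d a c)))) (∑∑-*ˡ (𝟙 (b ~ d)) (λ a c → 𝟙 (a ~ c) * F b d a c)))) ⟩
      ∑ (λ b → ∑ λ d → 𝟙 (b ~ d) * G b d)
        ≡⟨ ∑∑~ G ⟩
      ∑ (λ b → G b b + G b (p b))
        ≡⟨ ∑-cong (λ b → cong₂ _+_ (G≡ b b (↔-id b P)) (G≡ b (p b) (↔-edge b))) ⟩
      ∑ {m} (λ b → μ * (W + W) + μ * (W + W)) ≡⟨ constant _ ⟩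
      μ * (μ * (W + W) + μ * (W + W)) ≡⟨ lem μ W ⟩
      ⟦ 4 ⟧ * (μ * (μ * W)) ∎
      where
      G : Fin m → Fin m → ℚ
      G b d = ∑ λ a → ∑ λ c → 𝟙 (a ~ c) * F b d a c
      G≡ : ∀ b d → b ↔ d · P ≡ P → G b d ≡ μ * (W + W)
      G≡ b d e = trans (∑∑~ (F b d)) (trans (∑-cong (λ a → cong₂ _+_
        (cong w (trans (↔-id a _) e)) (cong w (trans (cong (a ↔ p a ·_) e) (↔-edge a))))) (constant (W + W)))
      lem : ∀ x y → x * (x * (y + y) + x * (y + y)) ≡ ⟦ 4 ⟧ * (x * (x * y))
      lem = solve-∀ ℚ-ring

    split-ba : (K : Fin m → Fin m → Fin m → ℚ) → ∑⁴ (λ b d a c → 𝟙 (b ~ a) * K b d c * F b d a c) ≡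
      ∑ (λ b → ∑ λ d → ∑ (λ c → K b d c * F b d b c) + ∑ (λ c → K b d c * F b d (p b) c))
    split-ba K = ∑-cong λ b → ∑-cong λ d → trans
      (∑-cong (λ a → trans (∑-cong (λ c → ℚₚ.*-assoc (𝟙 (b ~ a)) (K b d c) (F b d a c))) (∑-*ˡ (𝟙 (b ~ a)) (λ c → K b d c * F b d a c))))
      (∑~ b (λ a → ∑ (λ c → K b d c * F b d a c)))

    -- Of the four choices of a and c, two undo the first switch and two leave its result unchanged.
    sum-ba∧dc : ∑⁴ (λ b d a c → 𝟙 (b ~ a) * 𝟙 (d ~ c) * F b d a c) ≡ ⟦ 2 ⟧ * (μ * (μ * W)) + ⟦ 2 ⟧ * S₂
    sum-ba∧dc = begin
      ∑⁴ (λ b d a c → 𝟙 (b ~ a) * 𝟙 (d ~ c) * F b d a c)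
        ≡⟨ split-ba (λ b d c → 𝟙 (d ~ c)) ⟩
      ∑ (λ b → ∑ λ d → ∑ (λ c → 𝟙 (d ~ c) * F b d b c) + ∑ (λ c → 𝟙 (d ~ c) * F b d (p b) c))
        ≡⟨ ∑-cong (λ b → ∑-cong (λ d → trans (cong₂ _+_ (∑~ d (F b d b)) (∑~ d (F b d (p b))))
             (cong₂ _+_ (cong₂ _+_ (cong w (↔-invol b d P)) (cong w (↔-half b d)))
               (cong₂ _+_ (cong w (↔-half′ b d)) (cong w (trans (cong (p b ↔ p d ·_) (↔-mates b d)) (↔-invol (p b) (p d) P))))))) ⟩
      ∑ (λ b → ∑ λ d → (W + w (b ↔ d · P)) + (w (b ↔ d · P) + W))
        ≡⟨ ∑-cong (λ b → trans (∑-cong (λ d → lem W (w (b ↔ d · P)))) (∑-+ (λ d → ⟦ 2 ⟧ * W) (λ d → ⟦ 2 ⟧ * w (b ↔ d · P)))) ⟩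
      ∑ (λ b → ∑ {m} (λ d → ⟦ 2 ⟧ * W) + ∑ (λ d → ⟦ 2 ⟧ * w (b ↔ d · P)))
        ≡⟨ trans (∑-+ {m} (λ b → ∑ {m} (λ d → ⟦ 2 ⟧ * W)) (λ b → ∑ (λ d → ⟦ 2 ⟧ * w (b ↔ d · P))))
             (cong₂ _+_ (trans (∑-cong {m} (λ b → constant (⟦ 2 ⟧ * W))) (constant (μ * (⟦ 2 ⟧ * W)))) (∑∑-*ˡ ⟦ 2 ⟧ (λ b d → w (b ↔ d · P)))) ⟩
      μ * (μ * (⟦ 2 ⟧ * W)) + ⟦ 2 ⟧ * S₂ ≡⟨ cong (_+ ⟦ 2 ⟧ * S₂) (lem' μ W) ⟩
      ⟦ 2 ⟧ * (μ * (μ * W)) + ⟦ 2 ⟧ * S₂ ∎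
      where
      lem : ∀ x y → (x + y) + (y + x) ≡ ⟦ 2 ⟧ * x + ⟦ 2 ⟧ * y
      lem = solve-∀ ℚ-ring
      lem' : ∀ x y → x * (x * (⟦ 2 ⟧ * y)) ≡ ⟦ 2 ⟧ * (x * (x * y))
      lem' = solve-∀ ℚ-ring

    sum-bc∧da : ∑⁴ (λ b d a c → 𝟙 (b ~ c) * 𝟙 (d ~ a) * F b d a c) ≡ ⟦ 2 ⟧ * (μ * (μ * W)) + ⟦ 2 ⟧ * S₂
    sum-bc∧da = trans (swap-ac (λ b d a c → 𝟙 (b ~ c) * 𝟙 (d ~ a))) sum-ba∧dc

    quadruple : ∀ x → (x + x) + (x + x) ≡ ⟦ 4 ⟧ * x
    quadruple = solve-∀ ℚ-ring

    sum-bd∧ba : ∑⁴ (λ b d a c → 𝟙 (b ~ d) * 𝟙 (b ~ a) * F b d a c) ≡ ⟦ 4 ⟧ * S₂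
    sum-bd∧ba = begin
      ∑⁴ (λ b d a c → 𝟙 (b ~ d) * 𝟙 (b ~ a) * F b d a c)
        ≡⟨ ∑⁴-cong (λ b d a c → cong (_* F b d a c) (ℚₚ.*-comm (𝟙 (b ~ d)) (𝟙 (b ~ a)))) ⟩
      ∑⁴ (λ b d a c → 𝟙 (b ~ a) * 𝟙 (b ~ d) * F b d a c)
        ≡⟨ split-ba (λ b d c → 𝟙 (b ~ d)) ⟩
      ∑ (λ b → ∑ λ d → ∑ (λ c → 𝟙 (b ~ d) * F b d b c) + ∑ (λ c → 𝟙 (b ~ d) * F b d (p b) c))
        ≡⟨ ∑-cong (λ b → trans (∑-cong (λ d → trans (cong₂ _+_ (∑-*ˡ (𝟙 (b ~ d)) (F b d b)) (∑-*ˡ (𝟙 (b ~ d)) (F b d (p b))))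
              (sym (ℚₚ.*-distribˡ-+ (𝟙 (b ~ d)) (∑ (F b d b)) (∑ (F b d (p b))))))) (∑~ b (λ d → ∑ (F b d b) + ∑ (F b d (p b))))) ⟩
      ∑ (λ b → (∑ (F b b b) + ∑ (F b b (p b))) + (∑ (F b (p b) b) + ∑ (F b (p b) (p b))))
        ≡⟨ ∑-cong (λ b → cong₂ _+_ (cong₂ _+_ (∑-cong (F-bb b b)) (∑-cong (F-bb b (p b)))) (cong₂ _+_ (∑-cong (F-bpb b b)) (∑-cong (F-bpb b (p b))))) ⟩
      ∑ (λ b → (N b + N (p b)) + (N b + N (p b)))
        ≡⟨ trans (∑-+ (λ b → N b + N (p b)) (λ b → N b + N (p b))) (cong₂ _+_ ∑N ∑N) ⟩
      (S₂ + S₂) + (S₂ + S₂) ≡⟨ quadruple S₂ ⟩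
      ⟦ 4 ⟧ * S₂ ∎

    sum-bd∧bc : ∑⁴ (λ b d a c → 𝟙 (b ~ d) * 𝟙 (b ~ c) * F b d a c) ≡ ⟦ 4 ⟧ * S₂
    sum-bd∧bc = trans (swap-ac (λ b d a c → 𝟙 (b ~ d) * 𝟙 (b ~ c))) sum-bd∧ba

    -- For a = c the outer switch disappears. For {a, c} the edge of b, conjugation by that edge
    -- turns (b d) into a switch at p b, and over all d the total is `N (p b)`.
    sum-ba∧bc : ∑⁴ (λ b d a c → 𝟙 (b ~ a) * 𝟙 (b ~ c) * F b d a c) ≡ ⟦ 4 ⟧ * S₂
    sum-ba∧bc = begin
      ∑⁴ (λ b d a c → 𝟙 (b ~ a) * 𝟙 (b ~ c) * F b d a c)
        ≡⟨ split-ba (λ b d c → 𝟙 (b ~ c)) ⟩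
      ∑ (λ b → ∑ λ d → ∑ (λ c → 𝟙 (b ~ c) * F b d b c) + ∑ (λ c → 𝟙 (b ~ c) * F b d (p b) c))
        ≡⟨ ∑-cong (λ b → ∑-cong (λ d → trans (cong₂ _+_ (∑~ b (F b d b)) (∑~ b (F b d (p b))))
             (cong₂ _+_ (cong₂ _+_ (cong w (↔-id b _)) (cong w (conj b d)))
               (cong₂ _+_ (cong w (trans (↔-comm (p b) b _) (conj b d))) (cong w (↔-id (p b) _)))))) ⟩
      ∑ (λ b → ∑ λ d → (w (b ↔ d · P) + H b d) + (H b d + w (b ↔ d · P)))
        ≡⟨ ∑-cong (λ b → trans (∑-+ (λ d → w (b ↔ d · P) + H b d) (λ d → H b d + w (b ↔ d · P)))
             (cong₂ _+_ (trans (∑-+ (λ d → w (b ↔ d · P)) (H b)) (cong (N b +_) (H≡ b)))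
               (trans (∑-+ (H b) (λ d → w (b ↔ d · P))) (trans (cong (_+ N b) (H≡ b)) (ℚₚ.+-comm (N (p b)) (N b)))))) ⟩
      ∑ (λ b → (N b + N (p b)) + (N b + N (p b)))
        ≡⟨ trans (∑-+ (λ b → N b + N (p b)) (λ b → N b + N (p b))) (cong₂ _+_ ∑N ∑N) ⟩
      (S₂ + S₂) + (S₂ + S₂) ≡⟨ quadruple S₂ ⟩
      ⟦ 4 ⟧ * S₂ ∎
      where
      H : Fin m → Fin m → ℚ
      H b d = w (p b ↔ sw b (p b) d · P)
      H≡ : ∀ b → ∑ (H b) ≡ N (p b)
      H≡ b = ∑-involution (sw-invol b (p b)) (λ d → w (p b ↔ d · P))
      conj : ∀ b d → b ↔ p b · b ↔ d · P ≡ p b ↔ sw b (p b) d · P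
      conj b d = trans (↔-edge-conj b b d) (cong (λ x → x ↔ sw b (p b) d · P) (sw-l b (p b)))

    sum-da∧dc : ∑⁴ (λ b d a c → 𝟙 (d ~ a) * 𝟙 (d ~ c) * F b d a c) ≡ ⟦ 4 ⟧ * S₂
    sum-da∧dc = trans (swap-bd (λ b d a c → 𝟙 (d ~ a) * 𝟙 (d ~ c))) sum-ba∧bc

    -- With all four vertices on one edge, each of the eight choices of d, a, c for a given b leaves
    -- P fixed.
    sum-all : ∑⁴ (λ b d a c → 𝟙 (b ~ d) * (𝟙 (b ~ a) * 𝟙 (b ~ c)) * F b d a c) ≡ ⟦ 8 ⟧ * (μ * W)
    sum-all = begin
      ∑⁴ (λ b d a c → 𝟙 (b ~ d) * (𝟙 (b ~ a) * 𝟙 (b ~ c)) * F b d a c)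
        ≡⟨ ∑⁴-cong (λ b d a c → cong (_* F b d a c) (reorder (𝟙 (b ~ d)) (𝟙 (b ~ a)) (𝟙 (b ~ c)))) ⟩
      ∑⁴ (λ b d a c → 𝟙 (b ~ a) * (𝟙 (b ~ d) * 𝟙 (b ~ c)) * F b d a c)
        ≡⟨ split-ba (λ b d c → 𝟙 (b ~ d) * 𝟙 (b ~ c)) ⟩
      ∑ (λ b → ∑ λ d → ∑ (λ c → 𝟙 (b ~ d) * 𝟙 (b ~ c) * F b d b c) + ∑ (λ c → 𝟙 (b ~ d) * 𝟙 (b ~ c) * F b d (p b) c))
        ≡⟨ ∑-cong (λ b → trans (∑-cong (λ d → trans (cong₂ _+_ (one b d b) (one b d (p b)))
              (sym (ℚₚ.*-distribˡ-+ (𝟙 (b ~ d)) (F b d b b + F b d b (p b)) (F b d (p b) b + F b d (p b) (p b))))))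
            (∑~ b (λ d → (F b d b b + F b d b (p b)) + (F b d (p b) b + F b d (p b) (p b))))) ⟩
      ∑ (λ b → ((F b b b b + F b b b (p b)) + (F b b (p b) b + F b b (p b) (p b))) +
               ((F b (p b) b b + F b (p b) b (p b)) + (F b (p b) (p b) b + F b (p b) (p b) (p b))))
        ≡⟨ ∑-cong (λ b → cong₂ _+_ (eight b b (↔-id b P)) (eight b (p b) (↔-edge b))) ⟩
      ∑ {m} (λ b → ((W + W) + (W + W)) + ((W + W) + (W + W))) ≡⟨ constant _ ⟩
      μ * (((W + W) + (W + W)) + ((W + W) + (W + W))) ≡⟨ lem μ W ⟩
      ⟦ 8 ⟧ * (μ * W) ∎
      where
      reorder : ∀ x y z → x * (y * z) ≡ y * (x * z)
      reorder = solve-∀ ℚ-ring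
      lem : ∀ x y → x * (((y + y) + (y + y)) + ((y + y) + (y + y))) ≡ ⟦ 8 ⟧ * (x * y)
      lem = solve-∀ ℚ-ring
      one : ∀ b d a → ∑ (λ c → 𝟙 (b ~ d) * 𝟙 (b ~ c) * F b d a c) ≡ 𝟙 (b ~ d) * (F b d a b + F b d a (p b))
      one b d a = trans (∑-cong (λ c → ℚₚ.*-assoc (𝟙 (b ~ d)) (𝟙 (b ~ c)) (F b d a c)))
        (trans (∑-*ˡ (𝟙 (b ~ d)) (λ c → 𝟙 (b ~ c) * F b d a c)) (cong (𝟙 (b ~ d) *_) (∑~ b (F b d a))))
      eight : ∀ b d → b ↔ d · P ≡ P → (F b d b b + F b d b (p b)) + (F b d (p b) b + F b d (p b) (p b)) ≡ (W + W) + (W + W)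
      eight b d e = cong₂ _+_ (cong₂ _+_ (cong w (trans (↔-id b _) e)) (cong w (trans (cong (b ↔ p b ·_) e) (↔-edge b))))
        (cong₂ _+_ (cong w (trans (cong (p b ↔ b ·_) e) (trans (↔-comm (p b) b P) (↔-edge b)))) (cong w (trans (↔-id (p b) _) e)))

  private
    consistent-~ : ∀ b d a c → consistent (b ~ d) (b ~ a) (b ~ c) (d ~ a) (d ~ c) (a ~ c) ≡ true
    consistent-~ b d a c = cong₂ _∧_ (~-transitive b d a) (cong₂ _∧_ (~-transitive b d c) (cong₂ _∧_ (~-transitive b a c) (~-transitive d a c)))

    coefficient : (Bool → Bool → Bool → Bool → Bool → Bool → ℚ) → Fin m → Fin m → Fin m → Fin m → ℚ
    coefficient f b d a c = f (b ~ d) (b ~ a) (b ~ c) (d ~ a) (d ~ c) (a ~ c)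

  -- In the coefficient of `S₂`, 36 collects 2 from each of the two pairings across {b, d} and {a,
  -- c}, and 2 * 4 from each of the four triples. In that of W, 8 is 4 + 2 + 2 and 48 is 6 * 8.
  double-switches : ∑⁴ (λ b d a c → 𝟙 (four-edges b d a c) * F b d a c) ≡
    S₄ - (⟦ 4 ⟧ * μ - ⟦ 36 ⟧) * S₂ - ⟦ 8 ⟧ * S₃ + (⟦ 8 ⟧ * μ * μ - ⟦ 48 ⟧ * μ) * W
  double-switches = begin
    ∑⁴ (λ b d a c → 𝟙 (four-edges b d a c) * F b d a c)
      ≡⟨ ∑⁴-cong (λ b d a c → trans (cong (_* F b d a c) (möbius (b ~ d) (b ~ a) (b ~ c) (d ~ a) (d ~ c) (a ~ c) (consistent-~ b d a c)))
           (trans (sym (Σ-*ʳ partition-terms (F b d a c) (λ t → proj₁ t * coefficient (proj₂ t) b d a c))) (Σ-cong partition-terms (λ t → ℚₚ.*-assoc (proj₁ t) (coefficient (proj₂ t) b d a c) (F b d a c))))) ⟩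
    ∑⁴ (λ b d a c → Σℚ partition-terms (λ t → proj₁ t * (coefficient (proj₂ t) b d a c * F b d a c)))
      ≡⟨ ∑⁴-Σ partition-terms (λ t b d a c → proj₁ t * (coefficient (proj₂ t) b d a c * F b d a c)) ⟩
    Σℚ partition-terms (λ t → ∑⁴ (λ b d a c → proj₁ t * (coefficient (proj₂ t) b d a c * F b d a c)))
      ≡⟨ Σ-cong partition-terms (λ t → ∑⁴-*ˡ (proj₁ t) (λ b d a c → coefficient (proj₂ t) b d a c * F b d a c)) ⟩
    Σℚ partition-terms (λ t → proj₁ t * ∑⁴ (λ b d a c → coefficient (proj₂ t) b d a c * F b d a c))
      ≡⟨ term 1ℚ (∑⁴-cong (λ b d a c → ℚₚ.*-identityˡ (F b d a c)))
          (term (- 1ℚ) sum-bd (term (- 1ℚ) sum-ac (term (- 1ℚ) sum-ba (term (- 1ℚ) sum-bc (term (- 1ℚ) sum-da (term (- 1ℚ) sum-dc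
          (term 1ℚ sum-bd∧ac (term 1ℚ sum-ba∧dc (term 1ℚ sum-bc∧da
          (term ⟦ 2 ⟧ sum-bd∧ba (term ⟦ 2 ⟧ sum-bd∧bc (term ⟦ 2 ⟧ sum-ba∧bc (term ⟦ 2 ⟧ sum-da∧dc
          (term (- ⟦ 6 ⟧) sum-all (refl {x = 0ℚ}))))))))))))))) ⟩
    _ ≡⟨ collect S₄ S₂ S₃ (μ * S₂) (μ * (μ * W)) (μ * W) ⟩
    S₄ - ⟦ 4 ⟧ * (μ * S₂) + ⟦ 36 ⟧ * S₂ - ⟦ 8 ⟧ * S₃ + ⟦ 8 ⟧ * (μ * (μ * W)) - ⟦ 48 ⟧ * (μ * W)
      ≡⟨ factor S₄ S₂ S₃ W μ ⟩
    S₄ - (⟦ 4 ⟧ * μ - ⟦ 36 ⟧) * S₂ - ⟦ 8 ⟧ * S₃ + (⟦ 8 ⟧ * μ * μ - ⟦ 48 ⟧ * μ) * W ∎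
    where
    term : ∀ k {x y r s} → x ≡ y → r ≡ s → k * x + r ≡ k * y + s
    term k refl refl = refl
    collect : ∀ s₄ s₂ s₃ μs₂ μμw μw →
      1ℚ * s₄ + (- 1ℚ * (⟦ 2 ⟧ * μs₂) + (- 1ℚ * (⟦ 2 ⟧ * μs₂) +
      (- 1ℚ * (⟦ 2 ⟧ * s₃) + (- 1ℚ * (⟦ 2 ⟧ * s₃) + (- 1ℚ * (⟦ 2 ⟧ * s₃) + (- 1ℚ * (⟦ 2 ⟧ * s₃) +
      (1ℚ * (⟦ 4 ⟧ * μμw) + (1ℚ * (⟦ 2 ⟧ * μμw + ⟦ 2 ⟧ * s₂) + (1ℚ * (⟦ 2 ⟧ * μμw + ⟦ 2 ⟧ * s₂) +
      (⟦ 2 ⟧ * (⟦ 4 ⟧ * s₂) + (⟦ 2 ⟧ * (⟦ 4 ⟧ * s₂) + (⟦ 2 ⟧ * (⟦ 4 ⟧ * s₂) + (⟦ 2 ⟧ * (⟦ 4 ⟧ * s₂) +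
      (- ⟦ 6 ⟧ * (⟦ 8 ⟧ * μw) + 0ℚ))))))))))))))
      ≡ s₄ - ⟦ 4 ⟧ * μs₂ + ⟦ 36 ⟧ * s₂ - ⟦ 8 ⟧ * s₃ + ⟦ 8 ⟧ * μμw - ⟦ 48 ⟧ * μw
    collect = solve-∀ ℚ-ring
    factor : ∀ s₄ s₂ s₃ w μ → s₄ - ⟦ 4 ⟧ * (μ * s₂) + ⟦ 36 ⟧ * s₂ - ⟦ 8 ⟧ * s₃ + ⟦ 8 ⟧ * (μ * (μ * w)) - ⟦ 48 ⟧ * (μ * w)
      ≡ s₄ - (⟦ 4 ⟧ * μ - ⟦ 36 ⟧) * s₂ - ⟦ 8 ⟧ * s₃ + (⟦ 8 ⟧ * μ * μ - ⟦ 48 ⟧ * μ) * w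
    factor = solve-∀ ℚ-ring

-- [2,2,1^j]-related matchings as double switches

-- The loop `go` inside Defs.orbitLen cannot be named from outside, so it is recovered by unification: go₁ and go₂ are
-- the loop after one and two steps, where the fuel is still tied to the size m; cong! abstracts the only position in
-- which they differ, the fuel, and matching its result against motive names the loop with all arguments free.
mutual
  go₁ : ∀ {N} (σ : Perm (suc N)) (i : Fin (suc N)) (k : ℕ) (x : Fin (suc N)) → ℕ
  go₁ σ i k x = _

  go₁-is : ∀ {N} (σ : Perm (suc N)) i → orbitLen σ i ≡ (if lookup σ i ==ᶠ i then 1 else go₁ σ i 2 (lookup σ (lookup σ i)))
  go₁-is {N} σ i with lookup σ (lookup σ i) | 2
  ... | x | k = refl

mutual
  go₂ : ∀ {N} (σ : Perm (suc (suc N))) (i : Fin (suc (suc N))) (k : ℕ) (x : Fin (suc (suc N))) → ℕ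
  go₂ σ i k x = _

  go₂-is : ∀ {N} (σ : Perm (suc (suc N))) i k x → go₁ σ i k x ≡ (if x ==ᶠ i then k else go₂ σ i (suc k) (lookup σ x))
  go₂-is {N} σ i k x with lookup σ x | suc k
  ... | y | l = refl

mutual
  go₁≡go₂ : ∀ {N N'} (σ : Perm (suc N)) (i : Fin (suc N)) (k : ℕ) (x : Fin (suc N))
    (σ' : Perm (suc (suc N'))) (i' : Fin (suc (suc N'))) (k' : ℕ) (x' : Fin (suc (suc N'))) →
    let a = _ ; b = _ in a ≡ b → a ≡ b
  go₁≡go₂ σ i k x σ' i' k' x' e = e

  go₁≡go₂-is : ∀ {N N'} (σ : Perm (suc N)) (i : Fin (suc N)) (k : ℕ) (x : Fin (suc N))
    (σ' : Perm (suc (suc N'))) (i' : Fin (suc (suc N'))) (k' : ℕ) (x' : Fin (suc (suc N'))) →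
    (∀ (a b : ℕ) → a ≡ b) → go₁ σ i k x ≡ go₂ σ' i' k' x'
  go₁≡go₂-is {N} {N'} σ i k x σ' i' k' x' h with N
  ... | _ = go₁≡go₂ σ i k x σ' i' k' x' (h _ _)

data Motive {x y : ℕ} (e : x ≡ y) (f : ℕ → ℕ) : {a b : ℕ} → a ≡ b → Set where
  motive : Motive e f (cong f e)

mutual
  go : ∀ {N} (σ : Perm (suc (suc N))) (i : Fin (suc (suc N))) (f k : ℕ) (x : Fin (suc (suc N))) → ℕ
  go σ i f k x = _

  go-is : ∀ {N} (σ : Perm (suc (suc N))) (i : Fin (suc (suc N))) (k : ℕ) (x : Fin (suc (suc N))) →
    (e : suc N ≡ N) → Motive e _ (go₁≡go₂ σ i k x σ i k x (cong! e))
  go-is σ i k x e = motive {f = λ f → go σ i f k x}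

go-≥ : ∀ {N} (σ : Perm (suc (suc N))) i f k x → k ℕ.≤ go σ i f k x
go-≥ σ i zero k x = ℕₚ.≤-refl
go-≥ σ i (suc f) k x with x ==ᶠ i
... | true = ℕₚ.≤-refl
... | false = ℕₚ.≤-trans (ℕₚ.n≤1+n k) (go-≥ σ i f (suc k) (lookup σ x))

module _ {N : ℕ} (σ : Perm (suc (suc N))) where

  -- The parts of [2,2,1^j] are 1 and 2, so all longer orbits can be treated alike.
  data Orbit (i : Fin (suc (suc N))) : Set where
    fixed : lookup σ i ≡ i → orbitLen σ i ≡ 1 → Orbit i
    pair : lookup σ i ≢ i → lookup σ (lookup σ i) ≡ i → orbitLen σ i ≡ 2 → Orbit i
    long : 3 ℕ.≤ orbitLen σ i → Orbit i

  orbit : ∀ i → Orbit i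
  orbit i with lookup σ i ==ᶠ i in e₁
  ... | true = fixed (==ᶠ⇒≡ e₁) (cong (λ b → if b then 1 else go σ i (suc N) 2 (lookup σ (lookup σ i))) e₁)
  ... | false with lookup σ (lookup σ i) ==ᶠ i in e₂
  ... | true = pair (λ e → case trans (sym e₁) (trans (cong (_==ᶠ i) e) (==ᶠ-refl i)) of λ ()) (==ᶠ⇒≡ e₂)
      (trans (cong (λ b → if b then 1 else go σ i (suc N) 2 (lookup σ (lookup σ i))) e₁)
        (cong (λ b → if b then 2 else go σ i N 3 (lookup σ (lookup σ (lookup σ i)))) e₂))
  ... | false = long (subst (3 ℕ.≤_) (sym
      (trans (cong (λ b → if b then 1 else go σ i (suc N) 2 (lookup σ (lookup σ i))) e₁)
        (cong (λ b → if b then 2 else go σ i N 3 (lookup σ (lookup σ (lookup σ i)))) e₂)))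
      (go-≥ σ i N 3 (lookup σ (lookup σ (lookup σ i)))))

∑-≡0 : ∀ {m} (f : Fin m → ℚ) → (∀ i → 0ℚ ≤ℚ f i) → ∑ f ≡ 0ℚ → ∀ i → f i ≡ 0ℚ
∑-≡0 {m} f h e i = ℚₚ.≤-antisym (subst (f i ≤ℚ_) (trans (sym (∑-def f)) e) (Σ-≥term∈ (allFin m) f (λ i _ → h i) (∈-allFin i))) (h i)

none⇒ : ∀ bd ba bc da dc ac → none bd ba bc da dc ac ≡ true →
  bd ≡ false × ba ≡ false × bc ≡ false × da ≡ false × dc ≡ false × ac ≡ false
none⇒ false false false false false false _ = refl , refl , refl , refl , refl , refl

module Relation {N : ℕ} {P Q : Perm (suc (suc N))} (MP : IsMatching P) (MQ : IsMatching Q)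
                (j : ℕ) (size : suc (suc N) ≡ 8 ℕ.+ 2 ℕ.* j) where

  m : ℕ
  m = suc (suc N)

  open Matching MP

  q : Fin m → Fin m
  q = lookup Q

  s : Fin m → Fin m
  s i = p (q i)

  s≡ : ∀ i → lookup (P ∘ₚ Q) i ≡ s i
  s≡ i = lookup-∘ P Q i

  moved : Fin m → Bool
  moved i = not (s i ==ᶠ i)

  moved⁺ : ∀ {i} → s i ≢ i → moved i ≡ true
  moved⁺ n = cong not (==ᶠ-≢ n)

  moved⁻ : ∀ {i} → moved i ≡ true → s i ≢ i
  moved⁻ {i} h e = case trans (sym h) (cong not (trans (cong (_==ᶠ i) e) (==ᶠ-refl i))) of λ ()

  unmoved⁺ : ∀ {i} → s i ≡ i → moved i ≡ false
  unmoved⁺ {i} e = cong not (trans (cong (_==ᶠ i) e) (==ᶠ-refl i))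

  unmoved⁻ : ∀ {i} → moved i ≡ false → s i ≡ i
  unmoved⁻ {i} h with s i ≟ᶠ i
  ... | yes e = e

  μ : List ℕ
  μ = 2 ∷ 2 ∷ replicate j 1

  orbits : ℕ → ℕ
  orbits k = countᵇ (λ i → orbitLen (P ∘ₚ Q) i ≡ᵇ k) (allFin m)

  count-ones : ∀ j → countᵇ (_≡ᵇ 1) (replicate j 1) ≡ j
  count-ones zero = refl
  count-ones (suc j) = cong suc (count-ones j)

  count-no-ones : ∀ k → (1 ≡ᵇ k) ≡ false → ∀ j → countᵇ (_≡ᵇ k) (replicate j 1) ≡ 0
  count-no-ones k e zero = refl
  count-no-ones k e (suc j) rewrite e = count-no-ones k e j

  ℚ-orbits : ∀ k → ℚ[ orbits k ] ≡ ∑ (λ i → 𝟙 (orbitLen (P ∘ₚ Q) i ≡ᵇ k))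
  ℚ-orbits k = sym (∑-countᵇ (λ i → orbitLen (P ∘ₚ Q) i ≡ᵇ k))

  ℚ-size : ℚ[ m ] ≡ ⟦ 8 ⟧ + ℚ[ 2 ℕ.* j ]
  ℚ-size = trans (cong ℚ[_] size) (ℚ[]-+ 8 (2 ℕ.* j))

  -- [2,2,1^j] in usable form: P Q exchanges opposite vertices on a 4-cycle of the union and fixes
  -- both ends of a common edge, and two 4-cycles have 8 vertices.
  Regular : Set
  Regular = (∀ i → s (s i) ≡ i) × ∑ (λ i → 𝟙 (moved i)) ≡ ⟦ 8 ⟧

  regular⇒related : Regular → related μ P Q ≡ true
  regular⇒related (ss , eight) = allᵇ⁺ _ (L.upTo (suc m)) λ k _ → T⇒≡ (ℕₚ.≡⇒≡ᵇ _ _ (count k))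
    where
    orbitLen≡ : ∀ i → orbitLen (P ∘ₚ Q) i ≡ (if moved i then 2 else 1)
    orbitLen≡ i with orbit (P ∘ₚ Q) i
    ... | fixed e l = trans l (cong (λ b → if b then 2 else 1) (sym (unmoved⁺ (trans (sym (s≡ i)) e))))
    ... | pair n _ l = trans l (cong (λ b → if b then 2 else 1) (sym (moved⁺ (λ e → n (trans (s≡ i) e)))))
    ... | long l = ⊥-elim (not-long (s i ≟ᶠ i))
      where
      σ = lookup (P ∘ₚ Q)
      σσ : σ (σ i) ≡ i
      σσ = trans (s≡ (σ i)) (trans (cong s (s≡ i)) (ss i))
      not-long : Dec (s i ≡ i) → ⊥
      not-long (yes e) with orbitLen (P ∘ₚ Q) i | (cong (λ b → if b then 1 else go (P ∘ₚ Q) i (suc N) 2 (σ (σ i))) (trans (cong (_==ᶠ i) (trans (s≡ i) e)) (==ᶠ-refl i)))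
      ... | _ | refl = ℕₚ.<-irrefl refl (ℕₚ.≤-trans (ℕ.s≤s (ℕ.s≤s ℕ.z≤n)) l)
      not-long (no n) with orbitLen (P ∘ₚ Q) i | (trans (cong (λ b → if b then 1 else go (P ∘ₚ Q) i (suc N) 2 (σ (σ i))) (==ᶠ-≢ (λ e → n (trans (sym (s≡ i)) e))))
                  (cong (λ b → if b then 2 else go (P ∘ₚ Q) i N 3 (σ (σ (σ i)))) (trans (cong (_==ᶠ i) σσ) (==ᶠ-refl i))))
      ... | _ | refl = ℕₚ.<-irrefl refl l
    by : ∀ k (g : Bool → ℚ) → (∀ b → 𝟙 ((if b then 2 else 1) ≡ᵇ k) ≡ g b) → ℚ[ orbits k ] ≡ ∑ (λ i → g (moved i))
    by k g h = trans (ℚ-orbits k) (∑-cong (λ i → trans (cong (λ l → 𝟙 (l ≡ᵇ k)) (orbitLen≡ i)) (h (moved i))))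
    ∑0 : ∑ {m} (λ _ → 0ℚ) ≡ 0ℚ
    ∑0 = trans (∑-const 0ℚ) (ℚₚ.*-zeroʳ ℚ[ m ])
    count : ∀ k → orbits k ≡ 2 ℕ.* k ℕ.* countᵇ (_≡ᵇ k) μ
    count 0 = ℚ[]-injective (trans (by 0 (λ _ → 0ℚ) (λ { true → refl ; false → refl })) ∑0)
    count 1 = trans (ℚ[]-injective (begin
      ℚ[ orbits 1 ]                       ≡⟨ by 1 (λ b → 1ℚ - 𝟙 b) (λ { true → refl ; false → refl }) ⟩
      ∑ (λ i → 1ℚ - 𝟙 (moved i))          ≡⟨ ∑-- (λ _ → 1ℚ) (λ i → 𝟙 (moved i)) ⟩
      ∑ {m} (λ i → 1ℚ) - ∑ (λ i → 𝟙 (moved i)) ≡⟨ cong₂ _-_ (trans (∑-const {m} 1ℚ) (cong (_* 1ℚ) ℚ-size)) eight ⟩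
      (⟦ 8 ⟧ + ℚ[ 2 ℕ.* j ]) * 1ℚ - ⟦ 8 ⟧ ≡⟨ lem ℚ[ 2 ℕ.* j ] ⟩
      ℚ[ 2 ℕ.* j ] ∎)) (cong (2 ℕ.*_) (sym (count-ones j)))
      where
      lem : ∀ x → (⟦ 8 ⟧ + x) * 1ℚ - ⟦ 8 ⟧ ≡ x
      lem = solve-∀ ℚ-ring
    count 2 = trans (ℚ[]-injective (trans (by 2 𝟙 (λ { true → refl ; false → refl })) eight))
      (cong (λ c → 4 ℕ.* (2 ℕ.+ c)) (sym (count-no-ones 2 refl j)))
    count (suc (suc (suc k))) = trans (ℚ[]-injective (trans (by (3 ℕ.+ k) (λ _ → 0ℚ) (λ { true → refl ; false → refl })) ∑0))
      (sym (trans (cong (2 ℕ.* (3 ℕ.+ k) ℕ.*_) (count-no-ones (3 ℕ.+ k) refl j)) (ℕₚ.*-zeroʳ (2 ℕ.* (3 ℕ.+ k)))))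

  -- The counts 2 j for k = 1 and 8 for k = 2 already add up to m, so no vertex remains for a longer
  -- orbit.
  related⇒regular : related μ P Q ≡ true → Regular
  related⇒regular rel = involutive , trans (∑-cong moved≡) (trans (sym (ℚ-orbits 2)) (cong ℚ[_] count2))
    where
    l : Fin m → ℕ
    l = orbitLen (P ∘ₚ Q)
    at : ∀ k → k ℕ.< suc m → orbits k ≡ 2 ℕ.* k ℕ.* countᵇ (_≡ᵇ k) μ
    at k lt = ℕₚ.≡ᵇ⇒≡ _ _ (≡⇒T (allᵇ⁻ (λ k → orbits k ≡ᵇ (2 ℕ.* k ℕ.* countᵇ (_≡ᵇ k) μ)) (L.upTo (suc m)) rel (∈-upTo⁺ lt)))
    count1 : orbits 1 ≡ 2 ℕ.* j
    count1 = trans (at 1 (ℕ.s≤s (ℕ.s≤s ℕ.z≤n))) (cong (2 ℕ.*_) (count-ones j))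
    count2 : orbits 2 ≡ 8
    count2 = trans (at 2 (ℕ.s≤s (ℕ.s≤s (ℕ.s≤s ℕ.z≤n)))) (cong (λ c → 4 ℕ.* (2 ℕ.+ c)) (count-no-ones 2 refl j))
    rest : Fin m → ℚ
    rest i = 1ℚ - 𝟙 (l i ≡ᵇ 1) - 𝟙 (l i ≡ᵇ 2)
    rest≥0 : ∀ i → 0ℚ ≤ℚ rest i
    rest≥0 i = nonneg (l i)
      where
      nonneg : ∀ n → 0ℚ ≤ℚ 1ℚ - 𝟙 (n ≡ᵇ 1) - 𝟙 (n ≡ᵇ 2)
      nonneg 0 = 0≤𝟙 true
      nonneg 1 = 0≤𝟙 false
      nonneg 2 = 0≤𝟙 false
      nonneg (suc (suc (suc n))) = 0≤𝟙 true
    ∑rest : ∑ rest ≡ 0ℚ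
    ∑rest = begin
      ∑ rest ≡⟨ trans (∑-- (λ i → 1ℚ - 𝟙 (l i ≡ᵇ 1)) (λ i → 𝟙 (l i ≡ᵇ 2))) (cong (_- ∑ (λ i → 𝟙 (l i ≡ᵇ 2))) (∑-- (λ i → 1ℚ) (λ i → 𝟙 (l i ≡ᵇ 1)))) ⟩
      ∑ {m} (λ i → 1ℚ) - ∑ (λ i → 𝟙 (l i ≡ᵇ 1)) - ∑ (λ i → 𝟙 (l i ≡ᵇ 2))
        ≡⟨ cong₂ _-_ (cong₂ _-_ (trans (∑-const {m} 1ℚ) (cong (_* 1ℚ) ℚ-size)) (trans (sym (ℚ-orbits 1)) (cong ℚ[_] count1)))
             (trans (sym (ℚ-orbits 2)) (cong ℚ[_] count2)) ⟩
      (⟦ 8 ⟧ + ℚ[ 2 ℕ.* j ]) * 1ℚ - ℚ[ 2 ℕ.* j ] - ⟦ 8 ⟧ ≡⟨ lem ℚ[ 2 ℕ.* j ] ⟩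
      0ℚ ∎
      where
      lem : ∀ x → (⟦ 8 ⟧ + x) * 1ℚ - x - ⟦ 8 ⟧ ≡ 0ℚ
      lem = solve-∀ ℚ-ring
    short : ∀ i → 3 ℕ.≤ l i → ⊥
    short i h = long≢0 (l i) h (∑-≡0 rest rest≥0 ∑rest i)
      where
      long≢0 : ∀ n → 3 ℕ.≤ n → 1ℚ - 𝟙 (n ≡ᵇ 1) - 𝟙 (n ≡ᵇ 2) ≡ 0ℚ → ⊥
      long≢0 (suc (suc (suc n))) _ ()
      long≢0 (suc (suc zero)) (ℕ.s≤s (ℕ.s≤s ())) _
      long≢0 (suc zero) (ℕ.s≤s ()) _
    involutive : ∀ i → s (s i) ≡ i
    involutive i with orbit (P ∘ₚ Q) i
    ... | fixed e _ = let si = trans (sym (s≡ i)) e in trans (cong s si) si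
    ... | pair _ e _ = trans (cong s (sym (s≡ i))) (trans (sym (s≡ _)) e)
    ... | long h = ⊥-elim (short i h)
    moved≡ : ∀ i → 𝟙 (moved i) ≡ 𝟙 (l i ≡ᵇ 2)
    moved≡ i with orbit (P ∘ₚ Q) i
    ... | fixed e h = cong 𝟙 (trans (unmoved⁺ (trans (sym (s≡ i)) e)) (cong (_≡ᵇ 2) (sym h)))
    ... | pair n _ h = cong 𝟙 (trans (moved⁺ (λ e → n (trans (s≡ i) e))) (cong (_≡ᵇ 2) (sym h)))
    ... | long h = ⊥-elim (short i h)

-- The effect of a double switch on four distinct edges

module Switch {m : ℕ} {P : Perm m} (M : IsMatching P) where

  open Matching M

  apart⇒≢ : ∀ {x y} → (x ~ y) ≡ false → y ≢ x
  apart⇒≢ {x} h refl = case trans (sym h) (~-same x) of λ ()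

  apart⇒≢p : ∀ {x y} → (x ~ y) ≡ false → y ≢ p x
  apart⇒≢p {x} h refl = case trans (sym h) (~-mate x) of λ ()

  exclude : ∀ {x y z} → (x ~ z) ≡ true → (x ~ y) ≡ false → (y ~ z) ≡ false
  exclude {x} {y} {z} xz xy = lem (x ~ y) (y ~ z) (x ~ z) (~-transitive x y z) xz xy
    where
    lem : ∀ a b c → transitiveᵇ a b c ≡ true → c ≡ true → a ≡ false → b ≡ false
    lem false false true _ _ _ = refl

  apart-sym : ∀ {x y} → (x ~ y) ≡ false → (y ~ x) ≡ false
  apart-sym {x} h = exclude (~-same x) h

  ∑𝟙~ : ∀ x → ∑ (λ i → 𝟙 (x ~ i)) ≡ ⟦ 2 ⟧
  ∑𝟙~ x = trans (∑-cong (λ i → sym (ℚₚ.*-identityʳ (𝟙 (x ~ i))))) (∑~ x (λ _ → 1ℚ))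

  module FourEdges {b d a c : Fin m} (bd : (b ~ d) ≡ false) (ba : (b ~ a) ≡ false) (bc : (b ~ c) ≡ false)
                   (da : (d ~ a) ≡ false) (dc : (d ~ c) ≡ false) (ac : (a ~ c) ≡ false) where

    data Location (i : Fin m) : Set where
      in-b : (b ~ i) ≡ true → (d ~ i) ≡ false → (a ~ i) ≡ false → (c ~ i) ≡ false → Location i
      in-d : (b ~ i) ≡ false → (d ~ i) ≡ true → (a ~ i) ≡ false → (c ~ i) ≡ false → Location i
      in-a : (b ~ i) ≡ false → (d ~ i) ≡ false → (a ~ i) ≡ true → (c ~ i) ≡ false → Location i
      in-c : (b ~ i) ≡ false → (d ~ i) ≡ false → (a ~ i) ≡ false → (c ~ i) ≡ true → Location i
      outside : (b ~ i) ≡ false → (d ~ i) ≡ false → (a ~ i) ≡ false → (c ~ i) ≡ false → Location i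

    locate : ∀ i → Location i
    locate i with b ~ i in eb
    ... | true = in-b eb (exclude eb bd) (exclude eb ba) (exclude eb bc)
    ... | false with d ~ i in ed
    ... | true = in-d eb ed (exclude ed da) (exclude ed dc)
    ... | false with a ~ i in ea
    ... | true = in-a eb ed ea (exclude ea ac)
    ... | false with c ~ i in ec
    ... | true = in-c eb ed ea ec
    ... | false = outside eb ed ea ec

    -- The four edges are disjoint, so this sum is the 0/1 indicator of their union.
    weight : Fin m → ℚ
    weight i = 𝟙 (b ~ i) + 𝟙 (d ~ i) + 𝟙 (a ~ i) + 𝟙 (c ~ i)

    ∑weight : ∑ weight ≡ ⟦ 8 ⟧
    ∑weight = trans (∑-+ (λ i → 𝟙 (b ~ i) + 𝟙 (d ~ i) + 𝟙 (a ~ i)) (λ i → 𝟙 (c ~ i)))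
      (cong₂ _+_ (trans (∑-+ (λ i → 𝟙 (b ~ i) + 𝟙 (d ~ i)) (λ i → 𝟙 (a ~ i)))
        (cong₂ _+_ (trans (∑-+ (λ i → 𝟙 (b ~ i)) (λ i → 𝟙 (d ~ i))) (cong₂ _+_ (∑𝟙~ b) (∑𝟙~ d))) (∑𝟙~ a))) (∑𝟙~ c))

    private
      R = b ↔ d · P
      module A₁ = Matching.Apart M {b} {d} (apart⇒≢ bd) (apart⇒≢p bd)
      MR : IsMatching R
      MR = ↔-matching b d M
      R-a : lookup R a ≡ p a
      R-a = A₁.at-else (apart⇒≢ ba) (apart⇒≢ da) (apart⇒≢p ba) (apart⇒≢p da)
      R-c : lookup R c ≡ p c
      R-c = A₁.at-else (apart⇒≢ bc) (apart⇒≢ dc) (apart⇒≢p bc) (apart⇒≢p dc)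
      module A₂ = Matching.Apart MR {a} {c} (apart⇒≢ ac) (λ e → apart⇒≢p ac (trans e R-a))

    result : Perm m
    result = a ↔ c · b ↔ d · P

    result-a : lookup result a ≡ p c
    result-a = trans A₂.at-a R-c
    result-c : lookup result c ≡ p a
    result-c = trans A₂.at-b R-a
    result-pa : lookup result (p a) ≡ c
    result-pa = subst (λ x → lookup result x ≡ c) R-a A₂.at-pa
    result-pc : lookup result (p c) ≡ a
    result-pc = subst (λ x → lookup result x ≡ a) R-c A₂.at-pb

    result-R : ∀ {i} → (a ~ i) ≡ false → (c ~ i) ≡ false → lookup result i ≡ lookup R i
    result-R ai ci = A₂.at-else (apart⇒≢ ai) (apart⇒≢ ci) (λ e → apart⇒≢p ai (trans e R-a)) (λ e → apart⇒≢p ci (trans e R-c))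

    ~p : ∀ x y → (x ~ y) ≡ false → (x ~ p y) ≡ false
    ~p x y h = ~-apart (λ e → apart⇒≢p h (trans (sym (inv M y)) (cong p e))) (λ e → apart⇒≢ h (p-inj e))

    result-b : lookup result b ≡ p d
    result-b = trans (result-R (apart-sym ba) (apart-sym bc)) A₁.at-a
    result-d : lookup result d ≡ p b
    result-d = trans (result-R (apart-sym da) (apart-sym dc)) A₁.at-b
    result-pb : lookup result (p b) ≡ d
    result-pb = trans (result-R (~p a b (apart-sym ba)) (~p c b (apart-sym bc))) A₁.at-pa
    result-pd : lookup result (p d) ≡ b
    result-pd = trans (result-R (~p a d (apart-sym da)) (~p c d (apart-sym dc))) A₁.at-pb

    result-outside : ∀ {i} → (b ~ i) ≡ false → (d ~ i) ≡ false → (a ~ i) ≡ false → (c ~ i) ≡ false → lookup result i ≡ p i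
    result-outside bi di ai ci = trans (result-R ai ci) (A₁.at-else (apart⇒≢ bi) (apart⇒≢ di) (apart⇒≢p bi) (apart⇒≢p di))

    s : Fin m → Fin m
    s i = p (lookup result i)

    s-a : s a ≡ c
    s-a = trans (cong p result-a) (inv M c)
    s-c : s c ≡ a
    s-c = trans (cong p result-c) (inv M a)
    s-b : s b ≡ d
    s-b = trans (cong p result-b) (inv M d)
    s-d : s d ≡ b
    s-d = trans (cong p result-d) (inv M b)

    private
      -- The map s exchanges the edges of x and y, taking x to y and `p x` to `p y`.
      record Switched (x y : Fin m) : Set where
        constructor switched
        field
          to : s x ≡ y
          to-p : s (p x) ≡ p y
          back : s y ≡ x
          back-p : s (p y) ≡ p x
          far : (x ~ y) ≡ false
      open Switched

      moves : ∀ {x y} → Switched x y → ∀ i → (x ~ i) ≡ true → s i ≢ i × s (s i) ≡ i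
      moves {x} {y} S i h with ~view x i
      ... | same refl = (λ e → apart⇒≢ (far S) (trans (sym (to S)) e)) , trans (cong s (to S)) (back S)
      ... | mate refl = (λ e → apart⇒≢ (far S) (p-inj (trans (sym (to-p S)) e))) , trans (cong s (to-p S)) (back-p S)
      ... | apart _ _ h' = case trans (sym h) h' of λ ()

      S-b : Switched b d
      S-b = switched s-b (cong p result-pb) s-d (cong p result-pd) bd
      S-d : Switched d b
      S-d = switched s-d (cong p result-pd) s-b (cong p result-pb) (apart-sym bd)
      S-a : Switched a c
      S-a = switched s-a (cong p result-pa) s-c (cong p result-pc) ac
      S-c : Switched c a
      S-c = switched s-c (cong p result-pc) s-a (cong p result-pa) (apart-sym ac)

    s-involutive : ∀ i → s (s i) ≡ i
    s-involutive i with locate i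
    ... | in-b h _ _ _ = proj₂ (moves S-b i h)
    ... | in-d _ h _ _ = proj₂ (moves S-d i h)
    ... | in-a _ _ h _ = proj₂ (moves S-a i h)
    ... | in-c _ _ _ h = proj₂ (moves S-c i h)
    ... | outside e₁ e₂ e₃ e₄ = trans (cong s si) si
      where
      si : s i ≡ i
      si = trans (cong p (result-outside e₁ e₂ e₃ e₄)) (inv M i)

    moved≡weight : ∀ i → 𝟙 (not (s i ==ᶠ i)) ≡ weight i
    moved≡weight i with locate i
    ... | in-b e₁ e₂ e₃ e₄ rewrite e₁ | e₂ | e₃ | e₄ | ==ᶠ-≢ (proj₁ (moves S-b i e₁)) = refl
    ... | in-d e₁ e₂ e₃ e₄ rewrite e₁ | e₂ | e₃ | e₄ | ==ᶠ-≢ (proj₁ (moves S-d i e₂)) = refl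
    ... | in-a e₁ e₂ e₃ e₄ rewrite e₁ | e₂ | e₃ | e₄ | ==ᶠ-≢ (proj₁ (moves S-a i e₃)) = refl
    ... | in-c e₁ e₂ e₃ e₄ rewrite e₁ | e₂ | e₃ | e₄ | ==ᶠ-≢ (proj₁ (moves S-c i e₄)) = refl
    ... | outside e₁ e₂ e₃ e₄ rewrite e₁ | e₂ | e₃ | e₄
            | trans (cong p (result-outside e₁ e₂ e₃ e₄)) (inv M i) | ==ᶠ-refl i = refl

-- Counting the double switches that reach a given matching

_==ᵥ_ : ∀ {m} → Perm m → Perm m → Bool
P ==ᵥ Q = does (Vₚ.≡-dec _≟ᶠ_ P Q)

==ᵥ-refl : ∀ {m} (P : Perm m) → (P ==ᵥ P) ≡ true
==ᵥ-refl P = dec-true (Vₚ.≡-dec _≟ᶠ_ P P) refl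

==ᵥ-≢ : ∀ {m} {P Q : Perm m} → P ≢ Q → (P ==ᵥ Q) ≡ false
==ᵥ-≢ {P = P} {Q} = dec-false (Vₚ.≡-dec _≟ᶠ_ P Q)

==ᵥ⇒≡ : ∀ {m} {P Q : Perm m} → (P ==ᵥ Q) ≡ true → P ≡ Q
==ᵥ⇒≡ {P = P} {Q} e with Vₚ.≡-dec _≟ᶠ_ P Q
... | yes h = h

module Counting {N : ℕ} {P Q : Perm (suc (suc N))} (MP : IsMatching P) (MQ : IsMatching Q)
                (j : ℕ) (size : suc (suc N) ≡ 8 ℕ.+ 2 ℕ.* j) where

  open Relation MP MQ j size
  open Matching MP
  open Switch MP

  switched : Fin m → Fin m → Fin m → Fin m → Perm m
  switched b d a c = a ↔ c · b ↔ d · P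

  indicator : Fin m → Fin m → Fin m → Fin m → ℚ
  indicator b d a c = 𝟙 (four-edges b d a c) * 𝟙 (Q ==ᵥ switched b d a c)

  indicator-0 : ∀ b d a c → (four-edges b d a c ≡ true → Q ≡ switched b d a c → ⊥) → indicator b d a c ≡ 0ℚ
  indicator-0 b d a c h with four-edges b d a c | Q ==ᵥ switched b d a c in e
  ... | false | x = ℚₚ.*-zeroˡ (𝟙 x)
  ... | true | false = refl
  ... | true | true = ⊥-elim (h refl (==ᵥ⇒≡ e))

  -- A double switch makes P Q exchange b with d and a with c, and P Q is known once Q is given.
  determined : ∀ b d a c → four-edges b d a c ≡ true → Q ≡ switched b d a c → d ≡ s b × c ≡ s a
  determined b d a c fe e with none⇒ (b ~ d) (b ~ a) (b ~ c) (d ~ a) (d ~ c) (a ~ c) fe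
  ... | bd , ba , bc , da , dc , ac =
    trans (sym E.s-b) (cong (λ Z → p (lookup Z b)) (sym e)) , trans (sym E.s-a) (cong (λ Z → p (lookup Z a)) (sym e))
    where module E = FourEdges bd ba bc da dc ac

  switched⇒regular : ∀ b d a c → four-edges b d a c ≡ true → Q ≡ switched b d a c → Regular
  switched⇒regular b d a c fe e with none⇒ (b ~ d) (b ~ a) (b ~ c) (d ~ a) (d ~ c) (a ~ c) fe
  ... | bd , ba , bc , da , dc , ac =
    (λ i → subst (λ Z → p (lookup Z (p (lookup Z i))) ≡ i) (sym e) (E.s-involutive i)) ,
    trans (∑-cong (λ i → subst (λ Z → 𝟙 (not (p (lookup Z i) ==ᶠ i)) ≡ E.weight i) (sym e) (E.moved≡weight i))) E.∑weight
    where module E = FourEdges bd ba bc da dc ac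

  module _ (reg : Regular) where

    private
      ss : ∀ i → s (s i) ≡ i
      ss = proj₁ reg

      qq : ∀ i → q (q i) ≡ i
      qq = inv MQ

      -- P and Q are involutions whose product is an involution, hence they commute.
      q-p : ∀ i → q (p i) ≡ p (q i)
      q-p i = begin
        q (p i)                  ≡⟨ cong (q ∘ p) (sym (qq i)) ⟩
        q (s (q i))              ≡⟨ sym (inv MP _) ⟩
        p (s (s (q i)))          ≡⟨ cong p (ss (q i)) ⟩
        p (q i) ∎

      s-p : ∀ i → s (p i) ≡ q i
      s-p i = trans (cong p (q-p i)) (inv MP (q i))

      p-s : ∀ i → p (s i) ≡ q i
      p-s i = inv MP (q i)

      s-inj : ∀ {x y} → s x ≡ s y → x ≡ y
      s-inj {x} {y} e = trans (sym (ss x)) (trans (cong s e) (ss y))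

      moved-p : ∀ {i} → s i ≢ i → s (p i) ≢ p i
      moved-p {i} n e = n (trans (cong p (trans (sym (s-p i)) e)) (inv MP i))

      moved-s : ∀ {i} → s i ≢ i → s (s i) ≢ s i
      moved-s {i} n e = n (s-inj e)

      moved-~ : ∀ {x i} → s x ≢ x → (x ~ i) ≡ true → moved i ≡ true
      moved-~ {x} {i} n h with ~view x i
      ... | same refl = moved⁺ n
      ... | mate refl = moved⁺ (moved-p n)
      ... | apart _ _ h' = case trans (sym h) h' of λ ()

      ~s : ∀ {x} → s x ≢ x → (x ~ s x) ≡ false
      ~s {x} n = ~-apart n (λ e → fpf MQ x (p-inj e))

      ~-transport : ∀ x y → (s x ~ y) ≡ false → (x ~ s y) ≡ false
      ~-transport x y h = ~-apart
        (λ e → apart⇒≢ h (trans (sym (ss y)) (cong s e)))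
        (λ e → apart⇒≢p h (trans (sym (ss y)) (trans (cong s e) (trans (s-p x) (sym (p-s x))))))

      ~-ss : ∀ x y → (x ~ y) ≡ false → (s x ~ s y) ≡ false
      ~-ss x y h = ~-transport (s x) y (subst (λ z → (z ~ y) ≡ false) (sym (ss x)) h)

      -- b is one of the 8 moved vertices and a one of the 4 moved vertices off the edges of b and s b; then d = s b and c = s a.
      choices : Fin m → Fin m → ℚ
      choices b a = 𝟙 (moved b) * (𝟙 (moved a) - 𝟙 (b ~ a) - 𝟙 (s b ~ a))

      module Valid {b a : Fin m} (mb : s b ≢ b) (ma : s a ≢ a) (ba : (b ~ a) ≡ false) (sba : (s b ~ a) ≡ false) where

        module E = FourEdges (~s mb) ba (~-transport b a sba) sba (~-ss b a ba) (~s ma)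

        fe : four-edges b (s b) a (s a) ≡ true
        fe rewrite ~s mb | ba | ~-transport b a sba | sba | ~-ss b a ba | ~s ma = refl

        -- Every vertex of the four edges is moved and both counts are 8, so this nonnegative
        -- function vanishes: nothing off the four edges is moved, and Q agrees with P there.
        excess : Fin m → ℚ
        excess i = 𝟙 (moved i) - E.weight i

        excess≥0 : ∀ i → 0ℚ ≤ℚ excess i
        excess≥0 i with E.locate i
        ... | E.in-b e₁ e₂ e₃ e₄ rewrite e₁ | e₂ | e₃ | e₄ | moved-~ mb e₁ = ℚₚ.≤-refl
        ... | E.in-d e₁ e₂ e₃ e₄ rewrite e₁ | e₂ | e₃ | e₄ | moved-~ (moved-s mb) e₂ = ℚₚ.≤-refl
        ... | E.in-a e₁ e₂ e₃ e₄ rewrite e₁ | e₂ | e₃ | e₄ | moved-~ ma e₃ = ℚₚ.≤-refl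
        ... | E.in-c e₁ e₂ e₃ e₄ rewrite e₁ | e₂ | e₃ | e₄ | moved-~ (moved-s ma) e₄ = ℚₚ.≤-refl
        ... | E.outside e₁ e₂ e₃ e₄ rewrite e₁ | e₂ | e₃ | e₄ = subst (0ℚ ≤ℚ_) (lem (𝟙 (moved i))) (0≤𝟙 (moved i))
          where
          lem : ∀ x → x ≡ x - (0ℚ + 0ℚ + 0ℚ + 0ℚ)
          lem = solve-∀ ℚ-ring

        excess≡0 : ∀ i → excess i ≡ 0ℚ
        excess≡0 = ∑-≡0 excess excess≥0 (trans (∑-- (λ i → 𝟙 (moved i)) E.weight) (cong₂ _-_ (proj₂ reg) E.∑weight))

        fixed-outside : ∀ i → E.weight i ≡ 0ℚ → s i ≡ i
        fixed-outside i h = unmoved⁻ (𝟙-0 (moved i) (trans (sym (ℚₚ.+-identityʳ _)) (trans (cong (λ x → 𝟙 (moved i) - x) (sym h)) (excess≡0 i))))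
          where
          𝟙-0 : ∀ b → 𝟙 b ≡ 0ℚ → b ≡ false
          𝟙-0 false _ = refl

        at : ∀ {x i} (f : Fin m → Fin m) → (x ~ i) ≡ true → q x ≡ f x → q (p x) ≡ f (p x) → q i ≡ f i
        at {x} {i} f h e e' with ~view x i
        ... | same refl = e
        ... | mate refl = e'
        ... | apart _ _ h' = case trans (sym h) h' of λ ()

        Q≡ : Q ≡ switched b (s b) a (s a)
        Q≡ = Vec-ext agree
          where
          agree : ∀ i → q i ≡ lookup E.result i
          agree i with E.locate i
          ... | E.in-b h _ _ _ = at (lookup E.result) h
                (trans (sym (p-s b)) (sym E.result-b)) (trans (q-p b) (sym E.result-pb))
          ... | E.in-d _ h _ _ = at (lookup E.result) h
                (trans (q-p (q b)) (trans (cong p (qq b)) (sym E.result-d))) (trans (cong q (p-s b)) (trans (qq b) (sym E.result-pd)))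
          ... | E.in-a _ _ h _ = at (lookup E.result) h
                (trans (sym (p-s a)) (sym E.result-a)) (trans (q-p a) (sym E.result-pa))
          ... | E.in-c _ _ _ h = at (lookup E.result) h
                (trans (q-p (q a)) (trans (cong p (qq a)) (sym E.result-c))) (trans (cong q (p-s a)) (trans (qq a) (sym E.result-pc)))
          ... | E.outside e₁ e₂ e₃ e₄ = trans (trans (sym (inv MP (q i))) (cong p (fixed-outside i weight0))) (sym (E.result-outside e₁ e₂ e₃ e₄))
            where
            weight0 : E.weight i ≡ 0ℚ
            weight0 rewrite e₁ | e₂ | e₃ | e₄ = refl

      -- If a lies on the edge of b or of s b, then a is moved as well and the subtracted indicator
      -- cancels `𝟙 (moved a)`. In the remaining case with both vertices moved, Q is the switched
      -- matching.
      indicator≡choices : ∀ b a → indicator b (s b) a (s a) ≡ choices b a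
      indicator≡choices b a = by-cases (moved b) (b ~ a) (s b ~ a) (moved a) refl refl refl refl
        where
        apart-all : four-edges b (s b) a (s a) ≡ true → _
        apart-all = none⇒ (b ~ s b) (b ~ a) (b ~ s a) (s b ~ a) (s b ~ s a) (a ~ s a)
        by-cases : ∀ x y z t → moved b ≡ x → (b ~ a) ≡ y → (s b ~ a) ≡ z → moved a ≡ t →
          indicator b (s b) a (s a) ≡ 𝟙 x * (𝟙 t - 𝟙 y - 𝟙 z)
        by-cases false y z t mb ba sba ma = trans
          (indicator-0 b (s b) a (s a) (λ fe _ → apart⇒≢ (proj₁ (apart-all fe)) (unmoved⁻ mb)))
          (sym (ℚₚ.*-zeroˡ (𝟙 t - 𝟙 y - 𝟙 z)))
        by-cases true true z t mb ba sba ma = trans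
          (indicator-0 b (s b) a (s a) (λ fe _ → case trans (sym ba) (proj₁ (proj₂ (apart-all fe))) of λ ()))
          (sym (cong₂ (λ x y → 1ℚ * (𝟙 x - 1ℚ - 𝟙 y)) (trans (sym ma) (moved-~ (moved⁻ mb) ba)) (trans (sym sba) (exclude ba (~s (moved⁻ mb))))))
        by-cases true false true t mb ba sba ma = trans
          (indicator-0 b (s b) a (s a) (λ fe _ → case trans (sym sba) (proj₁ (proj₂ (proj₂ (proj₂ (apart-all fe))))) of λ ()))
          (sym (cong (λ x → 1ℚ * (𝟙 x - 0ℚ - 1ℚ)) (trans (sym ma) (moved-~ (moved-s (moved⁻ mb)) sba))))
        by-cases true false false false mb ba sba ma =
          indicator-0 b (s b) a (s a) (λ fe _ → apart⇒≢ (proj₂ (proj₂ (proj₂ (proj₂ (proj₂ (apart-all fe)))))) (unmoved⁻ ma))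
        by-cases true false false true mb ba sba ma =
          cong₂ (λ x y → 𝟙 x * 𝟙 y) Ok.fe (subst (λ Z → (Z ==ᵥ switched b (s b) a (s a)) ≡ true) (sym Ok.Q≡) (==ᵥ-refl (switched b (s b) a (s a))))
          where module Ok = Valid (moved⁻ mb) (moved⁻ ma) ba sba

      pointwise : ∀ b d a c → indicator b d a c ≡ 𝟙 (d ==ᶠ s b) * (𝟙 (c ==ᶠ s a) * choices b a)
      pointwise b d a c = by-cases (d ≟ᶠ s b) (c ≟ᶠ s a)
        where
        by-cases : Dec (d ≡ s b) → Dec (c ≡ s a) → indicator b d a c ≡ 𝟙 (d ==ᶠ s b) * (𝟙 (c ==ᶠ s a) * choices b a)
        by-cases (no n) _ = trans (indicator-0 b d a c (λ fe e → n (proj₁ (determined b d a c fe e))))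
          (sym (trans (cong (λ x → 𝟙 x * (𝟙 (c ==ᶠ s a) * choices b a)) (==ᶠ-≢ n)) (ℚₚ.*-zeroˡ (𝟙 (c ==ᶠ s a) * choices b a))))
        by-cases (yes _) (no n) = trans (indicator-0 b d a c (λ fe e → n (proj₂ (determined b d a c fe e))))
          (sym (trans (cong (λ x → 𝟙 (d ==ᶠ s b) * (𝟙 x * choices b a)) (==ᶠ-≢ n))
            (trans (cong (𝟙 (d ==ᶠ s b) *_) (ℚₚ.*-zeroˡ (choices b a))) (ℚₚ.*-zeroʳ (𝟙 (d ==ᶠ s b))))))
        by-cases (yes refl) (yes refl) = trans (indicator≡choices b a)
          (sym (trans (cong₂ (λ x y → 𝟙 x * (𝟙 y * choices b a)) (==ᶠ-refl (s b)) (==ᶠ-refl (s a)))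
            (trans (ℚₚ.*-identityˡ (1ℚ * choices b a)) (ℚₚ.*-identityˡ (choices b a)))))

    switch-count : ∑⁴ indicator ≡ ⟦ 32 ⟧
    switch-count = begin
      ∑⁴ indicator
        ≡⟨ ∑⁴-cong pointwise ⟩
      ∑⁴ (λ b d a c → 𝟙 (d ==ᶠ s b) * (𝟙 (c ==ᶠ s a) * choices b a))
        ≡⟨ ∑-cong (λ b → trans (∑-cong (λ d → ∑∑-*ˡ (𝟙 (d ==ᶠ s b)) (λ a c → 𝟙 (c ==ᶠ s a) * choices b a)))
             (∑-δ (s b) (λ _ → ∑ λ a → ∑ λ c → 𝟙 (c ==ᶠ s a) * choices b a))) ⟩
      ∑ (λ b → ∑ λ a → ∑ λ c → 𝟙 (c ==ᶠ s a) * choices b a)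
        ≡⟨ ∑-cong (λ b → ∑-cong (λ a → ∑-δ (s a) (λ _ → choices b a))) ⟩
      ∑ (λ b → ∑ λ a → choices b a)
        ≡⟨ ∑-cong (λ b → trans (∑-*ˡ (𝟙 (moved b)) (λ a → 𝟙 (moved a) - 𝟙 (b ~ a) - 𝟙 (s b ~ a))) (cong (𝟙 (moved b) *_) (four b))) ⟩
      ∑ (λ b → 𝟙 (moved b) * ⟦ 4 ⟧)
        ≡⟨ trans (∑-*ʳ ⟦ 4 ⟧ (λ b → 𝟙 (moved b))) (cong (_* ⟦ 4 ⟧) (proj₂ reg)) ⟩
      ⟦ 32 ⟧ ∎
      where
      four : ∀ b → ∑ (λ a → 𝟙 (moved a) - 𝟙 (b ~ a) - 𝟙 (s b ~ a)) ≡ ⟦ 4 ⟧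
      four b = trans (∑-- (λ a → 𝟙 (moved a) - 𝟙 (b ~ a)) (λ a → 𝟙 (s b ~ a)))
        (cong₂ _-_ (trans (∑-- (λ a → 𝟙 (moved a)) (λ a → 𝟙 (b ~ a))) (cong₂ _-_ (proj₂ reg) (∑𝟙~ b))) (∑𝟙~ (s b)))

  count : ∑⁴ indicator ≡ ⟦ 32 ⟧ * 𝟙 (related μ P Q)
  count = by-cases (related μ P Q) refl
    where
    ∑0 : ∑ {m} (λ _ → 0ℚ) ≡ 0ℚ
    ∑0 = trans (∑-const {m} 0ℚ) (ℚₚ.*-zeroʳ ℚ[ m ])
    by-cases : ∀ x → related μ P Q ≡ x → ∑⁴ indicator ≡ ⟦ 32 ⟧ * 𝟙 x
    by-cases true e = switch-count (related⇒regular e)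
    by-cases false e = trans (∑⁴-cong (λ b d a c → indicator-0 b d a c (λ fe h →
            case trans (sym e) (regular⇒related (switched⇒regular b d a c fe h)) of λ ())))
      (trans (∑-cong (λ b → trans (∑-cong (λ d → trans (∑-cong (λ a → ∑0)) ∑0)) ∑0)) ∑0)

-- The quadruples are grouped by the matching they lead to, and `Counting.count` gives the size of
-- each group.
double-switch-sum : ∀ {N} {P : Perm (suc (suc N))} (M : IsMatching P) (j : ℕ) → suc (suc N) ≡ 8 ℕ.+ 2 ℕ.* j →
  (w : Fun (suc (suc N))) →
  ∑⁴ (λ b d a c → 𝟙 (Matching.four-edges M b d a c) * w (a ↔ c · b ↔ d · P)) ≡ ⟦ 32 ⟧ * Amul (2 ∷ 2 ∷ replicate j 1) w P
double-switch-sum {N} {P} M j size w = begin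
  ∑⁴ (λ b d a c → 𝟙 (four-edges b d a c) * w (a ↔ c · b ↔ d · P))
    ≡⟨ ∑⁴-cong (λ b d a c → cong (𝟙 (four-edges b d a c) *_) (sym (pick (↔-matching a c (↔-matching b d M))))) ⟩
  ∑⁴ (λ b d a c → 𝟙 (four-edges b d a c) * Σℚ (matchings m) (λ Q → 𝟙 (Q ==ᵥ (a ↔ c · b ↔ d · P)) * w Q))
    ≡⟨ ∑⁴-cong (λ b d a c → trans (sym (Σ-*ˡ (matchings m) (𝟙 (four-edges b d a c)) (λ Q → 𝟙 (Q ==ᵥ (a ↔ c · b ↔ d · P)) * w Q)))
         (Σ-cong (matchings m) (λ Q → reorder (𝟙 (four-edges b d a c)) (𝟙 (Q ==ᵥ (a ↔ c · b ↔ d · P))) (w Q)))) ⟩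
  ∑⁴ (λ b d a c → Σℚ (matchings m) (λ Q → w Q * (𝟙 (four-edges b d a c) * 𝟙 (Q ==ᵥ (a ↔ c · b ↔ d · P)))))
    ≡⟨ ∑⁴-Σ (matchings m) (λ Q b d a c → w Q * (𝟙 (four-edges b d a c) * 𝟙 (Q ==ᵥ (a ↔ c · b ↔ d · P)))) ⟩
  Σℚ (matchings m) (λ Q → ∑⁴ (λ b d a c → w Q * (𝟙 (four-edges b d a c) * 𝟙 (Q ==ᵥ (a ↔ c · b ↔ d · P)))))
    ≡⟨ Σ-cong∈ (matchings m) (λ Q Q∈ → trans (∑⁴-*ˡ (w Q) (λ b d a c → 𝟙 (four-edges b d a c) * 𝟙 (Q ==ᵥ (a ↔ c · b ↔ d · P))))
         (trans (cong (w Q *_) (Counting.count M (∈matchings⇒ Q∈) j size))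
           (trans (reorder' (w Q) (𝟙 (related μ P Q))) (cong (⟦ 32 ⟧ *_) (sym (if-𝟙 (related μ P Q) (w Q))))))) ⟩
  Σℚ (matchings m) (λ Q → ⟦ 32 ⟧ * (if related μ P Q then w Q else 0ℚ))
    ≡⟨ Σ-*ˡ (matchings m) ⟦ 32 ⟧ (λ Q → if related μ P Q then w Q else 0ℚ) ⟩
  ⟦ 32 ⟧ * Amul μ w P ∎
  where
  m = suc (suc N)
  μ = 2 ∷ 2 ∷ replicate j 1
  open Matching M using (four-edges)
  pick : ∀ {Q} → IsMatching Q → Σℚ (matchings m) (λ Q' → 𝟙 (Q' ==ᵥ Q) * w Q') ≡ w Q
  pick {Q} MQ = Σ-δ (_==ᵥ Q) matchings-unique (∈matchings MQ) (==ᵥ-refl Q) (λ Q' _ → ==ᵥ-≢) w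
  reorder : ∀ x y z → x * (y * z) ≡ z * (x * y)
  reorder = solve-∀ ℚ-ring
  reorder' : ∀ x y → x * (⟦ 32 ⟧ * y) ≡ ⟦ 32 ⟧ * (y * x)
  reorder' = solve-∀ ℚ-ring

-- Cells of a partition and of its double

data RowView (r k : ℕ) : Set where
  inside : k ℕ.< r → (k <ᵇ r) ≡ true → RowView r k
  below : ∀ k' → k ≡ r ℕ.+ k' → (k <ᵇ r) ≡ false → k ℕ.∸ r ≡ k' → RowView r k

rowView : ∀ r k → RowView r k
rowView zero k = below k refl refl refl
rowView (suc r) zero = inside (ℕ.s≤s ℕ.z≤n) refl
rowView (suc r) (suc k) with rowView r k
... | inside lt e = inside (ℕ.s≤s lt) e
... | below k' e e' e'' = below k' (cong suc e) e' e''

rowOf-below : ∀ r rs k' → rowOf (r ∷ rs) (r ℕ.+ k') ≡ suc (rowOf rs k')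
rowOf-below r rs k' with rowView r (r ℕ.+ k')
... | inside lt _ = ⊥-elim (ℕₚ.m+n≮m r k' lt)
... | below _ e e' e'' rewrite e' | ℕₚ.m+n∸m≡n r k' = refl

colOf-below : ∀ r rs k' → colOf (r ∷ rs) (r ℕ.+ k') ≡ colOf rs k'
colOf-below r rs k' with rowView r (r ℕ.+ k')
... | inside lt _ = ⊥-elim (ℕₚ.m+n≮m r k' lt)
... | below _ e e' e'' rewrite e' | ℕₚ.m+n∸m≡n r k' = refl

rowOf-inside : ∀ r rs {k} → k ℕ.< r → rowOf (r ∷ rs) k ≡ 0
rowOf-inside r rs {k} lt rewrite T⇒≡ (ℕₚ.<⇒<ᵇ lt) = refl

colOf-inside : ∀ r rs {k} → k ℕ.< r → colOf (r ∷ rs) k ≡ k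
colOf-inside r rs {k} lt rewrite T⇒≡ (ℕₚ.<⇒<ᵇ lt) = refl

cell-injective : ∀ ν a b → rowOf ν a ≡ rowOf ν b → colOf ν a ≡ colOf ν b → a ≡ b
cell-injective [] a b _ e = e
cell-injective (r ∷ rs) a b e e' with rowView r a | rowView r b
... | inside lt _ | inside lt' _ = trans (sym (colOf-inside r rs lt)) (trans e' (colOf-inside r rs lt'))
... | inside lt _ | below b' refl _ _ = case trans (sym (rowOf-inside r rs lt)) (trans e (rowOf-below r rs b')) of λ ()
... | below a' refl _ _ | inside lt _ = case trans (sym (rowOf-below r rs a')) (trans e (rowOf-inside r rs lt)) of λ ()
... | below a' refl _ _ | below b' refl _ _ = cong (r ℕ.+_) (cell-injective rs a' b'
      (ℕₚ.suc-injective (trans (sym (rowOf-below r rs a')) (trans e (rowOf-below r rs b'))))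
      (trans (sym (colOf-below r rs a')) (trans e' (colOf-below r rs b'))))

Decreasing-tail : ∀ r rs → Decreasing (r ∷ rs) → Decreasing rs
Decreasing-tail r [] _ = _
Decreasing-tail r (x ∷ rs) d = proj₂ d

colOf-< : ∀ r rs → Decreasing (r ∷ rs) → ∀ {b} → b ℕ.< sum (r ∷ rs) → colOf (r ∷ rs) b ℕ.< r
colOf-< r rs d {b} lt with rowView r b
... | inside h _ = subst (ℕ._< r) (sym (colOf-inside r rs h)) h
colOf-< r [] d lt | below b' refl _ _ = ⊥-elim (ℕₚ.m+n≮m r b' (subst (r ℕ.+ b' ℕ.<_) (ℕₚ.+-identityʳ r) lt))
colOf-< r (r' ∷ rs) d lt | below b' refl _ _ = subst (ℕ._< r) (sym (colOf-below r (r' ∷ rs) b'))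
  (ℕₚ.<-≤-trans (colOf-< r' rs (proj₂ d) (ℕₚ.+-cancelˡ-< r _ _ lt)) (proj₁ d))

-- If a is in the first row, the wanted cell is the one of that row whose number is the column of b;
-- the row is long enough because row lengths decrease. Otherwise both cells lie below the first
-- row.
corner-cell : ∀ ν → Decreasing ν → ∀ {a b} → b ℕ.< sum ν → rowOf ν a ℕ.< rowOf ν b →
  ∃ λ c → c ℕ.< sum ν × rowOf ν c ≡ rowOf ν a × colOf ν c ≡ colOf ν b
corner-cell (r ∷ rs) d {a} {b} lt h with rowView r a | rowView r b
... | _ | inside lt' _ = ⊥-elim (ℕₚ.n≮0 (subst (rowOf (r ∷ rs) a ℕ.<_) (rowOf-inside r rs lt') h))
... | inside lt' _ | below b' refl _ _ = c , ℕₚ.<-≤-trans c<r (ℕₚ.m≤m+n r (sum rs)) ,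
      trans (rowOf-inside r rs c<r) (sym (rowOf-inside r rs lt')) , colOf-inside r rs c<r
  where
  c = colOf (r ∷ rs) (r ℕ.+ b')
  c<r = colOf-< r rs d lt
... | below a' refl _ _ | below b' refl _ _
  with corner-cell rs (Decreasing-tail r rs d) {a'} {b'} (ℕₚ.+-cancelˡ-< r _ _ lt)
         (ℕ.s<s⁻¹ (subst₂ ℕ._<_ (rowOf-below r rs a') (rowOf-below r rs b') h))
... | c , lt' , e , e' = r ℕ.+ c , ℕₚ.+-monoʳ-< r lt' ,
      trans (rowOf-below r rs c) (trans (cong suc e) (sym (rowOf-below r rs a'))) ,
      trans (colOf-below r rs c) (trans e' (sym (colOf-below r rs b')))

isDiagram : ∀ m ν → Decreasing ν → sum ν ≡ m → Shape.IsDiagram m ν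
isDiagram m ν d e = record
  { corner = λ a b h → let c , lt , er , ec = corner-cell ν d {toℕ a} {toℕ b} (subst (toℕ b ℕ.<_) (sym e) (Fₚ.toℕ<n b)) h
                           lt' = subst (c ℕ.<_) e lt in
      F.fromℕ< lt' , trans (cong (rowOf ν) (Fₚ.toℕ-fromℕ< lt')) er , trans (cong (colOf ν) (Fₚ.toℕ-fromℕ< lt')) ec
  ; cell-inj = λ {a} {b} er ec → Fₚ.toℕ-injective (cell-injective ν (toℕ a) (toℕ b) er ec) }

double-decreasing : ∀ ν → Decreasing ν → Decreasing (double ν)
double-decreasing [] d = _
double-decreasing (x ∷ []) d = _
double-decreasing (x ∷ y ∷ xs) (h , d) = ℕₚ.*-monoʳ-≤ 2 h , double-decreasing (y ∷ xs) d

sum-double : ∀ ν → sum (double ν) ≡ 2 ℕ.* sum ν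
sum-double [] = refl
sum-double (x ∷ ν) = trans (cong (2 ℕ.* x ℕ.+_) (sum-double ν)) (sym (ℕₚ.*-distribˡ-+ 2 x (sum ν)))

half-< : ∀ (e : Bool) {a r} → a ℕ.< r → (if e then 1 else 0) ℕ.+ 2 ℕ.* a ℕ.< 2 ℕ.* r
half-< e {a} {r} lt = ℕₚ.<-≤-trans (ℕₚ.+-monoˡ-< (2 ℕ.* a) (bit<2 e))
  (ℕₚ.≤-trans (ℕₚ.≤-reflexive (sym (ℕₚ.*-suc 2 a))) (ℕₚ.*-monoʳ-≤ 2 lt))
  where
  bit<2 : ∀ e → (if e then 1 else 0) ℕ.< 2
  bit<2 true = ℕ.s≤s (ℕ.s≤s ℕ.z≤n)
  bit<2 false = ℕ.s≤s ℕ.z≤n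

bit : Bool → ℕ
bit e = if e then 1 else 0

half-below : ∀ e r a → bit e ℕ.+ 2 ℕ.* (r ℕ.+ a) ≡ 2 ℕ.* r ℕ.+ (bit e ℕ.+ 2 ℕ.* a)
half-below e r a = begin
  bit e ℕ.+ 2 ℕ.* (r ℕ.+ a)          ≡⟨ cong (bit e ℕ.+_) (ℕₚ.*-distribˡ-+ 2 r a) ⟩
  bit e ℕ.+ (2 ℕ.* r ℕ.+ 2 ℕ.* a)    ≡⟨ sym (ℕₚ.+-assoc (bit e) (2 ℕ.* r) (2 ℕ.* a)) ⟩
  (bit e ℕ.+ 2 ℕ.* r) ℕ.+ 2 ℕ.* a    ≡⟨ cong (ℕ._+ 2 ℕ.* a) (ℕₚ.+-comm (bit e) (2 ℕ.* r)) ⟩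
  (2 ℕ.* r ℕ.+ bit e) ℕ.+ 2 ℕ.* a    ≡⟨ ℕₚ.+-assoc (2 ℕ.* r) (bit e) (2 ℕ.* a) ⟩
  2 ℕ.* r ℕ.+ (bit e ℕ.+ 2 ℕ.* a) ∎

-- All earlier rows are doubled too, so cell a becomes the two neighbours 2 a and 2 a + 1 of the
-- same row, and `e` selects one of them.
rowOf-double : ∀ ν e a → rowOf (double ν) (bit e ℕ.+ 2 ℕ.* a) ≡ rowOf ν a
rowOf-double [] e a = refl
rowOf-double (r ∷ rs) e a with rowView r a
... | inside lt _ = trans (rowOf-inside (2 ℕ.* r) (double rs) (half-< e lt)) (sym (rowOf-inside r rs lt))
... | below a' refl _ _ = begin
  rowOf (double (r ∷ rs)) (bit e ℕ.+ 2 ℕ.* (r ℕ.+ a')) ≡⟨ cong (rowOf (double (r ∷ rs))) (half-below e r a') ⟩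
  rowOf (double (r ∷ rs)) (2 ℕ.* r ℕ.+ (bit e ℕ.+ 2 ℕ.* a')) ≡⟨ rowOf-below (2 ℕ.* r) (double rs) _ ⟩
  suc (rowOf (double rs) (bit e ℕ.+ 2 ℕ.* a')) ≡⟨ cong suc (rowOf-double rs e a') ⟩
  suc (rowOf rs a') ≡⟨ sym (rowOf-below r rs a') ⟩
  rowOf (r ∷ rs) (r ℕ.+ a') ∎

colOf-double : ∀ ν e a → colOf (double ν) (bit e ℕ.+ 2 ℕ.* a) ≡ bit e ℕ.+ 2 ℕ.* colOf ν a
colOf-double [] e a = refl
colOf-double (r ∷ rs) e a with rowView r a
... | inside lt _ = trans (colOf-inside (2 ℕ.* r) (double rs) (half-< e lt)) (cong (λ x → bit e ℕ.+ 2 ℕ.* x) (sym (colOf-inside r rs lt)))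
... | below a' refl _ _ = begin
  colOf (double (r ∷ rs)) (bit e ℕ.+ 2 ℕ.* (r ℕ.+ a')) ≡⟨ cong (colOf (double (r ∷ rs))) (half-below e r a') ⟩
  colOf (double (r ∷ rs)) (2 ℕ.* r ℕ.+ (bit e ℕ.+ 2 ℕ.* a')) ≡⟨ colOf-below (2 ℕ.* r) (double rs) _ ⟩
  colOf (double rs) (bit e ℕ.+ 2 ℕ.* a') ≡⟨ colOf-double rs e a' ⟩
  bit e ℕ.+ 2 ℕ.* colOf rs a' ≡⟨ cong (λ x → bit e ℕ.+ 2 ℕ.* x) (sym (colOf-below r rs a')) ⟩
  bit e ℕ.+ 2 ℕ.* colOf (r ∷ rs) (r ℕ.+ a') ∎

≡ᵇ-cong : ∀ {a b c d : ℕ} → (a ≡ b → c ≡ d) → (c ≡ d → a ≡ b) → (a ≡ᵇ b) ≡ (c ≡ᵇ d)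
≡ᵇ-cong {a} {b} {c} {d} f g with a ≡ᵇ b in e | c ≡ᵇ d in e'
... | true | true = refl
... | false | false = refl
... | true | false = case trans (sym e') (T⇒≡ (ℕₚ.≡⇒≡ᵇ c d (f (ℕₚ.≡ᵇ⇒≡ a b (≡⇒T e))))) of λ ()
... | false | true = case trans (sym e) (T⇒≡ (ℕₚ.≡⇒≡ᵇ a b (g (ℕₚ.≡ᵇ⇒≡ c d (≡⇒T e'))))) of λ ()

half-≡ᵇ-same : ∀ e a b → ((bit e ℕ.+ 2 ℕ.* a) ≡ᵇ (bit e ℕ.+ 2 ℕ.* b)) ≡ (a ≡ᵇ b)
half-≡ᵇ-same e a b = ≡ᵇ-cong (λ h → ℕₚ.*-cancelˡ-≡ a b 2 (ℕₚ.+-cancelˡ-≡ (bit e) _ _ h)) (cong (λ x → bit e ℕ.+ 2 ℕ.* x))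

even-bit : ∀ e a → even (bit e ℕ.+ 2 ℕ.* a) ≡ not e
even-bit e zero = trans (cong even (ℕₚ.+-identityʳ (bit e))) (lem e)
  where
  lem : ∀ e → even (bit e) ≡ not e
  lem true = refl
  lem false = refl
even-bit e (suc a) = trans (cong even (trans (cong (bit e ℕ.+_) (ℕₚ.*-suc 2 a)) (trans (ℕₚ.+-suc (bit e) _) (cong suc (ℕₚ.+-suc (bit e) _))))) (even-bit e a)

half-≡ᵇ-diff : ∀ {e f} → e ≢ f → ∀ a b → ((bit e ℕ.+ 2 ℕ.* a) ≡ᵇ (bit f ℕ.+ 2 ℕ.* b)) ≡ false
half-≡ᵇ-diff {e} {f} n a b with (bit e ℕ.+ 2 ℕ.* a) ≡ᵇ (bit f ℕ.+ 2 ℕ.* b) in h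
... | false = refl
... | true = ⊥-elim (n (not-injective (trans (sym (even-bit e a)) (trans (cong even (ℕₚ.≡ᵇ⇒≡ (bit e ℕ.+ 2 ℕ.* a) (bit f ℕ.+ 2 ℕ.* b) (≡⇒T h))) (even-bit f b)))))

-- Row and column counts of the doubled diagram

rℕ kℕ : List ℕ → ℕ → ℕ → ℚ
rℕ ν a b = 𝟙 (rowOf ν a ≡ᵇ rowOf ν b)
kℕ ν a b = 𝟙 (colOf ν a ≡ᵇ colOf ν b) * 𝟙 (not (a ≡ᵇ b))

r≡ : ∀ m ν (a b : Fin m) → Shape.r m ν a b ≡ rℕ ν (toℕ a) (toℕ b)
r≡ m ν a b = Shape.r-def m ν a b

k≡ : ∀ m ν (a b : Fin m) → Shape.k m ν a b ≡ kℕ ν (toℕ a) (toℕ b)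
k≡ m ν a b = trans (Shape.k-def m ν a b) (cong (λ x → 𝟙 (colOf ν (toℕ a) ≡ᵇ colOf ν (toℕ b)) * 𝟙 (not x)) eq)
  where
  eq : (a ==ᶠ b) ≡ (toℕ a ≡ᵇ toℕ b)
  eq with a ≟ᶠ b
  ... | yes refl = sym (T⇒≡ (ℕₚ.≡⇒≡ᵇ (toℕ a) (toℕ a) refl))
  ... | no n with toℕ a ≡ᵇ toℕ b in h
  ...   | false = refl
  ...   | true = ⊥-elim (n (Fₚ.toℕ-injective (ℕₚ.≡ᵇ⇒≡ _ _ (≡⇒T h))))

rℕ-double : ∀ ν e f a b → rℕ (double ν) (bit e ℕ.+ 2 ℕ.* a) (bit f ℕ.+ 2 ℕ.* b) ≡ rℕ ν a b
rℕ-double ν e f a b = cong₂ (λ x y → 𝟙 (x ≡ᵇ y)) (rowOf-double ν e a) (rowOf-double ν f b)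

kℕ-same : ∀ ν e a b → kℕ (double ν) (bit e ℕ.+ 2 ℕ.* a) (bit e ℕ.+ 2 ℕ.* b) ≡ kℕ ν a b
kℕ-same ν e a b = cong₂ (λ x y → 𝟙 x * 𝟙 (not y))
  (trans (cong₂ _≡ᵇ_ (colOf-double ν e a) (colOf-double ν e b)) (half-≡ᵇ-same e (colOf ν a) (colOf ν b))) (half-≡ᵇ-same e a b)

kℕ-diff : ∀ ν {e f} → e ≢ f → ∀ a b → kℕ (double ν) (bit e ℕ.+ 2 ℕ.* a) (bit f ℕ.+ 2 ℕ.* b) ≡ 0ℚ
kℕ-diff ν {e} {f} n a b = trans (cong (λ x → 𝟙 x * 𝟙 (not ((bit e ℕ.+ 2 ℕ.* a) ≡ᵇ (bit f ℕ.+ 2 ℕ.* b))))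
  (trans (cong₂ _≡ᵇ_ (colOf-double ν e a) (colOf-double ν f b)) (half-≡ᵇ-diff n (colOf ν a) (colOf ν b)))) (ℚₚ.*-zeroˡ (𝟙 (not ((bit e ℕ.+ 2 ℕ.* a) ≡ᵇ (bit f ℕ.+ 2 ℕ.* b)))))

∑-suc : ∀ {m} (f : ℕ → ℚ) → ∑ {suc m} (λ i → f (toℕ i)) ≡ f 0 + ∑ {m} (λ i → f (suc (toℕ i)))
∑-suc {m} f = trans (∑-def {suc m} (λ i → f (toℕ i))) (cong (f 0 +_)
  (trans (cong (λ l → Σℚ l (λ i → f (toℕ i))) (sym (Lₚ.map-tabulate {n = m} id F.suc)))
    (trans (Σ-map F.suc (allFin m) (λ i → f (toℕ i))) (sym (∑-def {m} (λ i → f (suc (toℕ i))))))))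

∑-zero : (f : Fin 0 → ℚ) → ∑ f ≡ 0ℚ
∑-zero f = ∑-def f

∑-double : ∀ n (f : ℕ → ℚ) → ∑ {2 ℕ.* n} (λ i → f (toℕ i)) ≡ ∑ {n} (λ i → f (2 ℕ.* toℕ i) + f (1 ℕ.+ 2 ℕ.* toℕ i))
∑-double zero f = trans (∑-zero (λ i → f (toℕ i))) (sym (∑-zero (λ i → f (2 ℕ.* toℕ i) + f (1 ℕ.+ 2 ℕ.* toℕ i))))
∑-double (suc n) f = begin
  ∑ {2 ℕ.* suc n} (λ i → f (toℕ i))             ≡⟨ cong (λ k → ∑ {k} (λ i → f (toℕ i))) (ℕₚ.*-suc 2 n) ⟩
  ∑ {2 ℕ.+ 2 ℕ.* n} (λ i → f (toℕ i))           ≡⟨ trans (∑-suc f) (cong (f 0 +_) (∑-suc (λ i → f (suc i)))) ⟩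
  f 0 + (f 1 + ∑ {2 ℕ.* n} (λ i → f (2 ℕ.+ toℕ i))) ≡⟨ cong (λ x → f 0 + (f 1 + x)) (∑-double n (λ i → f (2 ℕ.+ i))) ⟩
  f 0 + (f 1 + ∑ {n} (λ i → f (2 ℕ.+ 2 ℕ.* toℕ i) + f (3 ℕ.+ 2 ℕ.* toℕ i)))
    ≡⟨ sym (ℚₚ.+-assoc (f 0) (f 1) _) ⟩
  (f 0 + f 1) + ∑ {n} (λ i → f (2 ℕ.+ 2 ℕ.* toℕ i) + f (3 ℕ.+ 2 ℕ.* toℕ i))
    ≡⟨ cong ((f 0 + f 1) +_) (∑-cong (λ i → cong (λ x → f x + f (suc x)) (sym (ℕₚ.*-suc 2 (toℕ i))))) ⟩
  (f 0 + f 1) + ∑ {n} (λ i → f (2 ℕ.* suc (toℕ i)) + f (1 ℕ.+ 2 ℕ.* suc (toℕ i)))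
    ≡⟨ sym (∑-suc (λ i → f (2 ℕ.* i) + f (1 ℕ.+ 2 ℕ.* i))) ⟩
  ∑ {suc n} (λ i → f (2 ℕ.* toℕ i) + f (1 ℕ.+ 2 ℕ.* toℕ i)) ∎

halves : (ℕ → ℚ) → ℕ → ℚ
halves f a = f (2 ℕ.* a) + f (1 ℕ.+ 2 ℕ.* a)

∑²-double : ∀ n (f : ℕ → ℕ → ℚ) → ∑ {2 ℕ.* n} (λ a → ∑ {2 ℕ.* n} (λ b → f (toℕ a) (toℕ b))) ≡
  ∑ {n} (λ a → ∑ {n} (λ b → halves (λ x → halves (f x) (toℕ b)) (toℕ a)))
∑²-double n f = trans (∑-cong (λ a → ∑-double n (f (toℕ a))))
  (trans (∑-double n (λ x → ∑ {n} (λ b → halves (f x) (toℕ b))))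
    (∑-cong (λ a → sym (∑-+ (λ b → halves (f (2 ℕ.* toℕ a)) (toℕ b)) (λ b → halves (f (1 ℕ.+ 2 ℕ.* toℕ a)) (toℕ b))))))

∑³-double : ∀ n (f : ℕ → ℕ → ℕ → ℚ) → ∑ {2 ℕ.* n} (λ a → ∑ {2 ℕ.* n} (λ b → ∑ {2 ℕ.* n} (λ c → f (toℕ a) (toℕ b) (toℕ c)))) ≡
  ∑ {n} (λ a → ∑ {n} (λ b → ∑ {n} (λ c → halves (λ x → halves (λ y → halves (f x y) (toℕ c)) (toℕ b)) (toℕ a))))
∑³-double n f = trans (∑-cong (λ a → ∑²-double n (f (toℕ a))))
  (trans (∑-double n (λ x → ∑ {n} (λ b → ∑ {n} (λ c → halves (λ y → halves (f x y) (toℕ c)) (toℕ b)))))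
    (∑-cong (λ a → trans (sym (∑-+ (g (2 ℕ.* toℕ a)) (g (1 ℕ.+ 2 ℕ.* toℕ a)))) (∑-cong (λ b →
      sym (∑-+ (λ c → halves (λ y → halves (f (2 ℕ.* toℕ a) y) (toℕ c)) (toℕ b)) (λ c → halves (λ y → halves (f (1 ℕ.+ 2 ℕ.* toℕ a) y) (toℕ c)) (toℕ b))))))))
  where
  g : ℕ → Fin n → ℚ
  g x b = ∑ {n} (λ c → halves (λ y → halves (f x y) (toℕ c)) (toℕ b))

t≢f : true ≢ false
t≢f ()

f≢t : false ≢ true
f≢t ()

-- Sharing a row ignores which half of a cell is taken, sharing a column forces equal halves. The
-- factors count the free choices of halves: 4 and 8 for pairs and triples in a row, 2 for a column,
-- and 4 for a hook, whose two column cells use the same half.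
module Doubling (n : ℕ) (ν : List ℕ) (D₁ : Shape.IsDiagram n ν) (D₂ : Shape.IsDiagram (2 ℕ.* n) (double ν)) where

  module H = Diagram n ν D₁
  module F₂ = Diagram (2 ℕ.* n) (double ν) D₂
  module S₁ = Shape n ν
  module S₂ = Shape (2 ℕ.* n) (double ν)

  private
    ρ κ : ℕ → ℕ → ℚ
    ρ = rℕ (double ν)
    κ = kℕ (double ν)

    r-to : ∀ (a b : Fin n) → rℕ ν (toℕ a) (toℕ b) ≡ S₁.r a b
    r-to a b = sym (r≡ n ν a b)
    k-to : ∀ (a b : Fin n) → kℕ ν (toℕ a) (toℕ b) ≡ S₁.k a b
    k-to a b = sym (k≡ n ν a b)

    ρ-to : ∀ e f (a b : Fin n) → ρ (bit e ℕ.+ 2 ℕ.* toℕ a) (bit f ℕ.+ 2 ℕ.* toℕ b) ≡ S₁.r a b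
    ρ-to e f a b = trans (rℕ-double ν e f (toℕ a) (toℕ b)) (r-to a b)
    κ-same : ∀ e (a b : Fin n) → κ (bit e ℕ.+ 2 ℕ.* toℕ a) (bit e ℕ.+ 2 ℕ.* toℕ b) ≡ S₁.k a b
    κ-same e a b = trans (kℕ-same ν e (toℕ a) (toℕ b)) (k-to a b)
    κ-tf : ∀ (a b : Fin n) → κ (1 ℕ.+ 2 ℕ.* toℕ a) (2 ℕ.* toℕ b) ≡ 0ℚ
    κ-tf a b = kℕ-diff ν t≢f (toℕ a) (toℕ b)
    κ-ft : ∀ (a b : Fin n) → κ (2 ℕ.* toℕ a) (1 ℕ.+ 2 ℕ.* toℕ b) ≡ 0ℚ
    κ-ft a b = kℕ-diff ν f≢t (toℕ a) (toℕ b)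

  row₂-double : F₂.row₂ ≡ ⟦ 4 ⟧ * H.row₂
  row₂-double = begin
    F₂.row₂ ≡⟨ ∑-cong (λ a → ∑-cong (λ b → r≡ (2 ℕ.* n) (double ν) a b)) ⟩
    ∑ (λ a → ∑ (λ b → ρ (toℕ a) (toℕ b))) ≡⟨ ∑²-double n ρ ⟩
    ∑ (λ a → ∑ (λ b → halves (λ x → halves (ρ x) (toℕ b)) (toℕ a)))
      ≡⟨ ∑-cong (λ a → ∑-cong (λ b → trans (cong₂ _+_ (cong₂ _+_ (ρ-to false false a b) (ρ-to false true a b))
           (cong₂ _+_ (ρ-to true false a b) (ρ-to true true a b))) (lem (S₁.r a b)))) ⟩
    ∑ (λ a → ∑ (λ b → ⟦ 4 ⟧ * S₁.r a b)) ≡⟨ ∑∑-*ˡ ⟦ 4 ⟧ S₁.r ⟩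
    ⟦ 4 ⟧ * H.row₂ ∎
    where
    lem : ∀ x → (x + x) + (x + x) ≡ ⟦ 4 ⟧ * x
    lem = solve-∀ ℚ-ring

  col₂-double : F₂.col₂ ≡ ⟦ 2 ⟧ * H.col₂
  col₂-double = begin
    F₂.col₂ ≡⟨ ∑-cong (λ a → ∑-cong (λ b → k≡ (2 ℕ.* n) (double ν) a b)) ⟩
    ∑ (λ a → ∑ (λ b → κ (toℕ a) (toℕ b))) ≡⟨ ∑²-double n κ ⟩
    ∑ (λ a → ∑ (λ b → halves (λ x → halves (κ x) (toℕ b)) (toℕ a)))
      ≡⟨ ∑-cong (λ a → ∑-cong (λ b → trans (cong₂ _+_ (cong₂ _+_ (κ-same false a b) (κ-ft a b))
           (cong₂ _+_ (κ-tf a b) (κ-same true a b))) (lem (S₁.k a b)))) ⟩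
    ∑ (λ a → ∑ (λ b → ⟦ 2 ⟧ * S₁.k a b)) ≡⟨ ∑∑-*ˡ ⟦ 2 ⟧ S₁.k ⟩
    ⟦ 2 ⟧ * H.col₂ ∎
    where
    lem : ∀ x → (x + 0ℚ) + (0ℚ + x) ≡ ⟦ 2 ⟧ * x
    lem = solve-∀ ℚ-ring

  private
    eight : ∀ {f : ℕ → ℕ → ℕ → ℚ} {g : Bool → Bool → Bool → ℚ} a b c →
      (∀ e₁ e₂ e₃ → f (bit e₁ ℕ.+ 2 ℕ.* a) (bit e₂ ℕ.+ 2 ℕ.* b) (bit e₃ ℕ.+ 2 ℕ.* c) ≡ g e₁ e₂ e₃) →
      halves (λ x → halves (λ y → halves (f x y) c) b) a ≡
      ((g false false false + g false false true) + (g false true false + g false true true)) +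
      ((g true false false + g true false true) + (g true true false + g true true true))
    eight a b c h = cong₂ _+_
      (cong₂ _+_ (cong₂ _+_ (h false false false) (h false false true)) (cong₂ _+_ (h false true false) (h false true true)))
      (cong₂ _+_ (cong₂ _+_ (h true false false) (h true false true)) (cong₂ _+_ (h true true false) (h true true true)))

    κ-to : Bool → Bool → Fin n → Fin n → ℚ
    κ-to true true a b = S₁.k a b
    κ-to false false a b = S₁.k a b
    κ-to true false a b = 0ℚ
    κ-to false true a b = 0ℚ

    κ-value : ∀ e f (a b : Fin n) → κ (bit e ℕ.+ 2 ℕ.* toℕ a) (bit f ℕ.+ 2 ℕ.* toℕ b) ≡ κ-to e f a b
    κ-value true true a b = κ-same true a b
    κ-value false false a b = κ-same false a b
    κ-value true false a b = κ-tf a b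
    κ-value false true a b = κ-ft a b

  row₃-double : F₂.row₃ ≡ ⟦ 8 ⟧ * H.row₃
  row₃-double = begin
    F₂.row₃ ≡⟨ ∑³-cong (λ a b c → cong₂ _*_ (r≡ (2 ℕ.* n) (double ν) a b) (r≡ (2 ℕ.* n) (double ν) b c)) ⟩
    ∑ (λ a → ∑ (λ b → ∑ (λ c → ρ (toℕ a) (toℕ b) * ρ (toℕ b) (toℕ c)))) ≡⟨ ∑³-double n (λ a b c → ρ a b * ρ b c) ⟩
    _ ≡⟨ ∑³-cong (λ a b c → trans (eight {f = λ a b c → ρ a b * ρ b c} {g = λ _ _ _ → S₁.r a b * S₁.r b c} (toℕ a) (toℕ b) (toℕ c)
           (λ e₁ e₂ e₃ → cong₂ _*_ (ρ-to e₁ e₂ a b) (ρ-to e₂ e₃ b c))) (lem (S₁.r a b * S₁.r b c))) ⟩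
    ∑ (λ a → ∑ (λ b → ∑ (λ c → ⟦ 8 ⟧ * (S₁.r a b * S₁.r b c)))) ≡⟨ ∑³-*ˡ ⟦ 8 ⟧ (λ a b c → S₁.r a b * S₁.r b c) ⟩
    ⟦ 8 ⟧ * H.row₃ ∎
    where
    lem : ∀ x → ((x + x) + (x + x)) + ((x + x) + (x + x)) ≡ ⟦ 8 ⟧ * x
    lem = solve-∀ ℚ-ring

  col₃-double : F₂.col₃ ≡ ⟦ 2 ⟧ * H.col₃
  col₃-double = begin
    F₂.col₃ ≡⟨ ∑³-cong (λ a b c → cong₂ _*_ (cong₂ _*_ (k≡ (2 ℕ.* n) (double ν) a b) (k≡ (2 ℕ.* n) (double ν) b c)) (k≡ (2 ℕ.* n) (double ν) c a)) ⟩
    ∑ (λ a → ∑ (λ b → ∑ (λ c → κ (toℕ a) (toℕ b) * κ (toℕ b) (toℕ c) * κ (toℕ c) (toℕ a)))) ≡⟨ ∑³-double n (λ a b c → κ a b * κ b c * κ c a) ⟩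
    _ ≡⟨ ∑³-cong (λ a b c → trans (eight {f = λ a b c → κ a b * κ b c * κ c a} {g = λ e₁ e₂ e₃ → κ-to e₁ e₂ a b * κ-to e₂ e₃ b c * κ-to e₃ e₁ c a}
           (toℕ a) (toℕ b) (toℕ c) (λ e₁ e₂ e₃ → cong₂ _*_ (cong₂ _*_ (κ-value e₁ e₂ a b) (κ-value e₂ e₃ b c)) (κ-value e₃ e₁ c a)))
           (lem (S₁.k a b) (S₁.k b c) (S₁.k c a))) ⟩
    ∑ (λ a → ∑ (λ b → ∑ (λ c → ⟦ 2 ⟧ * (S₁.k a b * S₁.k b c * S₁.k c a)))) ≡⟨ ∑³-*ˡ ⟦ 2 ⟧ (λ a b c → S₁.k a b * S₁.k b c * S₁.k c a) ⟩
    ⟦ 2 ⟧ * H.col₃ ∎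
    where
    lem : ∀ x y z → ((x * y * z + x * 0ℚ * 0ℚ) + (0ℚ * 0ℚ * z + 0ℚ * y * 0ℚ)) + ((0ℚ * y * 0ℚ + 0ℚ * 0ℚ * z) + (x * 0ℚ * 0ℚ + x * y * z)) ≡ ⟦ 2 ⟧ * (x * y * z)
    lem = solve-∀ ℚ-ring

  hook-double : F₂.hook ≡ ⟦ 4 ⟧ * H.hook
  hook-double = begin
    F₂.hook ≡⟨ ∑³-cong (λ a b c → cong₂ _*_ (r≡ (2 ℕ.* n) (double ν) a b) (k≡ (2 ℕ.* n) (double ν) b c)) ⟩
    ∑ (λ a → ∑ (λ b → ∑ (λ c → ρ (toℕ a) (toℕ b) * κ (toℕ b) (toℕ c)))) ≡⟨ ∑³-double n (λ a b c → ρ a b * κ b c) ⟩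
    _ ≡⟨ ∑³-cong (λ a b c → trans (eight {f = λ a b c → ρ a b * κ b c} {g = λ e₁ e₂ e₃ → S₁.r a b * κ-to e₂ e₃ b c} (toℕ a) (toℕ b) (toℕ c)
           (λ e₁ e₂ e₃ → cong₂ _*_ (ρ-to e₁ e₂ a b) (κ-value e₂ e₃ b c))) (lem (S₁.r a b) (S₁.k b c))) ⟩
    ∑ (λ a → ∑ (λ b → ∑ (λ c → ⟦ 4 ⟧ * (S₁.r a b * S₁.k b c)))) ≡⟨ ∑³-*ˡ ⟦ 4 ⟧ (λ a b c → S₁.r a b * S₁.k b c) ⟩
    ⟦ 4 ⟧ * H.hook ∎
    where
    lem : ∀ x y → ((x * y + x * 0ℚ) + (x * 0ℚ + x * y)) + ((x * y + x * 0ℚ) + (x * 0ℚ + x * y)) ≡ ⟦ 4 ⟧ * (x * y)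
    lem = solve-∀ ℚ-ring

-- The eigenvalue as a polynomial in the counts of cells

module Eigenvalue (j : ℕ) (ν : List ℕ) (ν⊢ : ν ⊢ (4 ℕ.+ j)) where

  n : ℕ
  n = 4 ℕ.+ j

  D₁ : Shape.IsDiagram n ν
  D₁ = isDiagram n ν (proj₁ ν⊢) (proj₂ (proj₂ ν⊢))

  D₂ : Shape.IsDiagram (2 ℕ.* n) (double ν)
  D₂ = isDiagram (2 ℕ.* n) (double ν) (double-decreasing ν (proj₁ ν⊢)) (trans (sum-double ν) (cong (2 ℕ.*_) (proj₂ (proj₂ ν⊢))))

  open Doubling n ν D₁ D₂

  -- On the component of the doubled shape the pair sum acts by 2 y and the triple sum by q + 4 n² -
  -- 2 y.
  y q : ℚ
  y = ⟦ 2 ⟧ * H.row₂ - H.col₂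
  q = ⟦ 8 ⟧ * H.row₃ + ⟦ 2 ⟧ * H.col₃ - ⟦ 12 ⟧ * H.hook

  -- The scalar of 8 A: the formula for 32 A in terms of `S₂`, `S₃` and `S₄`, divided by 4. The
  -- square of y comes from `S₄`, on which the pair sum acts twice.
  eightfold : ℚ
  eightfold = y * y - (⟦ 4 ⟧ * ℚ[ n ] - ⟦ 22 ⟧) * y - ⟦ 2 ⟧ * q - ⟦ 24 ⟧ * ℚ[ n ]

  Amul-scalar : (w : Fun (2 ℕ.* n)) → InIsotypic (2 ℕ.* n) (double ν) w → ∀ {P} → P ∈ matchings (2 ℕ.* n) →
    ⟦ 8 ⟧ * Amul (2 ∷ 2 ∷ replicate j 1) w P ≡ eightfold * w P
  Amul-scalar w iso {P} P∈ = begin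
    ⟦ 8 ⟧ * A                ≡⟨ quarter A ⟩
    ½ * ½ * (⟦ 32 ⟧ * A)     ≡⟨ cong (½ * ½ *_) (sym (double-switch-sum M j size w)) ⟩
    ½ * ½ * ∑⁴ (λ b d a c → 𝟙 (Matching.four-edges M b d a c) * w (a ↔ c · b ↔ d · P))
                              ≡⟨ cong (½ * ½ *_) (SwitchSums.double-switches M w) ⟩
    ½ * ½ * (S₄ - (⟦ 4 ⟧ * μ - ⟦ 36 ⟧) * S₂ - ⟦ 8 ⟧ * S₃ + (⟦ 8 ⟧ * μ * μ - ⟦ 48 ⟧ * μ) * w P)
      ≡⟨ cong (½ * ½ *_) (cong₂ _+_ (cong₂ _-_ (cong₂ _-_ S₄≡ (cong₂ (λ k s → (⟦ 4 ⟧ * k - ⟦ 36 ⟧) * s) μ≡ S₂≡)) (cong (⟦ 8 ⟧ *_) S₃≡))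
           (cong (λ k → (⟦ 8 ⟧ * k * k - ⟦ 48 ⟧ * k) * w P) μ≡)) ⟩
    ½ * ½ * (z * (z * w P) - (⟦ 4 ⟧ * (⟦ 2 ⟧ * ℚ[ n ]) - ⟦ 36 ⟧) * (z * w P) - ⟦ 8 ⟧ * (c * w P) +
      (⟦ 8 ⟧ * (⟦ 2 ⟧ * ℚ[ n ]) * (⟦ 2 ⟧ * ℚ[ n ]) - ⟦ 48 ⟧ * (⟦ 2 ⟧ * ℚ[ n ])) * w P)
      ≡⟨ collect y q ℚ[ n ] (w P) ⟩
    eightfold * w P ∎
    where
    A = Amul (2 ∷ 2 ∷ replicate j 1) w P
    M : IsMatching P
    M = ∈matchings⇒ P∈
    size : 2 ℕ.* n ≡ 8 ℕ.+ 2 ℕ.* j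
    size = ℕₚ.*-distribˡ-+ 2 4 j
    open SwitchSums M w using (S₂; S₃; S₄)
    μ = ℚ[ 2 ℕ.* n ]
    μ≡ : μ ≡ ⟦ 2 ⟧ * ℚ[ n ]
    μ≡ = ℚ[]-* 2 n
    z c : ℚ
    z = ⟦ 2 ⟧ * y
    c = q + ((⟦ 2 ⟧ * ℚ[ n ]) * (⟦ 2 ⟧ * ℚ[ n ]) - z)
    z≡ : F₂.row₂ - F₂.col₂ ≡ z
    z≡ = trans (cong₂ _-_ row₂-double col₂-double) (lem H.row₂ H.col₂)
      where
      lem : ∀ r k → ⟦ 4 ⟧ * r - ⟦ 2 ⟧ * k ≡ ⟦ 2 ⟧ * (⟦ 2 ⟧ * r - k)
      lem = solve-∀ ℚ-ring
    q≡ : F₂.row₃ + F₂.col₃ - ⟦ 3 ⟧ * F₂.hook ≡ q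
    q≡ = trans (cong₂ _-_ (cong₂ _+_ row₃-double col₃-double) (cong (⟦ 3 ⟧ *_) hook-double)) (cong (λ t → ⟦ 8 ⟧ * H.row₃ + ⟦ 2 ⟧ * H.col₃ - t) (sym (ℚₚ.*-assoc ⟦ 3 ⟧ ⟦ 4 ⟧ H.hook)))
    swaps : ∀ {Q} → IsMatching Q → ∑ (λ a → ∑ (λ b → w (a ↔ b · Q))) ≡ z * w Q
    swaps {Q} MQ = trans (F₂.swaps-scalar w iso MQ) (cong (_* w Q) z≡)
    S₂≡ : S₂ ≡ z * w P
    S₂≡ = swaps M
    S₃≡ : S₃ ≡ c * w P
    S₃≡ = trans (F₂.cycles-scalar w iso M) (cong (_* w P) (cong₂ _+_ q≡ (cong₂ _-_ (cong₂ _*_ μ≡ μ≡) z≡)))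
    -- The inner sum is a pair sum based at the matching `b ↔ d · P`, where the same scalar applies.
    S₄≡ : S₄ ≡ z * (z * w P)
    S₄≡ = trans (∑-cong (λ b → trans (∑-cong (λ d → swaps (↔-matching b d M))) (∑-*ˡ z (λ d → w (b ↔ d · P)))))
      (trans (∑-*ˡ z (λ b → ∑ (λ d → w (b ↔ d · P)))) (cong (z *_) S₂≡))
    quarter : ∀ x → ⟦ 8 ⟧ * x ≡ ½ * ½ * (⟦ 32 ⟧ * x)
    quarter = solve-∀ ℚ-ring
    collect : ∀ y q n w →
      ½ * ½ * ((⟦ 2 ⟧ * y) * ((⟦ 2 ⟧ * y) * w) - (⟦ 4 ⟧ * (⟦ 2 ⟧ * n) - ⟦ 36 ⟧) * ((⟦ 2 ⟧ * y) * w)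
        - ⟦ 8 ⟧ * ((q + ((⟦ 2 ⟧ * n) * (⟦ 2 ⟧ * n) - ⟦ 2 ⟧ * y)) * w)
        + (⟦ 8 ⟧ * (⟦ 2 ⟧ * n) * (⟦ 2 ⟧ * n) - ⟦ 48 ⟧ * (⟦ 2 ⟧ * n)) * w)
      ≡ (y * y - (⟦ 4 ⟧ * n - ⟦ 22 ⟧) * y - ⟦ 2 ⟧ * q - ⟦ 24 ⟧ * n) * w
    collect = solve-∀ ℚ-ring

-- Bounding the eigenvalue

≡ᵇ-transitive : ∀ x y z → transitiveᵇ (x ≡ᵇ y) (y ≡ᵇ z) (x ≡ᵇ z) ≡ true
≡ᵇ-transitive x y z = lem (x ≡ᵇ y) (y ≡ᵇ z) (x ≡ᵇ z)
  (λ p q → to (trans (from {x} p) (from {y} q))) (λ p q → to (trans (sym (from {x} p)) (from {x} q)))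
  (λ p q → to (trans (from {x} q) (sym (from {y} p))))
  where
  from : ∀ {x y} → (x ≡ᵇ y) ≡ true → x ≡ y
  from {x} {y} h = ℕₚ.≡ᵇ⇒≡ x y (≡⇒T h)
  to : ∀ {x y} → x ≡ y → (x ≡ᵇ y) ≡ true
  to {x} {y} h = T⇒≡ (ℕₚ.≡⇒≡ᵇ x y h)
  lem : ∀ a b c → (a ≡ true → b ≡ true → c ≡ true) → (a ≡ true → c ≡ true → b ≡ true) → (b ≡ true → c ≡ true → a ≡ true) →
    transitiveᵇ a b c ≡ true
  lem true true true _ _ _ = refl
  lem true true false h _ _ = case h refl refl of λ ()
  lem true false true _ h _ = case h refl refl of λ ()
  lem false true true _ _ h = case h refl refl of λ ()
  lem true false false _ _ _ = refl
  lem false true false _ _ _ = refl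
  lem false false true _ _ _ = refl
  lem false false false _ _ _ = refl

-- Summed over the rotations of (a, b, c) both weights are nonnegative on every triple of cells. The terms of weight₂
-- containing eab, the indicator of a = b, cancel its contributions from triples with repeated cells.
weight₁ : (rab rbc kab kbc kca : ℚ) → ℚ
weight₁ rab rbc kab kbc kca = ⟦ 8 ⟧ * (rab * rbc) + ⟦ 2 ⟧ * (kab * kbc * kca) - ⟦ 6 ⟧ * (rab * kbc) - ⟦ 6 ⟧ * (rbc * kab)
  - ⟦ 12 ⟧ * rab + ⟦ 6 ⟧ * kab + ⟦ 4 ⟧

weight₂ : (rab rbc kab kbc kca eab ebc : ℚ) → ℚ
weight₂ rab rbc kab kbc kca eab ebc = ⟦ 8 ⟧ * (rab * rbc) + ⟦ 2 ⟧ * (kab * kbc * kca) - ⟦ 6 ⟧ * (rab * kbc) - ⟦ 6 ⟧ * (rbc * kab)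
  + ⟦ 6 ⟧ * rab - ⟦ 3 ⟧ * kab + 1ℚ - ⟦ 36 ⟧ * (eab * rbc) + ⟦ 18 ⟧ * (eab * kbc) - ⟦ 9 ⟧ * eab + ⟦ 30 ⟧ * (eab * ebc)

-- Another form of `k`: a cell is determined by its row and column, so different cells of one column
-- lie in different rows. The weights then depend on six Booleans only.
offRow : Bool → Bool → ℚ
offRow r c = 𝟙 (c ∧ not r)

cellEq : Bool → Bool → ℚ
cellEq r c = 𝟙 (r ∧ c)

rotated₁ rotated₂ : (rab rbc rca cab cbc cca : Bool) → ℚ
rotated₁ rab rbc rca cab cbc cca =
    weight₁ (𝟙 rab) (𝟙 rbc) (offRow rab cab) (offRow rbc cbc) (offRow rca cca)
  + weight₁ (𝟙 rbc) (𝟙 rca) (offRow rbc cbc) (offRow rca cca) (offRow rab cab)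
  + weight₁ (𝟙 rca) (𝟙 rab) (offRow rca cca) (offRow rab cab) (offRow rbc cbc)
rotated₂ rab rbc rca cab cbc cca =
    weight₂ (𝟙 rab) (𝟙 rbc) (offRow rab cab) (offRow rbc cbc) (offRow rca cca) (cellEq rab cab) (cellEq rbc cbc)
  + weight₂ (𝟙 rbc) (𝟙 rca) (offRow rbc cbc) (offRow rca cca) (offRow rab cab) (cellEq rbc cbc) (cellEq rca cca)
  + weight₂ (𝟙 rca) (𝟙 rab) (offRow rca cca) (offRow rab cab) (offRow rbc cbc) (cellEq rca cca) (cellEq rab cab)

-- A single weight can be negative, for instance if only a and b share a row. The rotated sum is 0
-- as soon as two of the cells share a row, and positive otherwise.
rotated₁≥0 : ∀ rab rbc rca cab cbc cca → (transitiveᵇ rab rbc rca ∧ transitiveᵇ cab cbc cca) ≡ true →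
  0ℚ ≤ℚ rotated₁ rab rbc rca cab cbc cca
rotated₁≥0 = from-yes (∀ᵇ? λ rab → ∀ᵇ? λ rbc → ∀ᵇ? λ rca → ∀ᵇ? λ cab → ∀ᵇ? λ cbc → ∀ᵇ? λ cca →
  ((transitiveᵇ rab rbc rca ∧ transitiveᵇ cab cbc cca) ≟ᵇ true) →-dec (0ℚ ℚₚ.≤? rotated₁ rab rbc rca cab cbc cca))

rotated₂≥0 : ∀ rab rbc rca cab cbc cca → (transitiveᵇ rab rbc rca ∧ transitiveᵇ cab cbc cca) ≡ true →
  0ℚ ≤ℚ rotated₂ rab rbc rca cab cbc cca
rotated₂≥0 = from-yes (∀ᵇ? λ rab → ∀ᵇ? λ rbc → ∀ᵇ? λ rca → ∀ᵇ? λ cab → ∀ᵇ? λ cbc → ∀ᵇ? λ cca →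
  ((transitiveᵇ rab rbc rca ∧ transitiveᵇ cab cbc cca) ≟ᵇ true) →-dec (0ℚ ℚₚ.≤? rotated₂ rab rbc rca cab cbc cca))

≡ᵇ-sym : ∀ x y → (x ≡ᵇ y) ≡ (y ≡ᵇ x)
≡ᵇ-sym x y = ≡ᵇ-cong {x} {y} {y} {x} sym sym

==ᶠ-sym : ∀ {m} (a b : Fin m) → (a ==ᶠ b) ≡ (b ==ᶠ a)
==ᶠ-sym a b with a ≟ᶠ b
... | yes refl = sym (==ᶠ-refl a)
... | no n = sym (==ᶠ-≢ (n ∘ sym))

0≤third : ∀ {x} → 0ℚ ≤ℚ x + x + x → 0ℚ ≤ℚ x
0≤third {x} h = ℚₚ.≮⇒≥ λ lt → ℚₚ.<-irrefl refl (ℚₚ.<-≤-trans (ℚₚ.+-mono-< (ℚₚ.+-mono-< lt lt) lt) h)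

p≤q⇒0≤q-p : ∀ {p q} → p ≤ℚ q → 0ℚ ≤ℚ q - p
p≤q⇒0≤q-p {p} {q} h = subst (_≤ℚ q - p) (ℚₚ.+-inverseʳ p) (ℚₚ.+-monoˡ-≤ (- p) h)

0≤q-p⇒p≤q : ∀ {p q} → 0ℚ ≤ℚ q - p → p ≤ℚ q
0≤q-p⇒p≤q {p} {q} h = subst₂ _≤ℚ_ (ℚₚ.+-identityˡ p) (lem q p) (ℚₚ.+-monoˡ-≤ p h)
  where
  lem : ∀ q p → q - p + p ≡ q
  lem = solve-∀ ℚ-ring

0≤+ : ∀ {p q} → 0ℚ ≤ℚ p → 0ℚ ≤ℚ q → 0ℚ ≤ℚ p + q
0≤+ {p} {q} h h' = ℚₚ.+-mono-≤ {0ℚ} {p} {0ℚ} {q} h h'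

0≤* : ∀ {p q} → 0ℚ ≤ℚ p → 0ℚ ≤ℚ q → 0ℚ ≤ℚ p * q
0≤* {p} {q} h h' = subst (_≤ℚ p * q) (ℚₚ.*-zeroʳ p) (ℚₚ.*-monoˡ-≤-nonNeg p {{ℚ.nonNegative h}} h')

module Bounds (n : ℕ) (ν : List ℕ) (D : Shape.IsDiagram n ν) where

  open Shape n ν using (row; col; r; k; r-def; k-def; cell-inj)
  open Diagram n ν D using (row₂; col₂; row₃; col₃; hook)

  private
    rᵇ cᵇ : Fin n → Fin n → Bool
    rᵇ a b = row a ≡ᵇ row b
    cᵇ a b = col a ≡ᵇ col b

    e : Fin n → Fin n → ℚ
    e a b = 𝟙 (b ==ᶠ a)

    eq-cell : ∀ a b → (a ==ᶠ b) ≡ (rᵇ a b ∧ cᵇ a b)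
    eq-cell a b with a ≟ᶠ b
    ... | yes refl = sym (cong₂ _∧_ (T⇒≡ (ℕₚ.≡⇒≡ᵇ (row a) (row a) refl)) (T⇒≡ (ℕₚ.≡⇒≡ᵇ (col a) (col a) refl)))
    ... | no ne with rᵇ a b in er | cᵇ a b in ec
    ... | true | true = ⊥-elim (ne (cell-inj D (ℕₚ.≡ᵇ⇒≡ _ _ (≡⇒T er)) (ℕₚ.≡ᵇ⇒≡ _ _ (≡⇒T ec))))
    ... | true | false = refl
    ... | false | _ = refl

    e≡ : ∀ a b → e a b ≡ cellEq (rᵇ a b) (cᵇ a b)
    e≡ a b = cong 𝟙 (trans (==ᶠ-sym b a) (eq-cell a b))

    k≡off : ∀ a b → k a b ≡ offRow (rᵇ a b) (cᵇ a b)
    k≡off a b = trans (k-def a b) (trans (sym (𝟙-∧ (cᵇ a b) (not (a ==ᶠ b)))) (cong 𝟙 (trans (cong (λ x → cᵇ a b ∧ not x) (eq-cell a b)) (lem (rᵇ a b) (cᵇ a b)))))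
      where
      lem : ∀ r c → (c ∧ not (r ∧ c)) ≡ (c ∧ not r)
      lem true true = refl
      lem true false = refl
      lem false true = refl
      lem false false = refl

    r-sym : ∀ a b → r a b ≡ r b a
    r-sym a b = trans (r-def a b) (trans (cong 𝟙 (≡ᵇ-sym (row a) (row b))) (sym (r-def b a)))

    k-sym : ∀ a b → k a b ≡ k b a
    k-sym a b = trans (k-def a b) (trans (cong₂ (λ x y → 𝟙 x * 𝟙 (not y)) (≡ᵇ-sym (col a) (col b)) (==ᶠ-sym a b)) (sym (k-def b a)))

    consistent₃ : ∀ a b c → (transitiveᵇ (rᵇ a b) (rᵇ b c) (rᵇ c a) ∧ transitiveᵇ (cᵇ a b) (cᵇ b c) (cᵇ c a)) ≡ true
    consistent₃ a b c = cong₂ _∧_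
      (trans (cong (transitiveᵇ (rᵇ a b) (rᵇ b c)) (≡ᵇ-sym (row c) (row a))) (≡ᵇ-transitive (row a) (row b) (row c)))
      (trans (cong (transitiveᵇ (cᵇ a b) (cᵇ b c)) (≡ᵇ-sym (col c) (col a))) (≡ᵇ-transitive (col a) (col b) (col c)))

    -- The sum over all triples is invariant under rotation, so only the sum over the three
    -- rotations of a triple has to be nonnegative.
    by-rotation : (f : Fin n → Fin n → Fin n → ℚ) → (∀ a b c → 0ℚ ≤ℚ f a b c + f b c a + f c a b) → 0ℚ ≤ℚ ∑³ f
    by-rotation f h = 0≤third (subst (0ℚ ≤ℚ_) total (∑-≥0 _ (λ a → ∑-≥0 _ (λ b → ∑-≥0 _ (λ c → h a b c)))))
      where
      total : ∑³ (λ a b c → f a b c + f b c a + f c a b) ≡ ∑³ f + ∑³ f + ∑³ f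
      total = trans (∑³-+ (λ a b c → f a b c + f b c a) (λ a b c → f c a b))
        (cong₂ _+_ (trans (∑³-+ f (λ a b c → f b c a)) (cong (∑³ f +_) (∑³-rotate f)))
          (trans (∑³-rotate (λ a b c → f b c a)) (∑³-rotate f)))

    w₁ w₂ : Fin n → Fin n → Fin n → ℚ
    w₁ a b c = weight₁ (r a b) (r b c) (k a b) (k b c) (k c a)
    w₂ a b c = weight₂ (r a b) (r b c) (k a b) (k b c) (k c a) (e a b) (e b c)

    0≤∑w₁ : 0ℚ ≤ℚ ∑³ w₁
    0≤∑w₁ = by-rotation w₁ λ a b c → subst (0ℚ ≤ℚ_)
      (sym (cong₂ _+_ (cong₂ _+_ (to a b c) (to b c a)) (to c a b)))
      (rotated₁≥0 (rᵇ a b) (rᵇ b c) (rᵇ c a) (cᵇ a b) (cᵇ b c) (cᵇ c a) (consistent₃ a b c))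
      where
      to : ∀ a b c → w₁ a b c ≡ weight₁ (𝟙 (rᵇ a b)) (𝟙 (rᵇ b c)) (offRow (rᵇ a b) (cᵇ a b)) (offRow (rᵇ b c) (cᵇ b c)) (offRow (rᵇ c a) (cᵇ c a))
      to a b c rewrite r-def a b | r-def b c | k≡off a b | k≡off b c | k≡off c a = refl

    0≤∑w₂ : 0ℚ ≤ℚ ∑³ w₂
    0≤∑w₂ = by-rotation w₂ λ a b c → subst (0ℚ ≤ℚ_)
      (sym (cong₂ _+_ (cong₂ _+_ (to a b c) (to b c a)) (to c a b)))
      (rotated₂≥0 (rᵇ a b) (rᵇ b c) (rᵇ c a) (cᵇ a b) (cᵇ b c) (cᵇ c a) (consistent₃ a b c))
      where
      to : ∀ a b c → w₂ a b c ≡ weight₂ (𝟙 (rᵇ a b)) (𝟙 (rᵇ b c)) (offRow (rᵇ a b) (cᵇ a b)) (offRow (rᵇ b c) (cᵇ b c)) (offRow (rᵇ c a) (cᵇ c a))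
                                  (cellEq (rᵇ a b) (cᵇ a b)) (cellEq (rᵇ b c) (cᵇ b c))
      to a b c rewrite r-def a b | r-def b c | k≡off a b | k≡off b c | k≡off c a | e≡ a b | e≡ b c = refl

    N : ℚ
    N = ℚ[ n ]

    ∑-1 : ∑ {n} (λ _ → 1ℚ) ≡ N
    ∑-1 = trans (∑-const 1ℚ) (ℚₚ.*-identityʳ N)

    free-c : (f : Fin n → Fin n → ℚ) → ∑³ (λ a b c → f a b) ≡ N * ∑ (λ a → ∑ (f a))
    free-c f = trans (∑-cong (λ a → ∑-cong (λ b → ∑-const (f a b)))) (∑∑-*ˡ N f)

    equal-ab : (f : Fin n → Fin n → ℚ) → ∑³ (λ a b c → e a b * f b c) ≡ ∑ (λ a → ∑ (f a))
    equal-ab f = ∑-cong (λ a → trans (∑-cong (λ b → ∑-*ˡ (e a b) (f b))) (∑-δ a (λ b → ∑ (f b))))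

    ∑∑e : ∑ (λ a → ∑ (e a)) ≡ N
    ∑∑e = trans (∑-cong (λ a → trans (∑-cong (λ b → sym (ℚₚ.*-identityʳ (e a b)))) (∑-δ a (λ _ → 1ℚ)))) ∑-1

    hook-reverse : ∑³ (λ a b c → r b c * k a b) ≡ hook
    hook-reverse = trans (∑³-cong (λ a b c → cong₂ _*_ (r-sym b c) (k-sym a b))) (∑³-reverse (λ a b c → r a b * k b c))

    ∑³1 : ∑³ {n} (λ _ _ _ → 1ℚ) ≡ N * (N * N)
    ∑³1 = trans (free-c (λ _ _ → 1ℚ)) (cong (N *_) (trans (∑-cong {n} (λ a → ∑-1)) (∑-const N)))

  y q : ℚ
  y = ⟦ 2 ⟧ * row₂ - col₂
  q = ⟦ 8 ⟧ * row₃ + ⟦ 2 ⟧ * col₃ - ⟦ 12 ⟧ * hook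

  private
    Terms : Set
    Terms = List (ℚ × (Fin n → Fin n → Fin n → ℚ))

    ∑³-terms : (ts : Terms) → ∑³ (λ a b c → Σℚ ts (λ t → proj₁ t * proj₂ t a b c)) ≡ Σℚ ts (λ t → proj₁ t * ∑³ (proj₂ t))
    ∑³-terms ts = trans (∑³-Σ ts (λ t a b c → proj₁ t * proj₂ t a b c)) (Σ-cong ts (λ t → ∑³-*ˡ (proj₁ t) (proj₂ t)))

    term : ∀ k {x y r s} → x ≡ y → r ≡ s → k * x + r ≡ k * y + s
    term k refl refl = refl

  -- Equality holds for shapes with at most two rows, since two cells of any triple then share a
  -- row. This is what makes the final bound sharp at [n-1,1].
  lower-bound₁ : 0ℚ ≤ℚ q - ⟦ 6 ⟧ * N * y + ⟦ 4 ⟧ * (N * (N * N))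
  lower-bound₁ = subst (0ℚ ≤ℚ_) (trans (∑³-cong split) (trans (∑³-terms ts) (trans
      (term ⟦ 8 ⟧ (refl {x = row₃}) (term ⟦ 2 ⟧ (refl {x = col₃}) (term (- ⟦ 6 ⟧) (refl {x = hook}) (term (- ⟦ 6 ⟧) hook-reverse
        (term (- ⟦ 12 ⟧) (free-c r) (term ⟦ 6 ⟧ (free-c k) (term ⟦ 4 ⟧ ∑³1 (refl {x = 0ℚ}))))))))
      (collect row₂ col₂ row₃ col₃ hook N)))) 0≤∑w₁
    where
    ts : Terms
    ts = (⟦ 8 ⟧ , λ a b c → r a b * r b c) ∷ (⟦ 2 ⟧ , λ a b c → k a b * k b c * k c a) ∷ (- ⟦ 6 ⟧ , λ a b c → r a b * k b c)
       ∷ (- ⟦ 6 ⟧ , λ a b c → r b c * k a b) ∷ (- ⟦ 12 ⟧ , λ a b c → r a b) ∷ (⟦ 6 ⟧ , λ a b c → k a b) ∷ (⟦ 4 ⟧ , λ a b c → 1ℚ) ∷ []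
    split : ∀ a b c → w₁ a b c ≡ Σℚ ts (λ t → proj₁ t * proj₂ t a b c)
    split a b c = lem (r a b) (r b c) (k a b) (k b c) (k c a)
      where
      lem : ∀ x y u v w → ⟦ 8 ⟧ * (x * y) + ⟦ 2 ⟧ * (u * v * w) - ⟦ 6 ⟧ * (x * v) - ⟦ 6 ⟧ * (y * u) - ⟦ 12 ⟧ * x + ⟦ 6 ⟧ * u + ⟦ 4 ⟧
        ≡ ⟦ 8 ⟧ * (x * y) + (⟦ 2 ⟧ * (u * v * w) + (- ⟦ 6 ⟧ * (x * v) + (- ⟦ 6 ⟧ * (y * u) + (- ⟦ 12 ⟧ * x + (⟦ 6 ⟧ * u + (⟦ 4 ⟧ * 1ℚ + 0ℚ))))))
      lem = solve-∀ ℚ-ring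
    collect : ∀ r₂ k₂ r₃ k₃ h n →
      ⟦ 8 ⟧ * r₃ + (⟦ 2 ⟧ * k₃ + (- ⟦ 6 ⟧ * h + (- ⟦ 6 ⟧ * h + (- ⟦ 12 ⟧ * (n * r₂) + (⟦ 6 ⟧ * (n * k₂) + (⟦ 4 ⟧ * (n * (n * n)) + 0ℚ))))))
      ≡ (⟦ 8 ⟧ * r₃ + ⟦ 2 ⟧ * k₃ - ⟦ 12 ⟧ * h) - ⟦ 6 ⟧ * n * (⟦ 2 ⟧ * r₂ - k₂) + ⟦ 4 ⟧ * (n * (n * n))
    collect = solve-∀ ℚ-ring

  -- Equality holds for a single column, the opposite extreme to the shapes for which `lower-bound₁`
  -- is sharp.
  lower-bound₂ : 0ℚ ≤ℚ q - (⟦ 18 ⟧ * y - ⟦ 3 ⟧ * N * y + ⟦ 9 ⟧ * N * N - ⟦ 30 ⟧ * N - N * (N * N))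
  lower-bound₂ = subst (0ℚ ≤ℚ_) (trans (∑³-cong split) (trans (∑³-terms ts) (trans
      (term ⟦ 8 ⟧ (refl {x = row₃}) (term ⟦ 2 ⟧ (refl {x = col₃}) (term (- ⟦ 6 ⟧) (refl {x = hook}) (term (- ⟦ 6 ⟧) hook-reverse
        (term ⟦ 6 ⟧ (free-c r) (term (- ⟦ 3 ⟧) (free-c k) (term 1ℚ ∑³1
        (term (- ⟦ 36 ⟧) (equal-ab r) (term ⟦ 18 ⟧ (equal-ab k) (term (- ⟦ 9 ⟧) (trans (free-c e) (cong (N *_) ∑∑e))
        (term ⟦ 30 ⟧ (trans (equal-ab e) ∑∑e) (refl {x = 0ℚ}))))))))))))
      (collect row₂ col₂ row₃ col₃ hook N)))) 0≤∑w₂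
    where
    ts : Terms
    ts = (⟦ 8 ⟧ , λ a b c → r a b * r b c) ∷ (⟦ 2 ⟧ , λ a b c → k a b * k b c * k c a) ∷ (- ⟦ 6 ⟧ , λ a b c → r a b * k b c)
       ∷ (- ⟦ 6 ⟧ , λ a b c → r b c * k a b) ∷ (⟦ 6 ⟧ , λ a b c → r a b) ∷ (- ⟦ 3 ⟧ , λ a b c → k a b) ∷ (1ℚ , λ a b c → 1ℚ)
       ∷ (- ⟦ 36 ⟧ , λ a b c → e a b * r b c) ∷ (⟦ 18 ⟧ , λ a b c → e a b * k b c) ∷ (- ⟦ 9 ⟧ , λ a b c → e a b)
       ∷ (⟦ 30 ⟧ , λ a b c → e a b * e b c) ∷ []
    split : ∀ a b c → w₂ a b c ≡ Σℚ ts (λ t → proj₁ t * proj₂ t a b c)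
    split a b c = lem (r a b) (r b c) (k a b) (k b c) (k c a) (e a b) (e b c)
      where
      lem : ∀ x y u v w s t → ⟦ 8 ⟧ * (x * y) + ⟦ 2 ⟧ * (u * v * w) - ⟦ 6 ⟧ * (x * v) - ⟦ 6 ⟧ * (y * u) + ⟦ 6 ⟧ * x - ⟦ 3 ⟧ * u + 1ℚ
          - ⟦ 36 ⟧ * (s * y) + ⟦ 18 ⟧ * (s * v) - ⟦ 9 ⟧ * s + ⟦ 30 ⟧ * (s * t)
        ≡ ⟦ 8 ⟧ * (x * y) + (⟦ 2 ⟧ * (u * v * w) + (- ⟦ 6 ⟧ * (x * v) + (- ⟦ 6 ⟧ * (y * u) + (⟦ 6 ⟧ * x + (- ⟦ 3 ⟧ * u + (1ℚ * 1ℚ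
          + (- ⟦ 36 ⟧ * (s * y) + (⟦ 18 ⟧ * (s * v) + (- ⟦ 9 ⟧ * s + (⟦ 30 ⟧ * (s * t) + 0ℚ))))))))))
      lem = solve-∀ ℚ-ring
    collect : ∀ r₂ k₂ r₃ k₃ h n →
      ⟦ 8 ⟧ * r₃ + (⟦ 2 ⟧ * k₃ + (- ⟦ 6 ⟧ * h + (- ⟦ 6 ⟧ * h + (⟦ 6 ⟧ * (n * r₂) + (- ⟦ 3 ⟧ * (n * k₂) + (1ℚ * (n * (n * n))
        + (- ⟦ 36 ⟧ * r₂ + (⟦ 18 ⟧ * k₂ + (- ⟦ 9 ⟧ * (n * n) + (⟦ 30 ⟧ * n + 0ℚ))))))))))
      ≡ (⟦ 8 ⟧ * r₃ + ⟦ 2 ⟧ * k₃ - ⟦ 12 ⟧ * h) - (⟦ 18 ⟧ * (⟦ 2 ⟧ * r₂ - k₂) - ⟦ 3 ⟧ * n * (⟦ 2 ⟧ * r₂ - k₂) + ⟦ 9 ⟧ * n * n - ⟦ 30 ⟧ * n - n * (n * n))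
    collect = solve-∀ ℚ-ring

  -- Each ordered pair contributes at least -1 to y, and 2 when its two cells are equal; a single
  -- column attains this.
  y-lower : 0ℚ ≤ℚ y - (⟦ 3 ⟧ * N - N * N)
  y-lower = subst (0ℚ ≤ℚ_) total (∑-≥0 _ (λ a → ∑-≥0 _ (λ b → nonneg a b)))
    where
    f : Fin n → Fin n → ℚ
    f a b = ⟦ 2 ⟧ * r a b - k a b - ⟦ 3 ⟧ * e a b + 1ℚ
    check : ∀ rr cc → 0ℚ ≤ℚ ⟦ 2 ⟧ * 𝟙 rr - offRow rr cc - ⟦ 3 ⟧ * cellEq rr cc + 1ℚ
    check = from-yes (∀ᵇ? λ rr → ∀ᵇ? λ cc → 0ℚ ℚₚ.≤? (⟦ 2 ⟧ * 𝟙 rr - offRow rr cc - ⟦ 3 ⟧ * cellEq rr cc + 1ℚ))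
    nonneg : ∀ a b → 0ℚ ≤ℚ f a b
    nonneg a b rewrite r-def a b | k≡off a b | e≡ a b = check (rᵇ a b) (cᵇ a b)
    total : ∑ (λ a → ∑ (f a)) ≡ y - (⟦ 3 ⟧ * N - N * N)
    total = begin
      ∑ (λ a → ∑ (f a))
        ≡⟨ trans (∑∑-+ (λ a b → ⟦ 2 ⟧ * r a b - k a b - ⟦ 3 ⟧ * e a b) (λ _ _ → 1ℚ)) (cong₂ _+_
             (trans (∑∑-- (λ a b → ⟦ 2 ⟧ * r a b - k a b) (λ a b → ⟦ 3 ⟧ * e a b)) (cong₂ _-_
               (trans (∑∑-- (λ a b → ⟦ 2 ⟧ * r a b) k) (cong (_- col₂) (∑∑-*ˡ ⟦ 2 ⟧ r)))
               (trans (∑∑-*ˡ ⟦ 3 ⟧ e) (cong (⟦ 3 ⟧ *_) ∑∑e))))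
             (trans (∑-cong {n} (λ a → ∑-1)) (∑-const N))) ⟩
      ⟦ 2 ⟧ * row₂ - col₂ - ⟦ 3 ⟧ * N + N * N ≡⟨ lem (⟦ 2 ⟧ * row₂ - col₂) N ⟩
      y - (⟦ 3 ⟧ * N - N * N) ∎
      where
      lem : ∀ y n → y - ⟦ 3 ⟧ * n + n * n ≡ y - (⟦ 3 ⟧ * n - n * n)
      lem = solve-∀ ℚ-ring

  module _ {x₀ y₀ : Fin n} (rows : row x₀ ≢ row y₀) (cols : col x₀ ≡ col y₀) where

    private
      x≢y : x₀ ≢ y₀
      x≢y h = rows (cong row h)

      -- It is 0 for cells of one row, 3 for different cells of one column and 2 otherwise. The
      -- total is 2 n² - y, the distance from a single row, and pairs meeting `x₀` or `y₀` already
      -- supply 4 n - 2 of it.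
      deficit : Fin n → Fin n → ℚ
      deficit a b = ⟦ 2 ⟧ - ⟦ 2 ⟧ * r a b + k a b

      deficit-sym : ∀ a b → deficit a b ≡ deficit b a
      deficit-sym a b = cong₂ (λ u v → ⟦ 2 ⟧ - ⟦ 2 ⟧ * u + v) (r-sym a b) (k-sym a b)

      deficit≥0 : ∀ a b → 0ℚ ≤ℚ deficit a b
      deficit≥0 a b rewrite r-def a b | k≡off a b = check (rᵇ a b) (cᵇ a b)
        where
        check : ∀ rr cc → 0ℚ ≤ℚ ⟦ 2 ⟧ - ⟦ 2 ⟧ * 𝟙 rr + offRow rr cc
        check = from-yes (∀ᵇ? λ rr → ∀ᵇ? λ cc → 0ℚ ℚₚ.≤? (⟦ 2 ⟧ - ⟦ 2 ⟧ * 𝟙 rr + offRow rr cc))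

      deficit-refl : ∀ a → deficit a a ≡ 0ℚ
      deficit-refl a rewrite Shape.r-yes n ν {a} {a} refl | Shape.k-refl n ν a = refl

      deficit-xy : deficit x₀ y₀ ≡ ⟦ 3 ⟧
      deficit-xy rewrite Shape.r-no n ν rows | Shape.k-yes n ν cols x≢y = refl

      -- no cell lies in the rows of both x₀ and y₀
      pair-deficit : ∀ a → 0ℚ ≤ℚ deficit a x₀ + deficit a y₀ - (⟦ 2 ⟧ + e x₀ a + e y₀ a)
      pair-deficit a with a ≟ᶠ x₀ | a ≟ᶠ y₀
      ... | yes refl | yes refl = ⊥-elim (x≢y refl)
      ... | yes refl | no _ rewrite deficit-refl x₀ | deficit-xy = ℚₚ.≤-refl
      ... | no _ | yes refl rewrite deficit-refl y₀ | deficit-sym y₀ x₀ | deficit-xy = ℚₚ.≤-refl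
      ... | no _ | no _ rewrite r-def a x₀ | k≡off a x₀ | r-def a y₀ | k≡off a y₀ =
          check (rᵇ a x₀) (rᵇ a y₀) (cᵇ a x₀) (cᵇ a y₀) (not-both (rᵇ a x₀) (rᵇ a y₀) refl refl)
        where
        not-both : ∀ p q → rᵇ a x₀ ≡ p → rᵇ a y₀ ≡ q → (p ∧ q) ≡ false
        not-both true true ep eq = ⊥-elim (rows (trans (sym (ℕₚ.≡ᵇ⇒≡ (row a) (row x₀) (≡⇒T ep))) (ℕₚ.≡ᵇ⇒≡ (row a) (row y₀) (≡⇒T eq))))
        not-both true false _ _ = refl
        not-both false _ _ _ = refl
        check : ∀ rx ry cx cy → (rx ∧ ry) ≡ false →
          0ℚ ≤ℚ (⟦ 2 ⟧ - ⟦ 2 ⟧ * 𝟙 rx + offRow rx cx) + (⟦ 2 ⟧ - ⟦ 2 ⟧ * 𝟙 ry + offRow ry cy) - (⟦ 2 ⟧ + 0ℚ + 0ℚ)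
        check = from-yes (∀ᵇ? λ rx → ∀ᵇ? λ ry → ∀ᵇ? λ cx → ∀ᵇ? λ cy → ((rx ∧ ry) ≟ᵇ false) →-dec
            (0ℚ ℚₚ.≤? ((⟦ 2 ⟧ - ⟦ 2 ⟧ * 𝟙 rx + offRow rx cx) + (⟦ 2 ⟧ - ⟦ 2 ⟧ * 𝟙 ry + offRow ry cy) - (⟦ 2 ⟧ + 0ℚ + 0ℚ))))

      column : ℚ
      column = ∑ λ a → deficit a x₀ + deficit a y₀

      column≥ : 0ℚ ≤ℚ column - (⟦ 2 ⟧ * N + ⟦ 2 ⟧)
      column≥ = subst (0ℚ ≤ℚ_) (trans (∑-- (λ a → deficit a x₀ + deficit a y₀) (λ a → ⟦ 2 ⟧ + e x₀ a + e y₀ a)) (cong (λ t → column - t) total)) (∑-≥0 _ pair-deficit)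
        where
        total : ∑ (λ a → ⟦ 2 ⟧ + e x₀ a + e y₀ a) ≡ ⟦ 2 ⟧ * N + ⟦ 2 ⟧
        ∑e : ∀ x → ∑ (e x) ≡ 1ℚ
        ∑e x = trans (∑-cong (λ a → sym (ℚₚ.*-identityʳ (e x a)))) (∑-δ x (λ _ → 1ℚ))
        total = trans (∑-+ (λ a → ⟦ 2 ⟧ + e x₀ a) (e y₀)) (trans (cong₂ _+_ (trans (∑-+ (λ _ → ⟦ 2 ⟧) (e x₀)) (cong₂ _+_ (∑-const ⟦ 2 ⟧) (∑e x₀))) (∑e y₀)) (lem N))
          where
          lem : ∀ n → n * ⟦ 2 ⟧ + 1ℚ + 1ℚ ≡ ⟦ 2 ⟧ * n + ⟦ 2 ⟧
          lem = solve-∀ ℚ-ring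

      α : Fin n → ℚ
      α a = e x₀ a + e y₀ a

      ∑α : (f : Fin n → ℚ) → ∑ (λ a → α a * f a) ≡ f x₀ + f y₀
      ∑α f = trans (∑-cong (λ a → ℚₚ.*-distribʳ-+ (f a) (e x₀ a) (e y₀ a))) (trans (∑-+ (λ a → e x₀ a * f a) (λ a → e y₀ a * f a)) (cong₂ _+_ (∑-δ x₀ f) (∑-δ y₀ f)))

      α-01 : ∀ a → α a ≡ 0ℚ ⊎ α a ≡ 1ℚ
      α-01 a with a ≟ᶠ x₀ | a ≟ᶠ y₀
      ... | yes refl | yes refl = ⊥-elim (x≢y refl)
      ... | yes _ | no _ = inj₂ refl
      ... | no _ | yes _ = inj₂ refl
      ... | no _ | no _ = inj₁ refl

      -- (1 − α a)(1 − α b) deficit ≥ 0: the cross through x₀ and y₀ only misses nonnegative terms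
      missed : Fin n → Fin n → ℚ
      missed a b = deficit a b - α b * deficit a b - α a * deficit a b + α a * (α b * deficit a b)

      missed≥0 : ∀ a b → 0ℚ ≤ℚ missed a b
      missed≥0 a b with α-01 a | α-01 b
      ... | inj₁ p | inj₁ q rewrite p | q = subst (0ℚ ≤ℚ_) (lem (deficit a b)) (deficit≥0 a b)
        where
        lem : ∀ x → x ≡ x - 0ℚ * x - 0ℚ * x + 0ℚ * (0ℚ * x)
        lem = solve-∀ ℚ-ring
      ... | inj₁ p | inj₂ q rewrite p | q = ℚₚ.≤-reflexive (lem (deficit a b))
        where
        lem : ∀ x → 0ℚ ≡ x - 1ℚ * x - 0ℚ * x + 0ℚ * (1ℚ * x)
        lem = solve-∀ ℚ-ring
      ... | inj₂ p | inj₁ q rewrite p | q = ℚₚ.≤-reflexive (lem (deficit a b))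
        where
        lem : ∀ x → 0ℚ ≡ x - 0ℚ * x - 1ℚ * x + 1ℚ * (0ℚ * x)
        lem = solve-∀ ℚ-ring
      ... | inj₂ p | inj₂ q rewrite p | q = ℚₚ.≤-reflexive (lem (deficit a b))
        where
        lem : ∀ x → 0ℚ ≡ x - 1ℚ * x - 1ℚ * x + 1ℚ * (1ℚ * x)
        lem = solve-∀ ℚ-ring

      ∑missed : ∑ (λ a → ∑ (missed a)) ≡ (⟦ 2 ⟧ * (N * N) - y) - column - column + ⟦ 6 ⟧
      ∑missed = begin
        ∑ (λ a → ∑ (missed a))
          ≡⟨ ∑-cong (λ a → trans (∑-+ (λ b → deficit a b - α b * deficit a b - α a * deficit a b) (λ b → α a * (α b * deficit a b)))
               (cong₂ _+_ (trans (∑-- (λ b → deficit a b - α b * deficit a b) (λ b → α a * deficit a b))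
                   (cong₂ _-_ (trans (∑-- (deficit a) (λ b → α b * deficit a b)) (cong (λ t → ∑ (deficit a) - t) (∑α (deficit a)))) (∑-*ˡ (α a) (deficit a))))
                 (trans (∑-*ˡ (α a) (λ b → α b * deficit a b)) (cong (α a *_) (∑α (deficit a)))))) ⟩
        ∑ (λ a → ∑ (deficit a) - c a - α a * ∑ (deficit a) + α a * c a)
          ≡⟨ trans (∑-+ (λ a → ∑ (deficit a) - c a - α a * ∑ (deficit a)) (λ a → α a * c a))
               (cong₂ _+_ (trans (∑-- (λ a → ∑ (deficit a) - c a) (λ a → α a * ∑ (deficit a)))
                   (cong₂ _-_ (∑-- (λ a → ∑ (deficit a)) c) (∑α (λ a → ∑ (deficit a))))) (∑α c)) ⟩
        ∑ (λ a → ∑ (deficit a)) - column - (∑ (deficit x₀) + ∑ (deficit y₀)) + (c x₀ + c y₀)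
          ≡⟨ cong₂ _+_ (cong₂ _-_ (cong (_- column) total)
               (trans (sym (∑-+ (deficit x₀) (deficit y₀))) (∑-cong (λ a → cong₂ _+_ (deficit-sym x₀ a) (deficit-sym y₀ a)))))
               (cong₂ _+_ (cong₂ _+_ (deficit-refl x₀) deficit-xy) (cong₂ _+_ (trans (deficit-sym y₀ x₀) deficit-xy) (deficit-refl y₀))) ⟩
        (⟦ 2 ⟧ * (N * N) - y) - column - column + ⟦ 6 ⟧ ∎
        where
        c : Fin n → ℚ
        c a = deficit a x₀ + deficit a y₀
        total : ∑ (λ a → ∑ (deficit a)) ≡ ⟦ 2 ⟧ * (N * N) - y
        total = begin
          ∑ (λ a → ∑ (deficit a))
            ≡⟨ trans (∑-cong (λ a → ∑-+ (λ b → ⟦ 2 ⟧ - ⟦ 2 ⟧ * r a b) (k a))) (∑-+ (λ a → ∑ (λ b → ⟦ 2 ⟧ - ⟦ 2 ⟧ * r a b)) (λ a → ∑ (k a))) ⟩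
          ∑ (λ a → ∑ (λ b → ⟦ 2 ⟧ - ⟦ 2 ⟧ * r a b)) + col₂
            ≡⟨ cong (_+ col₂) (trans (∑-cong (λ a → ∑-- (λ _ → ⟦ 2 ⟧) (λ b → ⟦ 2 ⟧ * r a b))) (∑-- (λ a → ∑ {n} (λ _ → ⟦ 2 ⟧)) (λ a → ∑ (λ b → ⟦ 2 ⟧ * r a b)))) ⟩
          ∑ {n} (λ a → ∑ {n} (λ _ → ⟦ 2 ⟧)) - ∑ (λ a → ∑ (λ b → ⟦ 2 ⟧ * r a b)) + col₂
            ≡⟨ cong (_+ col₂) (cong₂ _-_ (trans (∑-cong {n} (λ a → ∑-const ⟦ 2 ⟧)) (∑-const (N * ⟦ 2 ⟧))) (∑∑-*ˡ ⟦ 2 ⟧ r)) ⟩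
          N * (N * ⟦ 2 ⟧) - ⟦ 2 ⟧ * row₂ + col₂ ≡⟨ lem N row₂ col₂ ⟩
          ⟦ 2 ⟧ * (N * N) - y ∎
          where
          lem : ∀ n r k → n * (n * ⟦ 2 ⟧) - ⟦ 2 ⟧ * r + k ≡ ⟦ 2 ⟧ * (n * n) - (⟦ 2 ⟧ * r - k)
          lem = solve-∀ ℚ-ring

    -- `column` is at least 2 n + 2: every other cell misses the row of `x₀` or of `y₀`, and these
    -- two have deficit 3 with each other. Pairs in either order give twice `column`, less the pairs
    -- inside {x₀, y₀}, of total 6, counted twice; and 2 (2 n + 2) - 6 = 2 n² - 2 (n - 1)².
    y-upper : 0ℚ ≤ℚ ⟦ 2 ⟧ * (N - 1ℚ) * (N - 1ℚ) - y
    y-upper = subst (0ℚ ≤ℚ_) (lem N y column)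
      (0≤+ (subst (0ℚ ≤ℚ_) ∑missed (∑-≥0 _ (λ a → ∑-≥0 _ (missed≥0 a)))) (0≤+ column≥ column≥))
      where
      lem : ∀ n y c → (⟦ 2 ⟧ * (n * n) - y) - c - c + ⟦ 6 ⟧ + ((c - (⟦ 2 ⟧ * n + ⟦ 2 ⟧)) + (c - (⟦ 2 ⟧ * n + ⟦ 2 ⟧))) ≡ ⟦ 2 ⟧ * (n - 1ℚ) * (n - 1ℚ) - y
      lem = solve-∀ ℚ-ring

-- The quartic inequality between the eigenvalue and the bound

bound₈ : ℚ → ℚ
bound₈ N = ⟦ 4 ⟧ * N * N * N * N - ⟦ 40 ⟧ * N * N * N + ⟦ 132 ⟧ * N * N - ⟦ 160 ⟧ * N + ⟦ 48 ⟧

value₈ : (N y q : ℚ) → ℚ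
value₈ N y q = y * y - (⟦ 4 ⟧ * N - ⟦ 22 ⟧) * y - ⟦ 2 ⟧ * q - ⟦ 24 ⟧ * N

module Quartic {N y q : ℚ}
  (I₁ : 0ℚ ≤ℚ q - ⟦ 6 ⟧ * N * y + ⟦ 4 ⟧ * (N * (N * N)))
  (I₂ : 0ℚ ≤ℚ q - (⟦ 18 ⟧ * y - ⟦ 3 ⟧ * N * y + ⟦ 9 ⟧ * N * N - ⟦ 30 ⟧ * N - N * (N * N)))
  (lower : 0ℚ ≤ℚ y - (⟦ 3 ⟧ * N - N * N))
  (upper : 0ℚ ≤ℚ ⟦ 2 ⟧ * (N - 1ℚ) * (N - 1ℚ) - y) where

  -- the second root of the difference of the bound and the estimate from I₁; the first is 2 (N - 1)²
  root : ℚ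
  root = ⟦ 20 ⟧ * N - ⟦ 2 ⟧ * N * N - ⟦ 24 ⟧

  -- With q replaced by its bound from `I₁`, the value is a convex quadratic in y that meets
  -- `bound₈` at 2 (n - 1)² and at `root`, so it stays below in between.
  above-root : 0ℚ ≤ℚ y - root → 0ℚ ≤ℚ bound₈ N - value₈ N y q
  above-root h = subst (0ℚ ≤ℚ_) (lem N y q) (0≤+ (0≤* upper h) (0≤+ I₁ I₁))
    where
    lem : ∀ N y q → (⟦ 2 ⟧ * (N - 1ℚ) * (N - 1ℚ) - y) * (y - (⟦ 20 ⟧ * N - ⟦ 2 ⟧ * N * N - ⟦ 24 ⟧))
        + ((q - ⟦ 6 ⟧ * N * y + ⟦ 4 ⟧ * (N * (N * N))) + (q - ⟦ 6 ⟧ * N * y + ⟦ 4 ⟧ * (N * (N * N))))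
      ≡ (⟦ 4 ⟧ * N * N * N * N - ⟦ 40 ⟧ * N * N * N + ⟦ 132 ⟧ * N * N - ⟦ 160 ⟧ * N + ⟦ 48 ⟧)
        - (y * y - (⟦ 4 ⟧ * N - ⟦ 22 ⟧) * y - ⟦ 2 ⟧ * q - ⟦ 24 ⟧ * N)
    lem = solve-∀ ℚ-ring

  private
    -- What is left of `bound₈` once q is replaced by its bound from `I₂`.
    rest : ℚ
    rest = bound₈ N - (y * y + (⟦ 2 ⟧ * N - ⟦ 14 ⟧) * y + ⟦ 2 ⟧ * (N * (N * N)) - ⟦ 18 ⟧ * (N * N) + ⟦ 36 ⟧ * N)

    from-rest : 0ℚ ≤ℚ rest → 0ℚ ≤ℚ bound₈ N - value₈ N y q
    from-rest h = subst (0ℚ ≤ℚ_) (lem (bound₈ N) N y q) (0≤+ h (0≤+ I₂ I₂))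
      where
      lem : ∀ b N y q → b - (y * y + (⟦ 2 ⟧ * N - ⟦ 14 ⟧) * y + ⟦ 2 ⟧ * (N * (N * N)) - ⟦ 18 ⟧ * (N * N) + ⟦ 36 ⟧ * N)
          + ((q - (⟦ 18 ⟧ * y - ⟦ 3 ⟧ * N * y + ⟦ 9 ⟧ * N * N - ⟦ 30 ⟧ * N - N * (N * N)))
           + (q - (⟦ 18 ⟧ * y - ⟦ 3 ⟧ * N * y + ⟦ 9 ⟧ * N * N - ⟦ 30 ⟧ * N - N * (N * N))))
        ≡ b - (y * y - (⟦ 4 ⟧ * N - ⟦ 22 ⟧) * y - ⟦ 2 ⟧ * q - ⟦ 24 ⟧ * N)
      lem = solve-∀ ℚ-ring

  -- Below `root` also y ≤ n² - 3 n, and `lower` confines y to an interval symmetric about 0.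
  -- Written in s = n - 7 the remaining polynomials have nonnegative coefficients. At n = 6 the
  -- argument breaks, as `root` is 24 and n² - 3 n is 18. For n ≥ 16 the case cannot arise, since 3
  -- n - n² exceeds `root`.
  below-root : ∀ s → N ≡ ⟦ 7 ⟧ + s → 0ℚ ≤ℚ s → 0ℚ ≤ℚ root - y → 0ℚ ≤ℚ bound₈ N - value₈ N y q
  below-root s N≡ s≥0 h = from-rest (subst (0ℚ ≤ℚ_) (lem N y)
    (0≤+ (0≤* y≤ lower) (0≤+ (0≤* (0≤+ t≥0 t≥0) y≤) (subst (0ℚ ≤ℚ_) (sym quartic) quartic≥0))))
    where
    s² = 0≤* s≥0 s≥0
    t≥0 : 0ℚ ≤ℚ N - ⟦ 7 ⟧
    t≥0 = subst (0ℚ ≤ℚ_) (trans (shift s) (cong (_- ⟦ 7 ⟧) (sym N≡))) s≥0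
      where
      shift : ∀ s → s ≡ ⟦ 7 ⟧ + s - ⟦ 7 ⟧
      shift = solve-∀ ℚ-ring
    y≤ : 0ℚ ≤ℚ (N * N - ⟦ 3 ⟧ * N) - y
    y≤ = subst (0ℚ ≤ℚ_) (sum-of-gaps N y) (0≤+ h (subst (0ℚ ≤ℚ_) (trans (shift s) (cong (λ N → ⟦ 3 ⟧ * (N * N) - ⟦ 23 ⟧ * N + ⟦ 24 ⟧) (sym N≡)))
      (0≤+ (0≤* (0≤ℚ[] 3) s²) (0≤+ (0≤* (0≤ℚ[] 19) s≥0) (0≤ℚ[] 10)))))
      where
      shift : ∀ s → ⟦ 3 ⟧ * (s * s) + (⟦ 19 ⟧ * s + ⟦ 10 ⟧) ≡ ⟦ 3 ⟧ * ((⟦ 7 ⟧ + s) * (⟦ 7 ⟧ + s)) - ⟦ 23 ⟧ * (⟦ 7 ⟧ + s) + ⟦ 24 ⟧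
      shift = solve-∀ ℚ-ring
      sum-of-gaps : ∀ N y → ⟦ 20 ⟧ * N - ⟦ 2 ⟧ * N * N - ⟦ 24 ⟧ - y + (⟦ 3 ⟧ * (N * N) - ⟦ 23 ⟧ * N + ⟦ 24 ⟧) ≡ (N * N - ⟦ 3 ⟧ * N) - y
      sum-of-gaps = solve-∀ ℚ-ring
    quartic : ⟦ 3 ⟧ * (N * N * (N * N)) - ⟦ 38 ⟧ * (N * (N * N)) + ⟦ 161 ⟧ * (N * N) - ⟦ 238 ⟧ * N + ⟦ 48 ⟧
      ≡ ⟦ 3 ⟧ * (s * s * (s * s)) + (⟦ 46 ⟧ * (s * (s * s)) + (⟦ 245 ⟧ * (s * s) + (⟦ 546 ⟧ * s + ⟦ 440 ⟧)))
    quartic = trans (cong (λ N → ⟦ 3 ⟧ * (N * N * (N * N)) - ⟦ 38 ⟧ * (N * (N * N)) + ⟦ 161 ⟧ * (N * N) - ⟦ 238 ⟧ * N + ⟦ 48 ⟧) N≡) (shift s)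
      where
      shift : ∀ s → ⟦ 3 ⟧ * ((⟦ 7 ⟧ + s) * (⟦ 7 ⟧ + s) * ((⟦ 7 ⟧ + s) * (⟦ 7 ⟧ + s))) - ⟦ 38 ⟧ * ((⟦ 7 ⟧ + s) * ((⟦ 7 ⟧ + s) * (⟦ 7 ⟧ + s)))
          + ⟦ 161 ⟧ * ((⟦ 7 ⟧ + s) * (⟦ 7 ⟧ + s)) - ⟦ 238 ⟧ * (⟦ 7 ⟧ + s) + ⟦ 48 ⟧
        ≡ ⟦ 3 ⟧ * (s * s * (s * s)) + (⟦ 46 ⟧ * (s * (s * s)) + (⟦ 245 ⟧ * (s * s) + (⟦ 546 ⟧ * s + ⟦ 440 ⟧)))
      shift = solve-∀ ℚ-ring
    quartic≥0 : 0ℚ ≤ℚ ⟦ 3 ⟧ * (s * s * (s * s)) + (⟦ 46 ⟧ * (s * (s * s)) + (⟦ 245 ⟧ * (s * s) + (⟦ 546 ⟧ * s + ⟦ 440 ⟧)))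
    quartic≥0 = 0≤+ (0≤* (0≤ℚ[] 3) (0≤* s² s²)) (0≤+ (0≤* (0≤ℚ[] 46) (0≤* s≥0 s²)) (0≤+ (0≤* (0≤ℚ[] 245) s²) (0≤+ (0≤* (0≤ℚ[] 546) s≥0) (0≤ℚ[] 440))))
    lem : ∀ N y →
      ((N * N - ⟦ 3 ⟧ * N) - y) * (y - (⟦ 3 ⟧ * N - N * N))
      + ((N - ⟦ 7 ⟧ + (N - ⟦ 7 ⟧)) * ((N * N - ⟦ 3 ⟧ * N) - y)
      + (⟦ 3 ⟧ * (N * N * (N * N)) - ⟦ 38 ⟧ * (N * (N * N)) + ⟦ 161 ⟧ * (N * N) - ⟦ 238 ⟧ * N + ⟦ 48 ⟧))
      ≡ ⟦ 4 ⟧ * N * N * N * N - ⟦ 40 ⟧ * N * N * N + ⟦ 132 ⟧ * N * N - ⟦ 160 ⟧ * N + ⟦ 48 ⟧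
        - (y * y + (⟦ 2 ⟧ * N - ⟦ 14 ⟧) * y + ⟦ 2 ⟧ * (N * (N * N)) - ⟦ 18 ⟧ * (N * N) + ⟦ 36 ⟧ * N)
    lem = solve-∀ ℚ-ring

  -- Here `rest` is 384 + 2 y - y², where 384 is the value of `bound₈`; it equals (20 - y)(y + 18) +
  -- 24, and -18 is the lower end of the range of y.
  at-six : N ≡ ⟦ 6 ⟧ → 0ℚ ≤ℚ ⟦ 20 ⟧ - y → 0ℚ ≤ℚ bound₈ N - value₈ N y q
  at-six refl h = from-rest (subst (0ℚ ≤ℚ_) (lem y) (0≤+ (0≤* h lower) (0≤ℚ[] 24)))
    where
    lem : ∀ y → (⟦ 20 ⟧ - y) * (y - - ⟦ 18 ⟧) + ⟦ 24 ⟧ ≡ ⟦ 384 ⟧ - (y * y + - ⟦ 2 ⟧ * y + ⟦ 432 ⟧ - ⟦ 648 ⟧ + ⟦ 216 ⟧)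
    lem = solve-∀ ℚ-ring

-- The range of y at n = 6 and the bound for all shapes

compositions : ℕ → List (List ℕ)
compositions zero = [] ∷ []
compositions (suc n) = map (1 ∷_) (compositions n) ++ map bump (compositions n)
  where
  bump : List ℕ → List ℕ
  -- This default puts some lists with a wrong sum into the enumeration. Only a list containing all
  -- partitions is needed, and the check at 6 is made on every entry.
  bump [] = []
  bump (x ∷ xs) = suc x ∷ xs

∈compositions : ∀ n ν → All (λ p → 1 ℕ.≤ p) ν → sum ν ≡ n → ν ∈ compositions n
∈compositions zero [] _ _ = here refl
∈compositions zero (suc x ∷ ν) _ ()
∈compositions zero (zero ∷ ν) (() ∷ _) _
∈compositions (suc n) [] _ ()
∈compositions (suc n) (zero ∷ ν) (() ∷ _) _
∈compositions (suc n) (suc zero ∷ ν) (_ ∷ h) e = ∈-++⁺ˡ (∈-map⁺ (1 ∷_) (∈compositions n ν h (ℕₚ.suc-injective e)))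
∈compositions (suc n) (suc (suc x) ∷ ν) (_ ∷ h) e =
  ∈-++⁺ʳ (map (1 ∷_) (compositions n)) (∈-map⁺ _ (∈compositions n (suc x ∷ ν) (ℕ.s≤s ℕ.z≤n ∷ h) (ℕₚ.suc-injective e)))

-- A form of y that evaluates on closed shapes, which the abstract `∑`, `r` and `k` do not.
content : ℕ → List ℕ → ℚ
content n ν = ⟦ 2 ⟧ * Σℚ (allFin n) (λ a → Σℚ (allFin n) (λ b → rℕ ν (toℕ a) (toℕ b)))
            - Σℚ (allFin n) (λ a → Σℚ (allFin n) (λ b → kℕ ν (toℕ a) (toℕ b)))

y≡content : ∀ n ν (D : Shape.IsDiagram n ν) → Bounds.y n ν D ≡ content n ν
y≡content n ν D = cong₂ (λ u v → ⟦ 2 ⟧ * u - v)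
  (trans (∑-def _) (Σ-cong (allFin n) (λ a → trans (∑-def _) (Σ-cong (allFin n) (λ b → r≡ n ν a b)))))
  (trans (∑-def _) (Σ-cong (allFin n) (λ a → trans (∑-def _) (Σ-cong (allFin n) (λ b → k≡ n ν a b)))))

-- The estimates fail for y strictly between 20 and 24, which no partition of 6 attains.
gap-at-six : All (λ ν → (0ℚ ≤ℚ ⟦ 20 ⟧ - content 6 ν) ⊎ (0ℚ ≤ℚ content 6 ν - ⟦ 24 ⟧)) (compositions 6)
gap-at-six = from-yes (all? (λ ν → (0ℚ ℚₚ.≤? (⟦ 20 ⟧ - content 6 ν)) ⊎-dec (0ℚ ℚₚ.≤? (content 6 ν - ⟦ 24 ⟧))) (compositions 6))

two-rows : ∀ n ν → 1 ℕ.≤ n → ν ⊢ n → ν ≢ n ∷ [] → ∃ λ r → ∃ λ r' → ∃ λ rs → ν ≡ r ∷ r' ∷ rs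
two-rows n [] n≥1 (_ , _ , e) _ = ⊥-elim (ℕₚ.<⇒≢ n≥1 e)
two-rows n (r ∷ []) _ (_ , _ , e) h = ⊥-elim (h (cong (_∷ []) (trans (sym (ℕₚ.+-identityʳ r)) e)))
two-rows n (r ∷ r' ∷ rs) _ _ _ = r , r' , rs , refl

value≤bound : ∀ j → 2 ℕ.≤ j → ∀ ν (ν⊢ : ν ⊢ (4 ℕ.+ j)) → ν ≢ (4 ℕ.+ j) ∷ [] →
  0ℚ ≤ℚ bound₈ ℚ[ 4 ℕ.+ j ] - Eigenvalue.eightfold j ν ν⊢
value≤bound j j≥2 ν ν⊢ ν≢ = by-size j j≥2 refl
  where
  n = 4 ℕ.+ j
  D = Eigenvalue.D₁ j ν ν⊢
  module B = Bounds n ν D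
  upper : 0ℚ ≤ℚ ⟦ 2 ⟧ * (ℚ[ n ] - 1ℚ) * (ℚ[ n ] - 1ℚ) - B.y
  upper with two-rows n ν (ℕ.s≤s ℕ.z≤n) ν⊢ ν≢
  -- The two cells of one column are the first cell of the first row and the one below it, whose
  -- number is the length of the first row.
  upper | suc r , suc r' , rs , refl = B.y-upper {F.zero} {x₁} rows cols
    where
    lt : suc r ℕ.< n
    lt = subst (suc r ℕ.<_) (proj₂ (proj₂ ν⊢)) (ℕₚ.m<m+n (suc r) (ℕ.s≤s ℕ.z≤n))
    x₁ : Fin n
    x₁ = F.fromℕ< lt
    at : toℕ x₁ ≡ suc r ℕ.+ 0
    at = trans (Fₚ.toℕ-fromℕ< lt) (sym (ℕₚ.+-identityʳ (suc r)))
    rows : 0 ≢ rowOf ν (toℕ x₁)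
    rows h = case trans h (trans (cong (rowOf ν) at) (rowOf-below (suc r) (suc r' ∷ rs) 0)) of λ ()
    cols : 0 ≡ colOf ν (toℕ x₁)
    cols = sym (trans (cong (colOf ν) at) (colOf-below (suc r) (suc r' ∷ rs) 0))
  upper | zero , _ , _ , refl = case proj₁ (proj₂ ν⊢) of λ { (() ∷ _) }
  upper | suc _ , zero , _ , refl = case proj₁ (proj₂ ν⊢) of λ { (_ ∷ () ∷ _) }
  module Q = Quartic {ℚ[ n ]} {B.y} {B.q} B.lower-bound₁ B.lower-bound₂ B.y-lower upper
  Goal : Set
  Goal = 0ℚ ≤ℚ bound₈ ℚ[ n ] - value₈ ℚ[ n ] B.y B.q
  at-six : j ≡ 2 → Goal
  at-six j≡2 = [ (λ h → Q.at-six N≡6 (subst (λ x → 0ℚ ≤ℚ ⟦ 20 ⟧ - x) (sym y≡) h))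
               , (λ h → Q.above-root (subst₂ (λ x N → 0ℚ ≤ℚ x - (⟦ 20 ⟧ * N - ⟦ 2 ⟧ * N * N - ⟦ 24 ⟧)) (sym y≡) (sym N≡6) h)) ]′
    (All.lookup gap-at-six (∈compositions 6 ν (proj₁ (proj₂ ν⊢)) (trans (proj₂ (proj₂ ν⊢)) n≡6)))
    where
    n≡6 : n ≡ 6
    n≡6 = cong (4 ℕ.+_) j≡2
    N≡6 : ℚ[ n ] ≡ ⟦ 6 ⟧
    N≡6 = cong ℚ[_] n≡6
    y≡ : B.y ≡ content 6 ν
    y≡ = trans (y≡content n ν D) (cong (λ k → content k ν) n≡6)
  beyond-six : ∀ i → j ≡ 3 ℕ.+ i → Goal
  beyond-six i e = [ (λ h → Q.above-root (p≤q⇒0≤q-p h))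
                   , (λ h → Q.below-root ℚ[ i ] (trans (cong (λ k → ℚ[ 4 ℕ.+ k ]) e) (ℚ[]-+ 7 i)) (0≤ℚ[] i) (p≤q⇒0≤q-p h)) ]′
    (ℚₚ.≤-total Q.root B.y)
  by-size : ∀ j' → 2 ℕ.≤ j' → j ≡ j' → Goal
  by-size (suc (suc zero)) _ = at-six
  by-size (suc (suc (suc i))) _ = beyond-six i
  by-size (suc zero) (ℕ.s≤s ())

-- The shapes [n] and [n - 1, 1]

module OneRow (n : ℕ) (D : Shape.IsDiagram n (n ∷ [])) where

  open Shape n (n ∷ []) using (row; col; r; k; r-yes)
  open Diagram n (n ∷ []) D using (row₂; col₂; row₃; col₃; hook; k-row)

  private
    N : ℚ
    N = ℚ[ n ]

    same-row : ∀ a b → row a ≡ row b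
    same-row a b = trans (rowOf-inside n [] (Fₚ.toℕ<n a)) (sym (rowOf-inside n [] (Fₚ.toℕ<n b)))

    r≡1 : ∀ a b → r a b ≡ 1ℚ
    r≡1 a b = r-yes (same-row a b)

    k≡0 : ∀ a b → k a b ≡ 0ℚ
    k≡0 a b = k-row (same-row a b)

    const¹ : ∀ c → ∑ {n} (λ _ → c) ≡ N * c
    const¹ = ∑-const

    const² : ∀ c → ∑ {n} (λ _ → ∑ {n} (λ _ → c)) ≡ N * (N * c)
    const² c = trans (∑-cong {n} (λ _ → const¹ c)) (const¹ (N * c))

    const³ : ∀ c → ∑ {n} (λ _ → ∑ {n} (λ _ → ∑ {n} (λ _ → c))) ≡ N * (N * (N * c))
    const³ c = trans (∑-cong {n} (λ _ → const² c)) (const¹ (N * (N * c)))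

  value : value₈ N (Bounds.y n (n ∷ []) D) (Bounds.q n (n ∷ []) D) ≡
    ⟦ 4 ⟧ * N * N * N * N - ⟦ 24 ⟧ * N * N * N + ⟦ 44 ⟧ * N * N - ⟦ 24 ⟧ * N
  value = trans (cong₂ (value₈ N)
      (cong₂ (λ u v → ⟦ 2 ⟧ * u - v)
        (trans (∑-cong (λ a → ∑-cong (λ b → r≡1 a b))) (const² 1ℚ))
        (trans (∑-cong (λ a → ∑-cong (λ b → k≡0 a b))) (const² 0ℚ)))
      (cong₂ _-_ (cong₂ (λ u v → ⟦ 8 ⟧ * u + ⟦ 2 ⟧ * v)
        (trans (∑³-cong (λ a b c → cong₂ _*_ (r≡1 a b) (r≡1 b c))) (const³ (1ℚ * 1ℚ)))
        (trans (∑³-cong (λ a b c → cong₂ _*_ (cong₂ _*_ (k≡0 a b) (k≡0 b c)) (k≡0 c a))) (const³ (0ℚ * 0ℚ * 0ℚ))))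
        (cong (⟦ 12 ⟧ *_) (trans (∑³-cong (λ a b c → cong₂ _*_ (r≡1 a b) (k≡0 b c))) (const³ (1ℚ * 0ℚ))))))
    (lem N)
    where
    lem : ∀ N → (⟦ 2 ⟧ * (N * (N * 1ℚ)) - N * (N * 0ℚ)) * (⟦ 2 ⟧ * (N * (N * 1ℚ)) - N * (N * 0ℚ))
        - (⟦ 4 ⟧ * N - ⟦ 22 ⟧) * (⟦ 2 ⟧ * (N * (N * 1ℚ)) - N * (N * 0ℚ))
        - ⟦ 2 ⟧ * (⟦ 8 ⟧ * (N * (N * (N * (1ℚ * 1ℚ)))) + ⟦ 2 ⟧ * (N * (N * (N * (0ℚ * 0ℚ * 0ℚ)))) - ⟦ 12 ⟧ * (N * (N * (N * (1ℚ * 0ℚ)))))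
        - ⟦ 24 ⟧ * N
      ≡ ⟦ 4 ⟧ * N * N * N * N - ⟦ 24 ⟧ * N * N * N + ⟦ 44 ⟧ * N * N - ⟦ 24 ⟧ * N
    lem = solve-∀ ℚ-ring

-- The shape [l + 1, 1]: `last` is the cell of the second row and `first` the cell above it.
module NearRow (l : ℕ) (D : Shape.IsDiagram (2 ℕ.+ l) (suc l ∷ 1 ∷ [])) where

  private
    n : ℕ
    n = 2 ℕ.+ l
    ν : List ℕ
    ν = suc l ∷ 1 ∷ []
    N : ℚ
    N = ℚ[ n ]

  open Shape n ν using (row; col; r; k; r-yes; r-no; k-yes; k-no)
  open Diagram n ν D using (row₂; col₂; row₃; col₃; hook; k-row)

  private
    first last : Fin n
    first = F.zero
    last = F.fromℕ (suc l)

    first≢last : first ≢ last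
    first≢last ()

    row-last : row last ≡ 1
    row-last = trans (cong (rowOf ν) (trans (Fₚ.toℕ-fromℕ (suc l)) (sym (ℕₚ.+-identityʳ (suc l))))) (rowOf-below (suc l) (1 ∷ []) 0)

    col-last : col last ≡ 0
    col-last = trans (cong (colOf ν) (trans (Fₚ.toℕ-fromℕ (suc l)) (sym (ℕₚ.+-identityʳ (suc l))))) (colOf-below (suc l) (1 ∷ []) 0)

    <last : ∀ {a} → a ≢ last → toℕ a ℕ.< suc l
    <last {a} h = ℕₚ.≤∧≢⇒< (ℕₚ.≤-pred (Fₚ.toℕ<n a)) (λ e → h (Fₚ.toℕ-injective (trans e (sym (Fₚ.toℕ-fromℕ (suc l))))))

    row-other : ∀ {a} → a ≢ last → row a ≡ 0
    row-other h = rowOf-inside (suc l) (1 ∷ []) (<last h)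

    col-other : ∀ {a} → a ≢ last → col a ≡ toℕ a
    col-other h = colOf-inside (suc l) (1 ∷ []) (<last h)

    δ φ : Fin n → ℚ
    δ a = 𝟙 (a ==ᶠ last)
    φ a = 𝟙 (a ==ᶠ first)

    -- Two cells share a row exactly if both or neither of them is `last`. As a polynomial in
    -- indicators the relation can be summed termwise.
    r-form : ∀ a b → r a b ≡ 1ℚ - δ a - δ b + ⟦ 2 ⟧ * (δ a * δ b)
    r-form a b with a ≟ᶠ last | b ≟ᶠ last
    ... | yes refl | yes refl rewrite r-yes {last} {last} refl = refl
    ... | yes refl | no n rewrite r-no {last} {b} (λ e → case trans (sym row-last) (trans e (row-other n)) of λ ()) = refl
    ... | no n | yes refl rewrite r-no {a} {last} (λ e → case trans (sym (row-other n)) (trans e row-last) of λ ()) = refl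
    ... | no n | no n' rewrite r-yes {a} {b} (trans (row-other n) (sym (row-other n'))) = refl

    -- The first column {first, last} is the only one with two cells.
    k-form : ∀ a b → k a b ≡ φ a * δ b + δ a * φ b
    k-form a b with a ≟ᶠ last | b ≟ᶠ last
    ... | yes refl | yes refl rewrite k-row {last} {last} refl | ==ᶠ-≢ (first≢last ∘ sym) = refl
    ... | no n | no n' rewrite k-row {a} {b} (trans (row-other n) (sym (row-other n'))) = lem (φ a) (φ b)
      where
      lem : ∀ x y → 0ℚ ≡ x * 0ℚ + 0ℚ * y
      lem = solve-∀ ℚ-ring
    ... | yes refl | no n with b ≟ᶠ first
    ... | yes refl rewrite k-yes {last} {first} col-last (first≢last ∘ sym) | ==ᶠ-≢ (first≢last ∘ sym) = refl
    ... | no n' rewrite k-no {last} {b} (λ e → n' (Fₚ.toℕ-injective (trans (sym (col-other n)) (trans (sym e) col-last)))) = lem (φ last)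
      where
      lem : ∀ x → 0ℚ ≡ x * 0ℚ + 1ℚ * 0ℚ
      lem = solve-∀ ℚ-ring
    k-form a b | no n | yes refl with a ≟ᶠ first
    ... | yes refl rewrite k-yes {first} {last} (sym col-last) first≢last = refl
    ... | no n' rewrite k-no {a} {last} (λ e → n' (Fₚ.toℕ-injective (trans (sym (col-other n)) (trans e col-last)))) = lem (φ last)
      where
      lem : ∀ x → 0ℚ ≡ 0ℚ * 1ℚ + 0ℚ * x
      lem = solve-∀ ℚ-ring

    ∑δ : (f : Fin n → ℚ) → ∑ (λ a → δ a * f a) ≡ f last
    ∑δ = ∑-δ last

    ∑φ : (f : Fin n → ℚ) → ∑ (λ a → φ a * f a) ≡ f first
    ∑φ = ∑-δ first

    ∑r : ∀ a (f : Fin n → ℚ) → ∑ (λ b → r a b * f b) ≡ ∑ f - δ a * ∑ f - f last + ⟦ 2 ⟧ * (δ a * f last)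
    ∑r a f = begin
      ∑ (λ b → r a b * f b) ≡⟨ ∑-cong (λ b → trans (cong (_* f b) (r-form a b)) (lem (δ a) (δ b) (f b))) ⟩
      ∑ (λ b → f b - δ a * f b - δ b * f b + ⟦ 2 ⟧ * δ a * (δ b * f b))
        ≡⟨ trans (∑-+ (λ b → f b - δ a * f b - δ b * f b) (λ b → ⟦ 2 ⟧ * δ a * (δ b * f b)))
             (cong₂ _+_ (trans (∑-- (λ b → f b - δ a * f b) (λ b → δ b * f b)) (cong₂ _-_ (trans (∑-- f (λ b → δ a * f b)) (cong (λ t → ∑ f - t) (∑-*ˡ (δ a) f))) (∑δ f)))
               (trans (∑-*ˡ (⟦ 2 ⟧ * δ a) (λ b → δ b * f b)) (trans (cong (⟦ 2 ⟧ * δ a *_) (∑δ f)) (ℚₚ.*-assoc ⟦ 2 ⟧ (δ a) (f last))))) ⟩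
      ∑ f - δ a * ∑ f - f last + ⟦ 2 ⟧ * (δ a * f last) ∎
      where
      lem : ∀ d e f → (1ℚ - d - e + ⟦ 2 ⟧ * (d * e)) * f ≡ f - d * f - e * f + ⟦ 2 ⟧ * d * (e * f)
      lem = solve-∀ ℚ-ring

    ∑1 : ∑ {n} (λ _ → 1ℚ) ≡ N
    ∑1 = trans (∑-const 1ℚ) (ℚₚ.*-identityʳ N)

    δ-last : δ last ≡ 1ℚ
    δ-last = cong 𝟙 (==ᶠ-refl last)

    ρ : Fin n → ℚ
    ρ a = N - 1ℚ - (N - ⟦ 2 ⟧) * δ a

    row-length : ∀ a → ∑ (r a) ≡ ρ a
    row-length a = trans (∑-cong (λ b → sym (ℚₚ.*-identityʳ (r a b)))) (trans (∑r a (λ _ → 1ℚ)) (trans (cong (λ s → s - δ a * s - 1ℚ + ⟦ 2 ⟧ * (δ a * 1ℚ)) ∑1) (lem (δ a) N)))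
      where
      lem : ∀ d n → n - d * n - 1ℚ + ⟦ 2 ⟧ * (d * 1ℚ) ≡ n - 1ℚ - (n - ⟦ 2 ⟧) * d
      lem = solve-∀ ℚ-ring

    ρ-last : ρ last ≡ 1ℚ
    ρ-last = trans (cong (λ d → N - 1ℚ - (N - ⟦ 2 ⟧) * d) δ-last) (lem N)
      where
      lem : ∀ n → n - 1ℚ - (n - ⟦ 2 ⟧) * 1ℚ ≡ 1ℚ
      lem = solve-∀ ℚ-ring

    ∑δ′ : (f : ℚ) → ∑ (λ a → δ a * f) ≡ f
    ∑δ′ f = ∑δ (λ _ → f)

    ∑ρ : ∑ ρ ≡ (N - 1ℚ) * (N - 1ℚ) + 1ℚ
    ∑ρ = trans (∑-- (λ _ → N - 1ℚ) (λ a → (N - ⟦ 2 ⟧) * δ a)) (trans (cong₂ _-_ (∑-const (N - 1ℚ)) (trans (∑-cong (λ a → ℚₚ.*-comm (N - ⟦ 2 ⟧) (δ a))) (∑δ′ (N - ⟦ 2 ⟧)))) (lem N))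
      where
      lem : ∀ n → n * (n - 1ℚ) - (n - ⟦ 2 ⟧) ≡ (n - 1ℚ) * (n - 1ℚ) + 1ℚ
      lem = solve-∀ ℚ-ring

    row₂≡ : row₂ ≡ (N - 1ℚ) * (N - 1ℚ) + 1ℚ
    row₂≡ = trans (∑-cong row-length) ∑ρ

    row₃≡ : row₃ ≡ (N - 1ℚ) * (N - 1ℚ) * (N - 1ℚ) + 1ℚ
    row₃≡ = begin
      row₃ ≡⟨ ∑-cong (λ a → trans (∑-cong (λ b → trans (∑-*ˡ (r a b) (r b)) (cong (r a b *_) (row-length b)))) (∑r a ρ)) ⟩
      ∑ (λ a → ∑ ρ - δ a * ∑ ρ - ρ last + ⟦ 2 ⟧ * (δ a * ρ last))
        ≡⟨ ∑-cong (λ a → trans (cong₂ (λ s t → s - δ a * s - t + ⟦ 2 ⟧ * (δ a * t)) ∑ρ ρ-last) (lem (δ a) N)) ⟩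
      ∑ (λ a → (N - 1ℚ) * (N - 1ℚ) + δ a * (1ℚ - (N - 1ℚ) * (N - 1ℚ)))
        ≡⟨ trans (∑-+ (λ _ → (N - 1ℚ) * (N - 1ℚ)) (λ a → δ a * (1ℚ - (N - 1ℚ) * (N - 1ℚ)))) (cong₂ _+_ (∑-const ((N - 1ℚ) * (N - 1ℚ))) (∑δ′ (1ℚ - (N - 1ℚ) * (N - 1ℚ)))) ⟩
      N * ((N - 1ℚ) * (N - 1ℚ)) + (1ℚ - (N - 1ℚ) * (N - 1ℚ)) ≡⟨ lem' N ⟩
      (N - 1ℚ) * (N - 1ℚ) * (N - 1ℚ) + 1ℚ ∎
      where
      lem : ∀ d n → ((n - 1ℚ) * (n - 1ℚ) + 1ℚ) - d * ((n - 1ℚ) * (n - 1ℚ) + 1ℚ) - 1ℚ + ⟦ 2 ⟧ * (d * 1ℚ) ≡ (n - 1ℚ) * (n - 1ℚ) + d * (1ℚ - (n - 1ℚ) * (n - 1ℚ))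
      lem = solve-∀ ℚ-ring
      lem' : ∀ n → n * ((n - 1ℚ) * (n - 1ℚ)) + (1ℚ - (n - 1ℚ) * (n - 1ℚ)) ≡ (n - 1ℚ) * (n - 1ℚ) * (n - 1ℚ) + 1ℚ
      lem' = solve-∀ ℚ-ring

    δφ : ∀ a → δ a * φ a ≡ 0ℚ
    δφ a with a ≟ᶠ first
    ... | yes refl = refl
    ... | no _ = ℚₚ.*-zeroʳ (δ a)

    col₃≡ : col₃ ≡ 0ℚ
    col₃≡ = trans (∑³-cong (λ a b c → trans (cong₂ _*_ (cong₂ _*_ (k-form a b) (k-form b c)) (k-form c a)) (vanish a b c)))
      (trans (∑-cong {n} (λ a → trans (∑-cong {n} (λ b → ∑0)) ∑0)) ∑0)
      where
      ∑0 : ∑ {n} (λ _ → 0ℚ) ≡ 0ℚ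
      ∑0 = trans (∑-const {n} 0ℚ) (ℚₚ.*-zeroʳ N)
      -- Three cells cannot alternate between `first` and `last` around a triangle, so every
      -- monomial contains both indicators of one and the same cell.
      vanish : ∀ a b c → (φ a * δ b + δ a * φ b) * (φ b * δ c + δ b * φ c) * (φ c * δ a + δ c * φ a) ≡ 0ℚ
      vanish a b c = trans (lem (δ a) (φ a) (δ b) (φ b) (δ c) (φ c)) (trans
          (cong₂ (λ u v → u * A + v) (δφ a) (cong₂ (λ u v → u * B + v * C) (δφ b) (δφ c))) (zeros A B C))
        where
        A = ⟦ 2 ⟧ * (δ b * φ b) * (δ c * φ c) + δ b * δ b * φ c * φ c + φ b * φ b * δ c * δ c
        B = φ a * φ a * δ c * δ c + δ a * δ a * φ c * φ c
        C = φ a * φ a * δ b * δ b + δ a * δ a * φ b * φ b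
        lem : ∀ x x' y y' z z' → (x' * y + x * y') * (y' * z + y * z') * (z' * x + z * x') ≡
          x * x' * (⟦ 2 ⟧ * (y * y') * (z * z') + y * y * z' * z' + y' * y' * z * z)
          + (y * y' * (x' * x' * z * z + x * x * z' * z') + z * z' * (x' * x' * y * y + x * x * y' * y'))
        lem = solve-∀ ℚ-ring
        zeros : ∀ u v w → 0ℚ * u + (0ℚ * v + 0ℚ * w) ≡ 0ℚ
        zeros = solve-∀ ℚ-ring

    κ : Fin n → ℚ
    κ a = φ a + δ a

    column-length : ∀ a → ∑ (k a) ≡ κ a
    column-length a = trans (∑-cong (λ b → trans (k-form a b) (lem (φ a) (δ b) (δ a) (φ b))))
      (trans (∑-+ (λ b → δ b * φ a) (λ b → φ b * δ a)) (cong₂ _+_ (∑δ (λ _ → φ a)) (∑φ (λ _ → δ a))))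
      where
      lem : ∀ x y u v → x * y + u * v ≡ y * x + v * u
      lem = solve-∀ ℚ-ring

    ∑κ : ∑ κ ≡ ⟦ 2 ⟧
    ∑κ = trans (∑-cong (λ a → cong₂ _+_ (sym (ℚₚ.*-identityʳ (φ a))) (sym (ℚₚ.*-identityʳ (δ a)))))
      (trans (∑-+ (λ a → φ a * 1ℚ) (λ a → δ a * 1ℚ)) (cong₂ _+_ (∑φ (λ _ → 1ℚ)) (∑δ (λ _ → 1ℚ))))

    col₂≡ : col₂ ≡ ⟦ 2 ⟧
    col₂≡ = trans (∑-cong column-length) ∑κ

    κ-last : κ last ≡ 1ℚ
    κ-last = cong₂ _+_ (cong 𝟙 (==ᶠ-≢ (first≢last ∘ sym))) δ-last

    hook≡ : hook ≡ N
    hook≡ = begin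
      hook ≡⟨ ∑-cong (λ a → trans (∑-cong (λ b → trans (∑-*ˡ (r a b) (k b)) (cong (r a b *_) (column-length b)))) (∑r a κ)) ⟩
      ∑ (λ a → ∑ κ - δ a * ∑ κ - κ last + ⟦ 2 ⟧ * (δ a * κ last))
        ≡⟨ ∑-cong (λ a → trans (cong₂ (λ s t → s - δ a * s - t + ⟦ 2 ⟧ * (δ a * t)) ∑κ κ-last) (lem (δ a))) ⟩
      ∑ {n} (λ _ → 1ℚ) ≡⟨ ∑1 ⟩
      N ∎
      where
      lem : ∀ d → ⟦ 2 ⟧ - d * ⟦ 2 ⟧ - 1ℚ + ⟦ 2 ⟧ * (d * 1ℚ) ≡ 1ℚ
      lem = solve-∀ ℚ-ring

  value : value₈ N (Bounds.y n ν D) (Bounds.q n ν D) ≡ bound₈ N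
  value = trans (cong₂ (value₈ N) (cong₂ (λ u v → ⟦ 2 ⟧ * u - v) row₂≡ col₂≡)
      (cong₂ _-_ (cong₂ (λ u v → ⟦ 8 ⟧ * u + ⟦ 2 ⟧ * v) row₃≡ col₃≡) (cong (⟦ 12 ⟧ *_) hook≡)))
    (lem N)
    where
    lem : ∀ N → (⟦ 2 ⟧ * ((N - 1ℚ) * (N - 1ℚ) + 1ℚ) - ⟦ 2 ⟧) * (⟦ 2 ⟧ * ((N - 1ℚ) * (N - 1ℚ) + 1ℚ) - ⟦ 2 ⟧)
        - (⟦ 4 ⟧ * N - ⟦ 22 ⟧) * (⟦ 2 ⟧ * ((N - 1ℚ) * (N - 1ℚ) + 1ℚ) - ⟦ 2 ⟧)
        - ⟦ 2 ⟧ * (⟦ 8 ⟧ * ((N - 1ℚ) * (N - 1ℚ) * (N - 1ℚ) + 1ℚ) + ⟦ 2 ⟧ * 0ℚ - ⟦ 12 ⟧ * N) - ⟦ 24 ⟧ * N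
      ≡ ⟦ 4 ⟧ * N * N * N * N - ⟦ 40 ⟧ * N * N * N + ⟦ 132 ⟧ * N * N - ⟦ 160 ⟧ * N + ⟦ 48 ⟧
    lem = solve-∀ ℚ-ring

-- A nonzero vector in the eigenspace of [n-1,1]

identity : ∀ m → Perm m
identity m = V.allFin m

module _ {m : ℕ} where

  lookup-identity : (i : Fin m) → lookup (identity m) i ≡ i
  lookup-identity = Vₚ.lookup-allFin

  identity-isPerm : IsPerm (identity m)
  identity-isPerm = record
    { inj = λ {i} {j} e → trans (sym (lookup-identity i)) (trans e (lookup-identity j))
    ; surj = λ i → i , lookup-identity i }

  act-identity : (P : Perm m) → act (identity m) P ≡ P
  act-identity P = act-unique identity-isPerm λ i → trans (cong (lookup P) (lookup-identity i)) (sym (lookup-identity (lookup P i)))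

  sgn-identity : sgn (identity m) ≡ 1ℚ
  sgn-identity = cong (λ k → evenSign (even k)) (ℚ[]-injective {inversions (identity m)} {0} (begin
    ℚ[ inversions (identity m) ] ≡⟨ ℚ-inversions (identity m) ⟩
    _ ≡⟨ Σ-cong (allFin m) (λ i → trans (Σ-cong (allFin m) (λ j → cong 𝟙 (no-inversion i j))) (Σ-0 (allFin m))) ⟩
    Σℚ (allFin m) (λ _ → 0ℚ) ≡⟨ Σ-0 (allFin m) ⟩
    0ℚ ∎))
    where
    asym : ∀ a b → ((a <ᵇ b) ∧ (b <ᵇ a)) ≡ false
    asym zero zero = refl
    asym zero (suc b) = refl
    asym (suc a) zero = refl
    asym (suc a) (suc b) = asym a b
    no-inversion : ∀ i j → inv-pair (identity m) i j ≡ false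
    no-inversion i j = trans (cong₂ (λ x y → (toℕ i <ᵇ toℕ j) ∧ (toℕ x <ᵇ toℕ y)) (lookup-identity j) (lookup-identity i)) (asym (toℕ i) (toℕ j))

mate : ℕ → ℕ
mate zero = 1
mate (suc zero) = 0
mate (suc (suc k)) = suc (suc (mate k))

mate-involutive : ∀ k → mate (mate k) ≡ k
mate-involutive zero = refl
mate-involutive (suc zero) = refl
mate-involutive (suc (suc k)) = cong (λ x → suc (suc x)) (mate-involutive k)

mate-≢ : ∀ k → mate k ≢ k
mate-≢ zero ()
mate-≢ (suc zero) ()
mate-≢ (suc (suc k)) e = mate-≢ k (ℕₚ.suc-injective (ℕₚ.suc-injective e))

mate-< : ∀ n k → k ℕ.< 2 ℕ.* n → mate k ℕ.< 2 ℕ.* n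
mate-< zero k ()
mate-< (suc n) k lt = subst (mate k ℕ.<_) (sym (ℕₚ.*-suc 2 n)) (step k (subst (k ℕ.<_) (ℕₚ.*-suc 2 n) lt))
  where
  step : ∀ k → k ℕ.< 2 ℕ.+ 2 ℕ.* n → mate k ℕ.< 2 ℕ.+ 2 ℕ.* n
  step zero _ = ℕ.s≤s (ℕ.s≤s ℕ.z≤n)
  step (suc zero) _ = ℕ.s≤s ℕ.z≤n
  step (suc (suc k)) (ℕ.s≤s (ℕ.s≤s lt)) = ℕ.s≤s (ℕ.s≤s (mate-< n k lt))

mate-double : ∀ x → mate (2 ℕ.* x) ≡ suc (2 ℕ.* x)
mate-double zero = refl
mate-double (suc x) = trans (cong mate (ℕₚ.*-suc 2 x)) (trans (cong (λ k → suc (suc k)) (mate-double x)) (cong suc (sym (ℕₚ.*-suc 2 x))))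

-- The shape [l, 2] is twice [n-1,1] for l = 2 (n - 1). The Young symmetrizer is applied to the
-- indicator of the edge formed by the second row. By `mate-l` this is an edge of the standard
-- matching `P₀`, where the result cannot cancel.
module Witness (m l : ℕ) (m≡ : m ≡ 2 ℕ.+ l) (1<l : 1 ℕ.< l) (mate-l : mate l ≡ suc l) (mate-<m : ∀ k → k ℕ.< m → mate k ℕ.< m) where

  ν : List ℕ
  ν = l ∷ 2 ∷ []

  open Shape m ν using (row; col; R; C; ∈stabilizer⁻; ∈stabilizer⁺)

  P₀ : Perm m
  P₀ = V.tabulate (λ i → F.fromℕ< (mate-<m (toℕ i) (Fₚ.toℕ<n i)))

  P₀-lookup : ∀ i → toℕ (lookup P₀ i) ≡ mate (toℕ i)
  P₀-lookup i = trans (cong toℕ (Vₚ.lookup∘tabulate _ i)) (Fₚ.toℕ-fromℕ< (mate-<m (toℕ i) (Fₚ.toℕ<n i)))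

  P₀-matching : IsMatching P₀
  P₀-matching = record
    { inv = λ i → Fₚ.toℕ-injective (trans (P₀-lookup (lookup P₀ i)) (trans (cong mate (P₀-lookup i)) (mate-involutive (toℕ i))))
    ; fpf = λ i e → mate-≢ (toℕ i) (trans (sym (P₀-lookup i)) (cong toℕ e)) }

  l<m : l ℕ.< m
  l<m = subst (l ℕ.<_) (sym m≡) (ℕₚ.m<n+m l {2} (ℕ.s≤s ℕ.z≤n))

  sl<m : suc l ℕ.< m
  sl<m = subst (suc l ℕ.<_) (sym m≡) ℕₚ.≤-refl

  0<l : 0 ℕ.< l
  0<l = ℕₚ.<-trans (ℕ.s≤s ℕ.z≤n) 1<l
  0<m : 0 ℕ.< m
  0<m = ℕₚ.<-trans 0<l l<m
  1<m : 1 ℕ.< m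
  1<m = ℕₚ.<-trans 1<l l<m

  -- ◰ and ◳ are the first two cells of the first row, ◱ and ◲ the cells of the second row below them.
  ◰ ◳ ◱ ◲ : Fin m
  ◰ = F.fromℕ< 0<m
  ◳ = F.fromℕ< 1<m
  ◱ = F.fromℕ< l<m
  ◲ = F.fromℕ< sl<m

  to-◰ : toℕ ◰ ≡ 0
  to-◰ = Fₚ.toℕ-fromℕ< 0<m
  to-◳ : toℕ ◳ ≡ 1
  to-◳ = Fₚ.toℕ-fromℕ< 1<m
  to-◱ : toℕ ◱ ≡ l
  to-◱ = Fₚ.toℕ-fromℕ< l<m
  to-◲ : toℕ ◲ ≡ suc l
  to-◲ = Fₚ.toℕ-fromℕ< sl<m

  P₀-◰ : lookup P₀ ◰ ≡ ◳
  P₀-◰ = Fₚ.toℕ-injective (trans (P₀-lookup ◰) (trans (cong mate to-◰) (sym to-◳)))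

  P₀-◱ : lookup P₀ ◱ ≡ ◲
  P₀-◱ = Fₚ.toℕ-injective (trans (P₀-lookup ◱) (trans (cong mate to-◱) (trans mate-l (sym to-◲))))

  data Position (i : Fin m) : Set where
    upper : toℕ i ℕ.< l → Position i
    lower-◱ : i ≡ ◱ → Position i
    lower-◲ : i ≡ ◲ → Position i

  position : ∀ i → Position i
  position i with ℕₚ.<-cmp (toℕ i) l
  ... | tri< lt _ _ = upper lt
  ... | tri≈ _ e _ = lower-◱ (Fₚ.toℕ-injective (trans e (sym to-◱)))
  ... | tri> _ _ gt = lower-◲ (Fₚ.toℕ-injective (trans (ℕₚ.≤-antisym (ℕₚ.≤-pred (subst (toℕ i ℕ.<_) m≡ (Fₚ.toℕ<n i))) gt) (sym to-◲)))

  row-upper : ∀ {i} → toℕ i ℕ.< l → row i ≡ 0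
  row-upper = rowOf-inside l (2 ∷ [])
  col-upper : ∀ {i} → toℕ i ℕ.< l → col i ≡ toℕ i
  col-upper = colOf-inside l (2 ∷ [])

  row-◱ : row ◱ ≡ 1
  row-◱ = trans (cong (rowOf ν) (trans to-◱ (sym (ℕₚ.+-identityʳ l)))) (rowOf-below l (2 ∷ []) 0)
  col-◱ : col ◱ ≡ 0
  col-◱ = trans (cong (colOf ν) (trans to-◱ (sym (ℕₚ.+-identityʳ l)))) (colOf-below l (2 ∷ []) 0)
  row-◲ : row ◲ ≡ 1
  row-◲ = trans (cong (rowOf ν) (trans to-◲ (sym (ℕₚ.+-comm l 1)))) (rowOf-below l (2 ∷ []) 1)
  col-◲ : col ◲ ≡ 1
  col-◲ = trans (cong (colOf ν) (trans to-◲ (sym (ℕₚ.+-comm l 1)))) (colOf-below l (2 ∷ []) 1)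

  row-one : ∀ {i} → row i ≡ 1 → i ≡ ◱ ⊎ i ≡ ◲
  row-one {i} h with position i
  ... | upper lt = case trans (sym h) (row-upper lt) of λ ()
  ... | lower-◱ e = inj₁ e
  ... | lower-◲ e = inj₂ e

  col-zero : ∀ {i} → col i ≡ 0 → i ≡ ◰ ⊎ i ≡ ◱
  col-zero {i} h with position i
  ... | upper lt = inj₁ (Fₚ.toℕ-injective (trans (sym (col-upper lt)) (trans h (sym to-◰))))
  ... | lower-◱ e = inj₂ e
  ... | lower-◲ refl = case trans (sym h) col-◲ of λ ()

  col-one : ∀ {i} → col i ≡ 1 → i ≡ ◳ ⊎ i ≡ ◲
  col-one {i} h with position i
  ... | upper lt = inj₁ (Fₚ.toℕ-injective (trans (sym (col-upper lt)) (trans h (sym to-◳))))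
  ... | lower-◱ refl = case trans (sym h) col-◱ of λ ()
  ... | lower-◲ e = inj₂ e

  col-alone : ∀ {i x} → i ≢ ◰ → i ≢ ◳ → i ≢ ◱ → i ≢ ◲ → col x ≡ col i → x ≡ i
  col-alone {i} {x} n₁ n₂ n₃ n₄ h with position i | position x
  ... | lower-◱ e | _ = ⊥-elim (n₃ e)
  ... | lower-◲ e | _ = ⊥-elim (n₄ e)
  ... | upper lt | upper lt' = Fₚ.toℕ-injective (trans (sym (col-upper lt')) (trans h (col-upper lt)))
  ... | upper lt | lower-◱ refl = ⊥-elim (n₁ (Fₚ.toℕ-injective (trans (sym (col-upper lt)) (trans (sym h) (trans col-◱ (sym to-◰))))))
  ... | upper lt | lower-◲ refl = ⊥-elim (n₂ (Fₚ.toℕ-injective (trans (sym (col-upper lt)) (trans (sym h) (trans col-◲ (sym to-◳))))))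

  -- A row permutation preserves the two-element second row, so it neither creates nor destroys the
  -- edge formed by it.
  row-step : ∀ {p Z} → p ∈ R → IsMatching Z → lookup (act p Z) ◱ ≡ ◲ → lookup Z ◱ ≡ ◲
  row-step {p} {Z} p∈ MZ h with ∈stabilizer⁻ row p∈
  ... | ip , fix with surj ip ◱
  ... | a , pa = edge (row-one (trans (sym (fix a)) (trans (cong row pa) row-◱)))
                      (row-one (trans (sym (fix (lookup Z a))) (trans (cong row pZa) row-◲)))
    where
    pZa : lookup p (lookup Z a) ≡ ◲
    pZa = trans (sym (act-lookup ip Z a)) (trans (cong (lookup (act p Z)) pa) h)
    edge : a ≡ ◱ ⊎ a ≡ ◲ → lookup Z a ≡ ◱ ⊎ lookup Z a ≡ ◲ → lookup Z ◱ ≡ ◲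
    edge (inj₁ refl) (inj₁ e) = ⊥-elim (fpf MZ ◱ e)
    edge (inj₁ refl) (inj₂ e) = e
    edge (inj₂ refl) (inj₁ e) = trans (cong (lookup Z) (sym e)) (inv MZ ◲)
    edge (inj₂ refl) (inj₂ e) = ⊥-elim (fpf MZ ◲ e)

  private
    distinct : ∀ {x y : Fin m} {a b} → toℕ x ≡ a → toℕ y ≡ b → a ≢ b → x ≢ y
    distinct refl refl n refl = n refl
    ◰≢◳ : ◰ ≢ ◳
    ◰≢◳ = distinct to-◰ to-◳ (λ ())
    ◰≢◱ : ◰ ≢ ◱
    ◰≢◱ = distinct to-◰ to-◱ (ℕₚ.<⇒≢ 0<l)
    ◰≢◲ : ◰ ≢ ◲
    ◰≢◲ = distinct to-◰ to-◲ (λ ())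
    ◳≢◱ : ◳ ≢ ◱
    ◳≢◱ = distinct to-◳ to-◱ (ℕₚ.<⇒≢ 1<l)
    ◳≢◲ : ◳ ≢ ◲
    ◳≢◲ = distinct to-◳ to-◲ (λ e → ℕₚ.<⇒≢ 0<l (ℕₚ.suc-injective e))
    ◱≢◲ : ◱ ≢ ◲
    ◱≢◲ e = ℕₚ.1+n≢n (trans (sym to-◲) (trans (cong toℕ (sym e)) to-◱))

  -- The column group has four elements; those whose image of P₀ has the edge ◱◲ are even.
  column-step : ∀ {q} → q ∈ C → lookup (act q P₀) ◱ ≡ ◲ → sgn q ≡ 1ℚ
  column-step {q} q∈ h with ∈stabilizer⁻ col q∈
  ... | iq , fix with surj iq ◱
  ... | a , qa = by-preimage (col-zero (trans (sym (fix a)) (trans (cong col qa) col-◱)))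
    where
    qP₀a : lookup q (lookup P₀ a) ≡ ◲
    qP₀a = trans (sym (act-lookup iq P₀ a)) (trans (cong (lookup (act q P₀)) qa) h)
    q-◰ : lookup q ◰ ≡ ◰ ⊎ lookup q ◰ ≡ ◱
    q-◰ = col-zero (trans (fix ◰) (trans (col-upper (subst (ℕ._< l) (sym to-◰) 0<l)) to-◰))
    q-◱ : lookup q ◱ ≡ ◰ ⊎ lookup q ◱ ≡ ◱
    q-◱ = col-zero (trans (fix ◱) col-◱)
    q-◳ : lookup q ◳ ≡ ◳ ⊎ lookup q ◳ ≡ ◲
    q-◳ = col-one (trans (fix ◳) (trans (col-upper (subst (ℕ._< l) (sym to-◳) 1<l)) to-◳))
    q-◲ : lookup q ◲ ≡ ◳ ⊎ lookup q ◲ ≡ ◲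
    q-◲ = col-one (trans (fix ◲) col-◲)
    other : ∀ {x y s t : Fin m} → s ≢ t → lookup q t ≡ y → lookup q s ≡ x ⊎ lookup q s ≡ y → lookup q s ≡ x
    other n e (inj₁ e') = e'
    other n e (inj₂ e') = ⊥-elim (n (inj iq (trans e' (sym e))))
    extend : ∀ {σ : Perm m} → lookup q ◰ ≡ lookup σ ◰ → lookup q ◳ ≡ lookup σ ◳ → lookup q ◱ ≡ lookup σ ◱ → lookup q ◲ ≡ lookup σ ◲ →
      (∀ i → i ≢ ◰ → i ≢ ◳ → i ≢ ◱ → i ≢ ◲ → lookup σ i ≡ i) → q ≡ σ
    extend e₁ e₂ e₃ e₄ e₅ = Vec-ext λ i → case-of i
      where
      case-of : ∀ i → _
      case-of i with i ≟ᶠ ◰ | i ≟ᶠ ◳ | i ≟ᶠ ◱ | i ≟ᶠ ◲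
      ... | yes refl | _ | _ | _ = e₁
      ... | no _ | yes refl | _ | _ = e₂
      ... | no _ | no _ | yes refl | _ = e₃
      ... | no _ | no _ | no _ | yes refl = e₄
      ... | no n₁ | no n₂ | no n₃ | no n₄ = trans (col-alone n₁ n₂ n₃ n₄ (fix i)) (sym (e₅ i n₁ n₂ n₃ n₄))
    by-preimage : a ≡ ◰ ⊎ a ≡ ◱ → sgn q ≡ 1ℚ
    by-preimage (inj₂ refl) = trans (cong sgn (extend {identity m}
        (to (other ◰≢◱ qa q-◰)) (to (other ◳≢◲ e q-◳)) (to qa) (to e) (λ i _ _ _ _ → lookup-identity i))) (sgn-identity {m})
      where
      e : lookup q ◲ ≡ ◲
      e = trans (cong (lookup q) (sym P₀-◱)) qP₀a
      to : ∀ {i} → lookup q i ≡ i → lookup q i ≡ lookup (identity m) i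
      to {i} e = trans e (sym (lookup-identity i))
    by-preimage (inj₁ refl) = trans (cong sgn (extend {σ}
        (trans qa (sym (σ-lookup ◰ (trans (cong (sw ◰ ◱) (sw-o ◰≢◳ ◰≢◲)) (sw-l ◰ ◱)))))
        (trans e (sym (σ-lookup ◳ (trans (cong (sw ◰ ◱) (sw-l ◳ ◲)) (sw-o (◰≢◲ ∘ sym) (◱≢◲ ∘ sym))))))
        (trans (other (◰≢◱ ∘ sym) qa q-◱) (sym (σ-lookup ◱ (trans (cong (sw ◰ ◱) (sw-o (◳≢◱ ∘ sym) ◱≢◲)) (sw-r ◰ ◱)))))
        (trans (other (◳≢◲ ∘ sym) e q-◲) (sym (σ-lookup ◲ (trans (cong (sw ◰ ◱) (sw-r ◳ ◲)) (sw-o (◰≢◳ ∘ sym) ◳≢◱)))))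
        (λ i n₁ n₂ n₃ n₄ → σ-lookup i (trans (cong (sw ◰ ◱) (sw-o n₂ n₄)) (sw-o n₁ n₃)))))
      (trans (sgn-tr (∘-isPerm (tr-isPerm ◳ ◲) identity-isPerm) ◰≢◱) (trans (cong -_ (sgn-tr identity-isPerm ◳≢◲)) (cong (λ s → - (- s)) (sgn-identity {m}))))
      where
      σ : Perm m
      σ = tr ◰ ◱ ∘ₚ (tr ◳ ◲ ∘ₚ identity m)
      σ-lookup : ∀ i {x} → sw ◰ ◱ (sw ◳ ◲ i) ≡ x → lookup σ i ≡ x
      σ-lookup i h = trans (lookup-tr∘ ◰ ◱ (tr ◳ ◲ ∘ₚ identity m) i)
        (trans (cong (sw ◰ ◱) (trans (lookup-tr∘ ◳ ◲ (identity m) i) (cong (sw ◳ ◲) (lookup-identity i)))) h)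
      e : lookup q ◳ ≡ ◲
      e = trans (cong (lookup q) (sym P₀-◰)) qP₀a

  edge : Fun m
  edge Z = 𝟙 (lookup Z ◱ ==ᶠ ◲)

  -- The isotypic form allows one function for each g; keeping only g = 1 leaves a single Young
  -- symmetrizer.
  u : Perm m → Fun m
  u g Z = 𝟙 (g ==ᵥ identity m) * edge Z

  w : Fun m
  w P = Σℚ (allPerms m) (λ g → Σℚ C (λ q → Σℚ R (λ p → sgn q * u g (act p (act q (act g P))))))

  isotypic : InIsotypic m ν w
  isotypic = u , λ P _ → refl

  private
    summand : Perm m → Perm m → Perm m → ℚ
    summand g q p = sgn q * u g (act p (act q (act g P₀)))

    summand≥0 : ∀ g q p → q ∈ C → p ∈ R → 0ℚ ≤ℚ summand g q p
    summand≥0 g q p q∈ p∈ with g ==ᵥ identity m in eg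
    ... | false = ℚₚ.≤-reflexive (lem (sgn q) (edge (act p (act q (act g P₀)))))
      where
      lem : ∀ x y → 0ℚ ≡ x * (0ℚ * y)
      lem = solve-∀ ℚ-ring
    ... | true with ==ᵥ⇒≡ {P = g} eg
    ... | refl = subst (λ Z → 0ℚ ≤ℚ sgn q * (1ℚ * edge (act p (act q Z)))) (sym (act-identity P₀)) (by-edge _ refl)
      where
      by-edge : ∀ b → (lookup (act p (act q P₀)) ◱ ==ᶠ ◲) ≡ b → 0ℚ ≤ℚ sgn q * (1ℚ * 𝟙 b)
      by-edge false _ = ℚₚ.≤-reflexive (sym (ℚₚ.*-zeroʳ (sgn q)))
      by-edge true e = subst (λ s → 0ℚ ≤ℚ s * 1ℚ) (sym (column-step q∈ (row-step p∈ (act-matching (proj₁ (∈stabilizer⁻ col q∈)) P₀-matching) (==ᶠ⇒≡ e)))) (0≤𝟙 true)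

    identity∈ : (f : Fin m → ℕ) → identity m ∈ filterᵇ (Shape.stabilizes m ν f) (allPerms m)
    identity∈ f = ∈stabilizer⁺ f identity-isPerm (λ k → cong f (lookup-identity k))

    summand-1 : summand (identity m) (identity m) (identity m) ≡ 1ℚ
    summand-1 = begin
      summand (identity m) (identity m) (identity m)
        ≡⟨ cong (λ Z → sgn (identity m) * (𝟙 (identity m ==ᵥ identity m) * edge Z)) (trans (act-identity _) (trans (act-identity _) (act-identity P₀))) ⟩
      sgn (identity m) * (𝟙 (identity m ==ᵥ identity m) * edge P₀)
        ≡⟨ cong₂ (λ s t → s * (t * edge P₀)) (sgn-identity {m}) (cong 𝟙 (==ᵥ-refl (identity m))) ⟩
      1ℚ * (1ℚ * edge P₀) ≡⟨ cong (λ t → 1ℚ * (1ℚ * 𝟙 t)) (trans (cong (_==ᶠ ◲) P₀-◱) (==ᶠ-refl ◲)) ⟩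
      1ℚ ∎

  -- By `row-step` and `column-step` every nonzero summand has sign 1, so none is negative, and the
  -- summand at three identities equals 1.
  1≤w : 1ℚ ≤ℚ w P₀
  1≤w = subst (_≤ℚ w P₀) summand-1
    (ℚₚ.≤-trans (Σ-≥term∈ R (summand (identity m) (identity m)) (λ p p∈ → summand≥0 (identity m) (identity m) p (identity∈ col) p∈) (identity∈ row))
    (ℚₚ.≤-trans (Σ-≥term∈ C (λ q → Σℚ R (summand (identity m) q)) (λ q q∈ → Σ-≥0∈ R (summand (identity m) q) (λ p p∈ → summand≥0 (identity m) q p q∈ p∈)) (identity∈ col))
      (Σ-≥term∈ (allPerms m) (λ g → Σℚ C (λ q → Σℚ R (summand g q)))
        (λ g _ → Σ-≥0∈ C (λ q → Σℚ R (summand g q)) (λ q q∈ → Σ-≥0∈ R (summand g q) (λ p p∈ → summand≥0 g q p q∈ p∈))) (∈allPerms identity-isPerm))))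

  w≢0 : w P₀ ≢ 0ℚ
  w≢0 e = ℚₚ.<-irrefl refl (ℚₚ.<-≤-trans (ℚₚ.positive⁻¹ 1ℚ) (subst (1ℚ ≤ℚ_) e 1≤w))

-- From scalars on components to eigenvalues

cancel-scale : ∀ {a b x} → x ≢ 0ℚ → a * x ≡ b * x → a ≡ b
cancel-scale {a} {b} {x} x≢0 h = trans (sym (divide a)) (trans (cong (_* ℚ.1/ x) h) (divide b))
  where
  instance _ = ℚ.≢-nonZero x≢0
  divide : ∀ c → c * x * ℚ.1/ x ≡ c
  divide c = trans (ℚₚ.*-assoc c x (ℚ.1/ x)) (trans (cong (c *_) (ℚₚ.*-inverseʳ x)) (ℚₚ.*-identityʳ c))

cancel-eight : ∀ {x y} → ⟦ 8 ⟧ * x ≡ ⟦ 8 ⟧ * y → x ≡ y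
cancel-eight {x} {y} h = cancel-scale {x} {y} {⟦ 8 ⟧} (λ ()) (trans (ℚₚ.*-comm x ⟦ 8 ⟧) (trans h (ℚₚ.*-comm ⟦ 8 ⟧ y)))

-- The scalar is the same on the whole component, so one matching with `w P` nonzero determines φ.
eigenvalue-value : ∀ j ν (ν⊢ : ν ⊢ (4 ℕ.+ j)) φ → IsEigenvalue (4 ℕ.+ j) ν (2 ∷ 2 ∷ replicate j 1) φ →
  ⟦ 8 ⟧ * φ ≡ Eigenvalue.eightfold j ν ν⊢
eigenvalue-value j ν ν⊢ φ (w , iso , (P , P∈ , w≢0) , eq) = cancel-scale {⟦ 8 ⟧ * φ} {Eigenvalue.eightfold j ν ν⊢} {w P} w≢0 (begin
  ⟦ 8 ⟧ * φ * w P                          ≡⟨ ℚₚ.*-assoc ⟦ 8 ⟧ φ (w P) ⟩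
  ⟦ 8 ⟧ * (φ * w P)                        ≡⟨ cong (⟦ 8 ⟧ *_) (sym (eq P P∈)) ⟩
  ⟦ 8 ⟧ * Amul (2 ∷ 2 ∷ replicate j 1) w P ≡⟨ Eigenvalue.Amul-scalar j ν ν⊢ w iso P∈ ⟩
  Eigenvalue.eightfold j ν ν⊢ * w P ∎)

one-row-⊢ : ∀ n → 1 ℕ.≤ n → (n ∷ []) ⊢ n
one-row-⊢ n h = _ , h ∷ [] , ℕₚ.+-identityʳ n

near-row-⊢ : ∀ j → ((3 ℕ.+ j) ∷ 1 ∷ []) ⊢ (4 ℕ.+ j)
near-row-⊢ j = (ℕ.s≤s ℕ.z≤n , _) , ℕ.s≤s ℕ.z≤n ∷ ℕ.s≤s ℕ.z≤n ∷ [] , ℕₚ.+-comm (3 ℕ.+ j) 1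

-- `Amul-scalar` makes every vector of the component satisfy the eigenvalue equation; what has to be
-- supplied is a nonzero one.
near-row-eigenvalue : ∀ j φ → ⟦ 8 ⟧ * φ ≡ bound₈ ℚ[ 4 ℕ.+ j ] →
  IsEigenvalue (4 ℕ.+ j) ((3 ℕ.+ j) ∷ 1 ∷ []) (2 ∷ 2 ∷ replicate j 1) φ
near-row-eigenvalue j φ h = W.w , W.isotypic , (W.P₀ , ∈matchings W.P₀-matching , W.w≢0) , λ P P∈ → cancel-eight (begin
  ⟦ 8 ⟧ * Amul (2 ∷ 2 ∷ replicate j 1) W.w P ≡⟨ Eigenvalue.Amul-scalar j ν ν⊢ W.w W.isotypic P∈ ⟩
  Eigenvalue.eightfold j ν ν⊢ * W.w P       ≡⟨ cong (_* W.w P) (trans (NearRow.value (2 ℕ.+ j) (Eigenvalue.D₁ j ν ν⊢)) (sym h)) ⟩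
  ⟦ 8 ⟧ * φ * W.w P                        ≡⟨ ℚₚ.*-assoc ⟦ 8 ⟧ φ (W.w P) ⟩
  ⟦ 8 ⟧ * (φ * W.w P) ∎)
  where
  ν : List ℕ
  ν = (3 ℕ.+ j) ∷ 1 ∷ []
  ν⊢ = near-row-⊢ j
  module W = Witness (2 ℕ.* (4 ℕ.+ j)) (2 ℕ.* (3 ℕ.+ j)) (ℕₚ.*-suc 2 (3 ℕ.+ j))
    (subst (1 ℕ.<_) (sym (ℕₚ.*-suc 2 (2 ℕ.+ j))) (ℕ.s≤s (ℕ.s≤s ℕ.z≤n))) (mate-double (3 ℕ.+ j)) (mate-< (4 ℕ.+ j))

open import Data.Nat using (_≤_; _∸_)
open import Data.Integer using (+_)
open import Data.Rational using (_/_)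

bound₈≡ : ∀ N → ⟦ 8 ⟧ * (½ * N * N * N * N - ⟦ 5 ⟧ * N * N * N + (+ 33 / 2) * N * N - ⟦ 20 ⟧ * N + ⟦ 6 ⟧) ≡
  ⟦ 4 ⟧ * N * N * N * N - ⟦ 40 ⟧ * N * N * N + ⟦ 132 ⟧ * N * N - ⟦ 160 ⟧ * N + ⟦ 48 ⟧
bound₈≡ = solve-∀ ℚ-ring

theorem4p5 : (n : ℕ) → 6 ≤ n →
    IsEigenvalue n (n ∸ 1 ∷ 1 ∷ []) (2 ∷ 2 ∷ replicate (n ∸ 4) 1)
    (½ * ℚ[ n ] * ℚ[ n ] * ℚ[ n ] * ℚ[ n ] - ℚ[ 5 ] * ℚ[ n ] * ℚ[ n ] * ℚ[ n ]
    + (+ 33 / 2) * ℚ[ n ] * ℚ[ n ] - ℚ[ 20 ] * ℚ[ n ] + ℚ[ 6 ])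
    × (∀ (λ' : List ℕ) → λ' ⊢ n → λ' ≢ n ∷ [] → ∀ (φ : ℚ) →
    IsEigenvalue n λ' (2 ∷ 2 ∷ replicate (n ∸ 4) 1) φ →
    φ ≤ℚ (½ * ℚ[ n ] * ℚ[ n ] * ℚ[ n ] * ℚ[ n ] - ℚ[ 5 ] * ℚ[ n ] * ℚ[ n ] * ℚ[ n ]
    + (+ 33 / 2) * ℚ[ n ] * ℚ[ n ] - ℚ[ 20 ] * ℚ[ n ] + ℚ[ 6 ]))
    × (∀ (φ : ℚ) → IsEigenvalue n (n ∷ []) (2 ∷ 2 ∷ replicate (n ∸ 4) 1) φ →
    φ - (½ * ℚ[ n ] * ℚ[ n ] * ℚ[ n ] * ℚ[ n ] - ℚ[ 5 ] * ℚ[ n ] * ℚ[ n ] * ℚ[ n ]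
    + (+ 33 / 2) * ℚ[ n ] * ℚ[ n ] - ℚ[ 20 ] * ℚ[ n ] + ℚ[ 6 ])
    ≡ ℚ[ 2 ] * ℚ[ n ] * ℚ[ n ] * ℚ[ n ] - ℚ[ 11 ] * ℚ[ n ] * ℚ[ n ]
    + ℚ[ 17 ] * ℚ[ n ] - ℚ[ 6 ])
-- Writing n as 4 + j makes both truncated subtractions compute and turns n ≥ 6 into j ≥ 2.
theorem4p5 (suc (suc (suc (suc j)))) (ℕ.s≤s (ℕ.s≤s (ℕ.s≤s (ℕ.s≤s j≥2)))) =
  near-row-eigenvalue j b (bound₈≡ N) , second , gap
  where
  N b : ℚ
  N = ℚ[ 4 ℕ.+ j ]
  -- Closed literals such as `ℚ[ 5 ]` evaluate to `⟦ 5 ⟧`, so this is the polynomial of the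
  -- statement by computation, in a form cheap for the ring solver.
  b = ½ * N * N * N * N - ⟦ 5 ⟧ * N * N * N + (+ 33 / 2) * N * N - ⟦ 20 ⟧ * N + ⟦ 6 ⟧
  eighth : ∀ x y → ½ * ½ * ½ * (⟦ 8 ⟧ * x - ⟦ 8 ⟧ * y) ≡ x - y
  eighth = solve-∀ ℚ-ring
  second : ∀ ν → ν ⊢ (4 ℕ.+ j) → ν ≢ (4 ℕ.+ j) ∷ [] → ∀ φ → IsEigenvalue (4 ℕ.+ j) ν (2 ∷ 2 ∷ replicate j 1) φ → φ ≤ℚ b
  second ν ν⊢ ν≢ φ eig = 0≤q-p⇒p≤q (subst (0ℚ ≤ℚ_) (eighth b φ) (0≤* (ℚₚ.nonNegative⁻¹ (½ * ½ * ½))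
    (subst (0ℚ ≤ℚ_) (cong₂ _-_ (sym (bound₈≡ N)) (sym (eigenvalue-value j ν ν⊢ φ eig))) (value≤bound j j≥2 ν ν⊢ ν≢))))
  gap : ∀ φ → IsEigenvalue (4 ℕ.+ j) ((4 ℕ.+ j) ∷ []) (2 ∷ 2 ∷ replicate j 1) φ →
    φ - b ≡ ⟦ 2 ⟧ * N * N * N - ⟦ 11 ⟧ * N * N + ⟦ 17 ⟧ * N - ⟦ 6 ⟧
  gap φ eig = begin
    φ - b                                       ≡⟨ sym (eighth φ b) ⟩
    ½ * ½ * ½ * (⟦ 8 ⟧ * φ - ⟦ 8 ⟧ * b)       ≡⟨ cong₂ (λ x y → ½ * ½ * ½ * (x - y)) (trans (eigenvalue-value j ((4 ℕ.+ j) ∷ []) ν⊢ φ eig) (OneRow.value _ (Eigenvalue.D₁ j _ ν⊢))) (bound₈≡ N) ⟩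
    _                                           ≡⟨ lem N ⟩
    ⟦ 2 ⟧ * N * N * N - ⟦ 11 ⟧ * N * N + ⟦ 17 ⟧ * N - ⟦ 6 ⟧ ∎
    where
    ν⊢ = one-row-⊢ (4 ℕ.+ j) (ℕ.s≤s ℕ.z≤n)
    lem : ∀ N → ½ * ½ * ½ * ((⟦ 4 ⟧ * N * N * N * N - ⟦ 24 ⟧ * N * N * N + ⟦ 44 ⟧ * N * N - ⟦ 24 ⟧ * N)
        - (⟦ 4 ⟧ * N * N * N * N - ⟦ 40 ⟧ * N * N * N + ⟦ 132 ⟧ * N * N - ⟦ 160 ⟧ * N + ⟦ 48 ⟧))
      ≡ ⟦ 2 ⟧ * N * N * N - ⟦ 11 ⟧ * N * N + ⟦ 17 ⟧ * N - ⟦ 6 ⟧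
    lem = solve-∀ ℚ-ring
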